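{- There is an absolute constant $c>0$ such that for every $n\ge 2$, every probability vector $\mathbf{p}=(p_1,\dots,p_n)$ with all $p_i>0$, and every $N$ for which $\log^{(n-2)}N$ is well defined and at least $1$, there exists a (randomized) algorithm for the perturbed rank guessing game with parameters $n,N,\mathbf{p}$ whose expected reward, against every strategy of the adversary, is at least $$1+\frac{1}{(6n)^{7n}}\cdot\frac{c}{\log^{(n-2)}N}.$$
   Context: $\log^{(m)}(x)=\log\log\cdots\log x$ denotes the $m$-fold iterated base-2 logarithm, with $\log^{(0)}x=x$. Perturbed rank guessing game. Given $n$, $N$ and a probability distribution $\mathbf{p}=(p_1,\dots,p_n)$ on $[n]=\{1,\dots,n\}$, the adversary chooses a set $S\subseteq[N]$ of $n$ integers $s_1<s_2<\dots<s_n$ with $s_i-s_{i-1}\ge 20$ for all $i\ge 2$. A random index $i$ is drawn with probability $p_i$ and $s_i$ is deleted from $S$. Seeing the remaining $n-1$ numbers, the adversary may modify each of them by $+1$, $-1$ or $0$, and shows the modified numbers $\widetilde{S}$ to the algorithm. The algorithm (which knows $n,N,\mathbf{p}$ and sees only $\widetilde{S}$) guesses the index of the deleted number. If the guess is correct, i.e. equals the deleted index $i$, the reward is $1/p_i$; otherwise the reward is $0$. -}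

module Defs where

open import Data.Empty using (⊥-elim)
open import Data.Sum using (inj₁; inj₂)
open import Data.Unit using (⊤)
open import Data.Product using (Σ; ∃; _×_; _,_; proj₁; proj₂)
open import Data.Nat as ℕ using (ℕ; zero; suc; ⌊_/2⌋)
import Data.Nat.Properties as ℕₚ
open import Data.Nat.Logarithm using (⌊log₂_⌋; ⌊log₂⌋-mono-≤; ⌊log₂⌊n/2⌋⌋≡⌊log₂n⌋∸1; ⌊log₂[2^n]⌋≡n)
import Data.Nat.Solver as ℕSolver
open import Data.Integer as ℤ using (ℤ; +_)
import Data.Integer.Properties as ℤₚ
open import Data.Rational
open import Data.Rational.Properties
open import Data.Rational.Solver using (module +-*-Solver)
import Data.Rational.Unnormalised as ℚᵘ
import Data.Rational.Unnormalised.Properties as ℚᵘₚ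
open import Data.Fin as Fin using (Fin; inject₁)
open import Data.Vec using (Vec; lookup; removeAt)
open import Data.Vec.Functional using (foldr)
open import Data.Bool using (if_then_else_)
open import Relation.Nullary using (yes; no; does)
open import Relation.Binary.PropositionalEquality
  using (_≡_; refl; sym; trans; cong; cong₂; subst; subst₂)

ι : ℕ → ℚ
ι n = + n / 1

abs : ℚ → ℚ
abs = ∣_∣

ι-toℚᵘ : ∀ n → toℚᵘ (ι n) ℚᵘ.≃ ℚᵘ.mkℚᵘ (+ n) 0
ι-toℚᵘ n = toℚᵘ-fromℚᵘ (ℚᵘ.mkℚᵘ (+ n) 0)

ι-+ : ∀ m n → ι (m ℕ.+ n) ≡ ι m + ι n
ι-+ m n = toℚᵘ-injective (begin
  toℚᵘ (ι (m ℕ.+ n))                           ≈⟨ ι-toℚᵘ (m ℕ.+ n) ⟩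
  ℚᵘ.mkℚᵘ (+ (m ℕ.+ n)) 0                      ≈⟨ ℚᵘ.*≡* (cong (ℤ._* + 1) (cong₂ ℤ._+_ (sym (ℤₚ.*-identityʳ (+ m))) (sym (ℤₚ.*-identityʳ (+ n))))) ⟩
  ℚᵘ.mkℚᵘ (+ m) 0 ℚᵘ.+ ℚᵘ.mkℚᵘ (+ n) 0         ≈⟨ ℚᵘₚ.+-cong (ℚᵘₚ.≃-sym (ι-toℚᵘ m)) (ℚᵘₚ.≃-sym (ι-toℚᵘ n)) ⟩
  toℚᵘ (ι m) ℚᵘ.+ toℚᵘ (ι n)                   ≈⟨ ℚᵘₚ.≃-sym (toℚᵘ-homo-+ (ι m) (ι n)) ⟩
  toℚᵘ (ι m + ι n)                             ∎)
  where open import Relation.Binary.Reasoning.Setoid ℚᵘₚ.≃-setoid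

ι-* : ∀ m n → ι (m ℕ.* n) ≡ ι m * ι n
ι-* m n = toℚᵘ-injective (begin
  toℚᵘ (ι (m ℕ.* n))                           ≈⟨ ι-toℚᵘ (m ℕ.* n) ⟩
  ℚᵘ.mkℚᵘ (+ (m ℕ.* n)) 0                      ≈⟨ ℚᵘ.*≡* (cong (ℤ._* + 1) (ℤₚ.pos-* m n)) ⟩
  ℚᵘ.mkℚᵘ (+ m) 0 ℚᵘ.* ℚᵘ.mkℚᵘ (+ n) 0         ≈⟨ ℚᵘₚ.*-cong (ℚᵘₚ.≃-sym (ι-toℚᵘ m)) (ℚᵘₚ.≃-sym (ι-toℚᵘ n)) ⟩
  toℚᵘ (ι m) ℚᵘ.* toℚᵘ (ι n)                   ≈⟨ ℚᵘₚ.≃-sym (toℚᵘ-homo-* (ι m) (ι n)) ⟩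
  toℚᵘ (ι m * ι n)                             ∎)
  where open import Relation.Binary.Reasoning.Setoid ℚᵘₚ.≃-setoid

ι-mono-≤ : ∀ {m n} → m ℕ.≤ n → ι m ≤ ι n
ι-mono-≤ {m} {n} m≤n = toℚᵘ-cancel-≤
  (ℚᵘₚ.≤-respˡ-≃ (ℚᵘₚ.≃-sym (ι-toℚᵘ m)) (ℚᵘₚ.≤-respʳ-≃ (ℚᵘₚ.≃-sym (ι-toℚᵘ n))
    (ℚᵘ.*≤* (ℤₚ.*-monoʳ-≤-nonNeg (+ 1) (ℤ.+≤+ m≤n)))))

ι-mono-< : ∀ {m n} → m ℕ.< n → ι m < ι n
ι-mono-< {m} {n} m<n = toℚᵘ-cancel-<
  (ℚᵘₚ.<-respˡ-≃ (ℚᵘₚ.≃-sym (ι-toℚᵘ m)) (ℚᵘₚ.<-respʳ-≃ (ℚᵘₚ.≃-sym (ι-toℚᵘ n))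
    (ℚᵘ.*<* (ℤₚ.*-monoʳ-<-pos (+ 1) (ℤ.+<+ m<n)))))

ι-cancel-≤ : ∀ {m n} → ι m ≤ ι n → m ℕ.≤ n
ι-cancel-≤ {m} {n} ιm≤ιn with m ℕ.≤? n
... | yes m≤n = m≤n
... | no  m≰n = ⊥-elim (<-irrefl refl (<-≤-trans (ι-mono-< (ℕₚ.≰⇒> m≰n)) ιm≤ιn))

0≤ι : ∀ n → 0ℚ ≤ ι n
0≤ι n = ι-mono-≤ {0} {n} ℕ.z≤n

+-cancelʳ-≤ : ∀ r {p q} → p + r ≤ q + r → p ≤ q
+-cancelʳ-≤ r {p} {q} h = subst₂ _≤_ (lem p) (lem q) (+-monoˡ-≤ (- r) h)
  where
  open +-*-Solver
  lem : ∀ p → p + r + - r ≡ p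
  lem p = solve 2 (λ p r → p :+ r :+ :- r := p) refl p r

*-monoˡ : ∀ {r} p q → 0ℚ ≤ r → p ≤ q → r * p ≤ r * q
*-monoˡ {r} p q 0≤r p≤q = *-monoˡ-≤-nonNeg r {{nonNegative 0≤r}} p≤q

*-mono : ∀ p q r s → 0ℚ ≤ r → 0ℚ ≤ q → p ≤ q → r ≤ s → p * r ≤ q * s
*-mono p q r s 0≤r 0≤q p≤q r≤s =
  ≤-trans (*-monoʳ-≤-nonNeg r {{nonNegative 0≤r}} p≤q) (*-monoˡ-≤-nonNeg q {{nonNegative 0≤q}} r≤s)

0<* : ∀ {p q} → 0ℚ < p → 0ℚ < q → 0ℚ < p * q
0<* {p} {q} 0<p 0<q = positive⁻¹ (p * q) {{pos*pos⇒pos p {{positive 0<p}} q {{positive 0<q}}}}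

0<+ : ∀ {p q} → 0ℚ < p → 0ℚ < q → 0ℚ < p + q
0<+ = +-mono-<

0<½* : ∀ {p} → 0ℚ < p → 0ℚ < ½ * p
0<½* = 0<* (positive⁻¹ ½)

½+½ : ∀ p → ½ * p + ½ * p ≡ p
½+½ p = trans (sym (*-distribʳ-+ p ½ ½)) (*-identityˡ p)

-- The reciprocal, extended by the value 0 at 0.
inv : ℚ → ℚ
inv q with q ≟ 0ℚ
... | yes _   = 0ℚ
... | no  q≢0 = (1/ q) {{≢-nonZero q≢0}}

inv-* : ∀ {q} → 0ℚ < q → inv q * q ≡ 1ℚ
inv-* {q} 0<q with q ≟ 0ℚ
... | yes q≡0 = ⊥-elim (<-irrefl (sym q≡0) 0<q)
... | no  q≢0 = *-inverseˡ q {{≢-nonZero q≢0}}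

0<inv : ∀ {q} → 0ℚ < q → 0ℚ < inv q
0<inv {q} 0<q with q ≟ 0ℚ
... | yes q≡0 = ⊥-elim (<-irrefl (sym q≡0) 0<q)
... | no  q≢0 = positive⁻¹ _ {{1/pos⇒pos q {{positive 0<q}}}}

inv-anti : ∀ {p q} → 0ℚ < p → p ≤ q → inv q ≤ inv p
inv-anti {p} {q} 0<p p≤q = subst₂ _≤_ eq₁ eq₂ (*-monoˡ p q (<⇒≤ (0<* (0<inv 0<p) (0<inv 0<q))) p≤q)
  where
  open +-*-Solver
  0<q = <-≤-trans 0<p p≤q
  eq₁ : inv p * inv q * p ≡ inv q
  eq₁ = trans (solve 3 (λ p a b → a :* b :* p := (a :* p) :* b) refl p (inv p) (inv q))
              (trans (cong (_* inv q) (inv-* 0<p)) (*-identityˡ (inv q)))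
  eq₂ : inv p * inv q * q ≡ inv p
  eq₂ = trans (*-assoc (inv p) (inv q) q) (trans (cong (inv p *_) (inv-* 0<q)) (*-identityʳ (inv p)))

abs-≤ : ∀ {p q r} → p ≤ q + r → q ≤ p + r → ∣ p - q ∣ ≤ r
abs-≤ {p} {q} {r} p≤ q≤ with ∣p∣≡p∨∣p∣≡-p (p - q)
... | inj₁ e = subst (_≤ r) (sym e)
  (+-cancelʳ-≤ q (subst₂ _≤_ (solve 2 (λ p q → p := p :- q :+ q) refl p q) (+-comm q r) p≤))
  where open +-*-Solver
... | inj₂ e = subst (_≤ r) (sym e)
  (+-cancelʳ-≤ p (subst₂ _≤_ (solve 2 (λ p q → q := :- (p :- q) :+ p) refl p q) (+-comm p r) q≤))
  where open +-*-Solver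

≤-abs : ∀ p → p ≤ ∣ p ∣
≤-abs p with ≤-total 0ℚ p
... | inj₁ 0≤p = ≤-reflexive (sym (0≤p⇒∣p∣≡p 0≤p))
... | inj₂ p≤0 = ≤-trans p≤0 (0≤∣p∣ p)

abs-≤ˡ : ∀ {p q r} → ∣ p - q ∣ ≤ r → p ≤ q + r
abs-≤ˡ {p} {q} {r} h = subst₂ _≤_ (solve 2 (λ p q → p :- q :+ q := p) refl p q) (+-comm r q)
  (+-monoˡ-≤ q (≤-trans (≤-abs (p - q)) h))
  where open +-*-Solver

⌊log₂⌋≡0⇒<2 : ∀ n → ⌊log₂ n ⌋ ≡ 0 → n ℕ.< 2
⌊log₂⌋≡0⇒<2 n e with n ℕ.<? 2
... | yes n<2 = n<2
... | no  n≮2 = ⊥-elim (ℕₚ.<-irrefl refl (ℕₚ.≤-trans (⌊log₂⌋-mono-≤ (ℕₚ.≮⇒≥ n≮2)) (ℕₚ.≤-reflexive e)))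

n<2+2⌊n/2⌋ : ∀ n → n ℕ.< 2 ℕ.+ 2 ℕ.* ⌊ n /2⌋
n<2+2⌊n/2⌋ 0 = ℕ.s≤s ℕ.z≤n
n<2+2⌊n/2⌋ 1 = ℕ.s≤s (ℕ.s≤s ℕ.z≤n)
n<2+2⌊n/2⌋ (suc (suc n)) = subst (suc (suc n) ℕ.<_)
  (ℕSolver.+-*-Solver.solve 1 (λ h → con 2 :+ (con 2 :+ con 2 :* h) := con 2 :+ con 2 :* (con 1 :+ h)) refl ⌊ n /2⌋)
  (ℕ.s≤s (ℕ.s≤s (n<2+2⌊n/2⌋ n)))
  where open ℕSolver.+-*-Solver

2⌊n/2⌋≤n : ∀ n → 2 ℕ.* ⌊ n /2⌋ ℕ.≤ n
2⌊n/2⌋≤n 0 = ℕ.z≤n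
2⌊n/2⌋≤n 1 = ℕ.z≤n
2⌊n/2⌋≤n (suc (suc n)) = subst (ℕ._≤ suc (suc n))
  (ℕSolver.+-*-Solver.solve 1 (λ h → con 2 :+ con 2 :* h := con 2 :* (con 1 :+ h)) refl ⌊ n /2⌋)
  (ℕ.s≤s (ℕ.s≤s (2⌊n/2⌋≤n n)))
  where open ℕSolver.+-*-Solver

⌊log₂⌋-bounds : ∀ k n → ⌊log₂ n ⌋ ≡ k → 0 ℕ.< n → (2 ℕ.^ k ℕ.≤ n) × (n ℕ.< 2 ℕ.^ suc k)
⌊log₂⌋-bounds zero n e 0<n = 0<n , ⌊log₂⌋≡0⇒<2 n e
⌊log₂⌋-bounds (suc k) n e 0<n = ℕₚ.≤-trans (ℕₚ.*-monoʳ-≤ 2 (proj₁ ih)) (2⌊n/2⌋≤n n)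
  , ℕₚ.<-≤-trans (n<2+2⌊n/2⌋ n) (subst (ℕ._≤ 2 ℕ.^ suc (suc k)) (ℕₚ.*-suc 2 ⌊ n /2⌋) (ℕₚ.*-monoʳ-≤ 2 (proj₂ ih)))
  where
  e′ : ⌊log₂ ⌊ n /2⌋ ⌋ ≡ k
  e′ = trans (⌊log₂⌊n/2⌋⌋≡⌊log₂n⌋∸1 n) (cong (ℕ._∸ 1) e)
  2≤n : ∀ n → 0 ℕ.< n → ⌊log₂ n ⌋ ≡ suc k → 2 ℕ.≤ n
  2≤n (suc zero) _ e with trans (sym e) (⌊log₂[2^n]⌋≡n 0)
  ... | ()
  2≤n (suc (suc n)) _ _ = ℕ.s≤s (ℕ.s≤s ℕ.z≤n)
  ih = ⌊log₂⌋-bounds k ⌊ n /2⌋ e′ (ℕₚ.⌊n/2⌋-mono (2≤n n 0<n e))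

2^⌊log₂n⌋≤n : ∀ n → 0 ℕ.< n → 2 ℕ.^ ⌊log₂ n ⌋ ℕ.≤ n
2^⌊log₂n⌋≤n n 0<n = proj₁ (⌊log₂⌋-bounds _ n refl 0<n)

n<2^[1+⌊log₂n⌋] : ∀ n → 0 ℕ.< n → n ℕ.< 2 ℕ.^ suc ⌊log₂ n ⌋
n<2^[1+⌊log₂n⌋] n 0<n = proj₂ (⌊log₂⌋-bounds _ n refl 0<n)

2^-cancel-≤ : ∀ {a b} → 2 ℕ.^ a ℕ.≤ 2 ℕ.^ b → a ℕ.≤ b
2^-cancel-≤ {a} {b} h with a ℕ.≤? b
... | yes a≤b = a≤b
... | no  a≰b = ⊥-elim (ℕₚ.<-irrefl refl (ℕₚ.<-≤-trans (ℕₚ.^-monoʳ-< 2 (ℕ.s≤s (ℕ.s≤s ℕ.z≤n)) (ℕₚ.≰⇒> a≰b)) h))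

^-distribʳ-* : ∀ m n o → (m ℕ.* n) ℕ.^ o ≡ m ℕ.^ o ℕ.* n ℕ.^ o
^-distribʳ-* m n zero    = refl
^-distribʳ-* m n (suc o) = trans (cong (m ℕ.* n ℕ.*_) (^-distribʳ-* m n o))
  (ℕSolver.+-*-Solver.solve 4 (λ m n a b → m :* n :* (a :* b) := m :* a :* (n :* b)) refl m n (m ℕ.^ o) (n ℕ.^ o))
  where open ℕSolver.+-*-Solver

-- (1 + 1/h)ʲ ≤ h/(h−j), with h = j + d.
bernoulli : ∀ h j d → d ℕ.+ j ≡ h → d ℕ.* suc h ℕ.^ j ℕ.≤ h ℕ.* h ℕ.^ j
bernoulli h zero d e = ℕₚ.*-monoˡ-≤ 1 (subst (d ℕ.≤_) e (ℕₚ.m≤m+n d 0))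
bernoulli h (suc j) d e = begin
  d ℕ.* (suc h ℕ.* suc h ℕ.^ j)   ≡⟨ sym (ℕₚ.*-assoc d (suc h) _) ⟩
  d ℕ.* suc h ℕ.* suc h ℕ.^ j     ≤⟨ ℕₚ.*-monoˡ-≤ (suc h ℕ.^ j) step ⟩
  h ℕ.* suc d ℕ.* suc h ℕ.^ j     ≡⟨ ℕₚ.*-assoc h (suc d) _ ⟩
  h ℕ.* (suc d ℕ.* suc h ℕ.^ j)   ≤⟨ ℕₚ.*-monoʳ-≤ h (bernoulli h j (suc d) (trans (sym (ℕₚ.+-suc d j)) e)) ⟩
  h ℕ.* (h ℕ.* h ℕ.^ j)           ∎
  where
  open ℕₚ.≤-Reasoning
  d≤h : d ℕ.≤ h
  d≤h = subst (d ℕ.≤_) e (ℕₚ.m≤m+n d (suc j))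
  step : d ℕ.* suc h ℕ.≤ h ℕ.* suc d
  step = begin
    d ℕ.* suc h     ≡⟨ ℕₚ.*-suc d h ⟩
    d ℕ.+ d ℕ.* h   ≤⟨ ℕₚ.+-mono-≤ d≤h (ℕₚ.≤-reflexive (ℕₚ.*-comm d h)) ⟩
    h ℕ.+ h ℕ.* d   ≡⟨ sym (ℕₚ.*-suc h d) ⟩
    h ℕ.* suc d     ∎

[1+2k]^k≤2[2k]^k : ∀ k → 0 ℕ.< k → suc (2 ℕ.* k) ℕ.^ k ℕ.≤ 2 ℕ.* (2 ℕ.* k) ℕ.^ k
[1+2k]^k≤2[2k]^k k@(suc _) _ = ℕₚ.*-cancelˡ-≤ k (subst (k ℕ.* suc (2 ℕ.* k) ℕ.^ k ℕ.≤_)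
  (ℕSolver.+-*-Solver.solve 2 (λ k x → con 2 :* k :* x := k :* (con 2 :* x)) refl k ((2 ℕ.* k) ℕ.^ k))
  (bernoulli (2 ℕ.* k) k k (cong (k ℕ.+_) (sym (ℕₚ.+-identityʳ k)))))
  where open ℕSolver.+-*-Solver

-- If p/q ≤ (s/t)(1 + 1/2k), then log₂ (p/q) ≤ log₂ (s/t) + 1/k; here A, B, C, D are
-- the truncated logarithms of pᵐ, qᵐ, sⁿ, tⁿ, and denominators have been cleared.
log-ratio : ∀ p q s t k m n → 0 ℕ.< p → 0 ℕ.< q → 0 ℕ.< s → 0 ℕ.< t → 0 ℕ.< k →
  p ℕ.* t ℕ.* (2 ℕ.* k) ℕ.≤ s ℕ.* q ℕ.* suc (2 ℕ.* k) →
  let A = ⌊log₂ p ℕ.^ m ⌋ ; B = ⌊log₂ q ℕ.^ m ⌋ ; C = ⌊log₂ s ℕ.^ n ⌋ ; D = ⌊log₂ t ℕ.^ n ⌋ in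
  A ℕ.* (n ℕ.* k) ℕ.+ D ℕ.* (m ℕ.* k) ℕ.≤
  m ℕ.* n ℕ.+ (suc C ℕ.* (m ℕ.* k) ℕ.+ suc B ℕ.* (n ℕ.* k))
log-ratio p@(suc _) q@(suc _) s@(suc _) t@(suc _) k@(suc _) m n 0<p 0<q 0<s 0<t 0<k ratio =
  2^-cancel-≤ (begin
    2 ℕ.^ (A ℕ.* (n ℕ.* k) ℕ.+ D ℕ.* (m ℕ.* k))
      ≡⟨ ℕₚ.^-distribˡ-+-* 2 (A ℕ.* (n ℕ.* k)) _ ⟩
    2 ℕ.^ (A ℕ.* (n ℕ.* k)) ℕ.* 2 ℕ.^ (D ℕ.* (m ℕ.* k))
      ≤⟨ ℕₚ.*-mono-≤ (low p m (n ℕ.* k)) (low t n (m ℕ.* k)) ⟩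
    p ℕ.^ (m ℕ.* (n ℕ.* k)) ℕ.* t ℕ.^ (n ℕ.* (m ℕ.* k))
      ≡⟨ cong₂ (λ a b → p ℕ.^ a ℕ.* t ℕ.^ b) e₁ e₂ ⟩
    p ℕ.^ (k ℕ.* (m ℕ.* n)) ℕ.* t ℕ.^ (k ℕ.* (m ℕ.* n))
      ≡⟨ merge p t ⟩
    ((p ℕ.* t) ℕ.^ k) ℕ.^ (m ℕ.* n)
      ≤⟨ ℕₚ.^-monoˡ-≤ (m ℕ.* n) powered ⟩
    (2 ℕ.* (s ℕ.* q) ℕ.^ k) ℕ.^ (m ℕ.* n)
      ≡⟨ ^-distribʳ-* 2 ((s ℕ.* q) ℕ.^ k) (m ℕ.* n) ⟩
    2 ℕ.^ (m ℕ.* n) ℕ.* ((s ℕ.* q) ℕ.^ k) ℕ.^ (m ℕ.* n)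
      ≡⟨ cong (2 ℕ.^ (m ℕ.* n) ℕ.*_) (sym (merge s q)) ⟩
    2 ℕ.^ (m ℕ.* n) ℕ.* (s ℕ.^ (k ℕ.* (m ℕ.* n)) ℕ.* q ℕ.^ (k ℕ.* (m ℕ.* n)))
      ≡⟨ cong₂ (λ a b → 2 ℕ.^ (m ℕ.* n) ℕ.* (s ℕ.^ a ℕ.* q ℕ.^ b)) (sym e₂) (sym e₁) ⟩
    2 ℕ.^ (m ℕ.* n) ℕ.* (s ℕ.^ (n ℕ.* (m ℕ.* k)) ℕ.* q ℕ.^ (m ℕ.* (n ℕ.* k)))
      ≤⟨ ℕₚ.*-monoʳ-≤ (2 ℕ.^ (m ℕ.* n)) (ℕₚ.*-mono-≤ (high s n (m ℕ.* k)) (high q m (n ℕ.* k))) ⟩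
    2 ℕ.^ (m ℕ.* n) ℕ.* (2 ℕ.^ (suc C ℕ.* (m ℕ.* k)) ℕ.* 2 ℕ.^ (suc B ℕ.* (n ℕ.* k)))
      ≡⟨ cong (2 ℕ.^ (m ℕ.* n) ℕ.*_) (sym (ℕₚ.^-distribˡ-+-* 2 (suc C ℕ.* (m ℕ.* k)) _)) ⟩
    2 ℕ.^ (m ℕ.* n) ℕ.* 2 ℕ.^ (suc C ℕ.* (m ℕ.* k) ℕ.+ suc B ℕ.* (n ℕ.* k))
      ≡⟨ sym (ℕₚ.^-distribˡ-+-* 2 (m ℕ.* n) _) ⟩
    2 ℕ.^ (m ℕ.* n ℕ.+ (suc C ℕ.* (m ℕ.* k) ℕ.+ suc B ℕ.* (n ℕ.* k))) ∎)
  where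
  open ℕₚ.≤-Reasoning
  A = ⌊log₂ p ℕ.^ m ⌋
  B = ⌊log₂ q ℕ.^ m ⌋
  C = ⌊log₂ s ℕ.^ n ⌋
  D = ⌊log₂ t ℕ.^ n ⌋
  e₁ : m ℕ.* (n ℕ.* k) ≡ k ℕ.* (m ℕ.* n)
  e₁ = solve 3 (λ m n k → m :* (n :* k) := k :* (m :* n)) refl m n k
    where open ℕSolver.+-*-Solver
  e₂ : n ℕ.* (m ℕ.* k) ≡ k ℕ.* (m ℕ.* n)
  e₂ = solve 3 (λ m n k → n :* (m :* k) := k :* (m :* n)) refl m n k
    where open ℕSolver.+-*-Solver
  low : ∀ x a b .{{_ : ℕ.NonZero x}} → 2 ℕ.^ (⌊log₂ x ℕ.^ a ⌋ ℕ.* b) ℕ.≤ x ℕ.^ (a ℕ.* b)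
  low x a b = subst₂ ℕ._≤_ (ℕₚ.^-*-assoc 2 ⌊log₂ x ℕ.^ a ⌋ b) (ℕₚ.^-*-assoc x a b)
    (ℕₚ.^-monoˡ-≤ b (2^⌊log₂n⌋≤n (x ℕ.^ a) (ℕₚ.m^n>0 x a)))
  high : ∀ x a b .{{_ : ℕ.NonZero x}} → x ℕ.^ (a ℕ.* b) ℕ.≤ 2 ℕ.^ (suc ⌊log₂ x ℕ.^ a ⌋ ℕ.* b)
  high x a b = subst₂ ℕ._≤_ (ℕₚ.^-*-assoc x a b) (ℕₚ.^-*-assoc 2 (suc ⌊log₂ x ℕ.^ a ⌋) b)
    (ℕₚ.^-monoˡ-≤ b (ℕₚ.<⇒≤ (n<2^[1+⌊log₂n⌋] (x ℕ.^ a) (ℕₚ.m^n>0 x a))))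
  merge : ∀ x y → x ℕ.^ (k ℕ.* (m ℕ.* n)) ℕ.* y ℕ.^ (k ℕ.* (m ℕ.* n)) ≡ ((x ℕ.* y) ℕ.^ k) ℕ.^ (m ℕ.* n)
  merge x y = trans (sym (^-distribʳ-* x y (k ℕ.* (m ℕ.* n)))) (sym (ℕₚ.^-*-assoc (x ℕ.* y) k (m ℕ.* n)))
  powered : (p ℕ.* t) ℕ.^ k ℕ.≤ 2 ℕ.* (s ℕ.* q) ℕ.^ k
  powered = ℕₚ.*-cancelʳ-≤ _ _ ((2 ℕ.* k) ℕ.^ k) {{ℕₚ.m^n≢0 (2 ℕ.* k) k}} (begin
    (p ℕ.* t) ℕ.^ k ℕ.* (2 ℕ.* k) ℕ.^ k              ≡⟨ sym (^-distribʳ-* (p ℕ.* t) (2 ℕ.* k) k) ⟩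
    (p ℕ.* t ℕ.* (2 ℕ.* k)) ℕ.^ k                    ≤⟨ ℕₚ.^-monoˡ-≤ k ratio ⟩
    (s ℕ.* q ℕ.* suc (2 ℕ.* k)) ℕ.^ k                ≡⟨ ^-distribʳ-* (s ℕ.* q) (suc (2 ℕ.* k)) k ⟩
    (s ℕ.* q) ℕ.^ k ℕ.* suc (2 ℕ.* k) ℕ.^ k          ≤⟨ ℕₚ.*-monoʳ-≤ ((s ℕ.* q) ℕ.^ k) ([1+2k]^k≤2[2k]^k k 0<k) ⟩
    (s ℕ.* q) ℕ.^ k ℕ.* (2 ℕ.* (2 ℕ.* k) ℕ.^ k)      ≡⟨ swap ((s ℕ.* q) ℕ.^ k) ((2 ℕ.* k) ℕ.^ k) ⟩
    2 ℕ.* (s ℕ.* q) ℕ.^ k ℕ.* (2 ℕ.* k) ℕ.^ k        ∎)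
    where
    swap : ∀ x y → x ℕ.* (2 ℕ.* y) ≡ 2 ℕ.* x ℕ.* y
    swap = solve 2 (λ x y → x :* (con 2 :* y) := con 2 :* x :* y) refl
      where open ℕSolver.+-*-Solver

IsCauchy : (ℕ → ℚ) → Set
IsCauchy s = ∀ ε → 0ℚ < ε → ∃ λ M → ∀ m n → M ℕ.≤ m → M ℕ.≤ n → ∣ s m - s n ∣ ≤ ε

record ℝ : Set where
  constructor mkℝ
  field
    seq    : ℕ → ℚ
    cauchy : IsCauchy seq
open ℝ public

infix 4 _<ℝ_ _≤ℝ_ _≃ℝ_

_<ℝ_ : ℝ → ℝ → Set
x <ℝ y = ∃ λ ε → 0ℚ < ε × ∃ λ M → ∀ n → M ℕ.≤ n → seq x n + ε ≤ seq y n

_≤ℝ_ : ℝ → ℝ → Set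
x ≤ℝ y = ∀ ε → 0ℚ < ε → ∃ λ M → ∀ n → M ℕ.≤ n → seq x n ≤ seq y n + ε

_≃ℝ_ : ℝ → ℝ → Set
x ≃ℝ y = x ≤ℝ y × y ≤ℝ x

fromℚ : ℚ → ℝ
fromℚ q = mkℝ (λ _ → q) (λ ε 0<ε → 0 , λ _ _ _ _ →
  subst (_≤ ε) (sym (cong ∣_∣ (+-inverseʳ q))) (<⇒≤ 0<ε))

fromℕ : ℕ → ℝ
fromℕ n = fromℚ (ι n)

0ℝ 1ℝ : ℝ
0ℝ = fromℚ 0ℚ
1ℝ = fromℚ 1ℚ

infixl 6 _+ℝ_
infixl 7 _*ℝ_

_+ℝ_ : ℝ → ℝ → ℝ
mkℝ x cx +ℝ mkℝ y cy = mkℝ (λ n → x n + y n) cs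
  where
  cs : IsCauchy (λ n → x n + y n)
  cs ε 0<ε with cx (½ * ε) (0<½* 0<ε) | cy (½ * ε) (0<½* 0<ε)
  ... | M , hx | M′ , hy = M ℕ.⊔ M′ , λ m n m≥ n≥ → begin
    ∣ x m + y m - (x n + y n) ∣      ≡⟨ cong ∣_∣ (lem (x m) (y m) (x n) (y n)) ⟩
    ∣ (x m - x n) + (y m - y n) ∣    ≤⟨ ∣p+q∣≤∣p∣+∣q∣ (x m - x n) (y m - y n) ⟩
    ∣ x m - x n ∣ + ∣ y m - y n ∣    ≤⟨ +-mono-≤
                                          (hx m n (ℕₚ.m⊔n≤o⇒m≤o M M′ m≥) (ℕₚ.m⊔n≤o⇒m≤o M M′ n≥))
                                          (hy m n (ℕₚ.m⊔n≤o⇒n≤o M M′ m≥) (ℕₚ.m⊔n≤o⇒n≤o M M′ n≥)) ⟩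
    ½ * ε + ½ * ε                    ≡⟨ ½+½ ε ⟩
    ε                                ∎
    where
    open ≤-Reasoning
    lem : ∀ a b c d → a + b - (c + d) ≡ (a - c) + (b - d)
    lem = solve 4 (λ a b c d → a :+ b :- (c :+ d) := (a :- c) :+ (b :- d)) refl
      where open +-*-Solver

bounded : ∀ s → IsCauchy s → ∃ λ B → 0ℚ < B × ∃ λ M → ∀ n → M ℕ.≤ n → ∣ s n ∣ ≤ B
bounded s c with c 1ℚ (positive⁻¹ 1ℚ)
... | M , h = 1ℚ + ∣ s M ∣ , +-mono-<-≤ (positive⁻¹ 1ℚ) (0≤∣p∣ (s M)) , M , λ n n≥ → begin
  ∣ s n ∣                     ≡⟨ cong ∣_∣ (lem (s n) (s M)) ⟩
  ∣ (s n - s M) + s M ∣       ≤⟨ ∣p+q∣≤∣p∣+∣q∣ (s n - s M) (s M) ⟩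
  ∣ s n - s M ∣ + ∣ s M ∣     ≤⟨ +-monoˡ-≤ ∣ s M ∣ (h n M n≥ ℕₚ.≤-refl) ⟩
  1ℚ + ∣ s M ∣                ∎
  where
  open ≤-Reasoning
  lem : ∀ a b → a ≡ (a - b) + b
  lem = solve 2 (λ a b → a := (a :- b) :+ b) refl
    where open +-*-Solver

*-close : ∀ B B′ ε a b c d → 0ℚ < B → 0ℚ < B′ → abs a ≤ B → abs d ≤ B′ →
  abs (b - d) ≤ ½ * (inv B * ε) → abs (a - c) ≤ ½ * (inv B′ * ε) → abs (a * b - c * d) ≤ ε
*-close B B′ ε a b c d 0<B 0<B′ a≤ d≤ b-d≤ a-c≤ = begin
  abs (a * b - c * d)                              ≡⟨ cong abs (lem a b c d) ⟩
  abs (a * (b - d) + d * (a - c))                  ≤⟨ ∣p+q∣≤∣p∣+∣q∣ (a * (b - d)) (d * (a - c)) ⟩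
  abs (a * (b - d)) + abs (d * (a - c))            ≡⟨ cong₂ _+_ (∣p*q∣≡∣p∣*∣q∣ a (b - d)) (∣p*q∣≡∣p∣*∣q∣ d (a - c)) ⟩
  abs a * abs (b - d) + abs d * abs (a - c)
    ≤⟨ +-mono-≤
         (*-mono (abs a) B (abs (b - d)) (½ * (inv B * ε)) (0≤∣p∣ (b - d)) (<⇒≤ 0<B) a≤ b-d≤)
         (*-mono (abs d) B′ (abs (a - c)) (½ * (inv B′ * ε)) (0≤∣p∣ (a - c)) (<⇒≤ 0<B′) d≤ a-c≤) ⟩
  B * (½ * (inv B * ε)) + B′ * (½ * (inv B′ * ε))  ≡⟨ cong₂ _+_ (halve B 0<B) (halve B′ 0<B′) ⟩
  ½ * ε + ½ * ε                                    ≡⟨ ½+½ ε ⟩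
  ε                                                ∎
  where
  open ≤-Reasoning
  lem : ∀ a b c d → a * b - c * d ≡ a * (b - d) + d * (a - c)
  lem = solve 4 (λ a b c d → a :* b :- c :* d := a :* (b :- d) :+ d :* (a :- c)) refl
    where open +-*-Solver
  rearrange : ∀ b h i e → b * (h * (i * e)) ≡ i * b * (h * e)
  rearrange = solve 4 (λ b h i e → b :* (h :* (i :* e)) := i :* b :* (h :* e)) refl
    where open +-*-Solver
  halve : ∀ B → 0ℚ < B → B * (½ * (inv B * ε)) ≡ ½ * ε
  halve B 0<B = trans (rearrange B ½ (inv B) ε)
    (trans (cong (_* (½ * ε)) (inv-* 0<B)) (*-identityˡ (½ * ε)))

_*ℝ_ : ℝ → ℝ → ℝ
mkℝ x cx *ℝ mkℝ y cy = mkℝ (λ n → x n * y n) cs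
  where
  cs : IsCauchy (λ n → x n * y n)
  cs ε 0<ε =
    let B  , 0<B  , M₁ , hB  = bounded x cx
        B′ , 0<B′ , M₂ , hB′ = bounded y cy
        M₃ , hy = cy (½ * (inv B * ε)) (0<½* (0<* (0<inv 0<B) 0<ε))
        M₄ , hx = cx (½ * (inv B′ * ε)) (0<½* (0<* (0<inv 0<B′) 0<ε))
        M₁₂ = M₁ ℕ.⊔ M₂
        M₃₄ = M₃ ℕ.⊔ M₄
    in M₁₂ ℕ.⊔ M₃₄ , λ m n m≥ n≥ →
    let m≥₁₂ = ℕₚ.m⊔n≤o⇒m≤o M₁₂ M₃₄ m≥
        m≥₃₄ = ℕₚ.m⊔n≤o⇒n≤o M₁₂ M₃₄ m≥
        n≥₁₂ = ℕₚ.m⊔n≤o⇒m≤o M₁₂ M₃₄ n≥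
        n≥₃₄ = ℕₚ.m⊔n≤o⇒n≤o M₁₂ M₃₄ n≥
    in *-close B B′ ε (x m) (y m) (x n) (y n) 0<B 0<B′
         (hB m (ℕₚ.m⊔n≤o⇒m≤o M₁ M₂ m≥₁₂)) (hB′ n (ℕₚ.m⊔n≤o⇒n≤o M₁ M₂ n≥₁₂))
         (hy m n (ℕₚ.m⊔n≤o⇒m≤o M₃ M₄ m≥₃₄) (ℕₚ.m⊔n≤o⇒m≤o M₃ M₄ n≥₃₄))
         (hx m n (ℕₚ.m⊔n≤o⇒n≤o M₃ M₄ m≥₃₄) (ℕₚ.m⊔n≤o⇒n≤o M₃ M₄ n≥₃₄))

inv-close : ∀ δ ε a b → 0ℚ < δ → δ ≤ a → δ ≤ b → abs (b - a) ≤ ε * (δ * δ) → abs (inv a - inv b) ≤ ε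
inv-close δ ε a b 0<δ δ≤a δ≤b close = begin
  abs (inv a - inv b)
    ≡⟨ cong abs (sym (trans (lem (inv a) (inv b) a b)
         (cong₂ _-_ (trans (cong (inv a *_) (inv-* 0<b)) (*-identityʳ (inv a)))
                    (trans (cong (inv b *_) (inv-* 0<a)) (*-identityʳ (inv b)))))) ⟩
  abs (w * (b - a))                       ≡⟨ ∣p*q∣≡∣p∣*∣q∣ w (b - a) ⟩
  abs w * abs (b - a)                     ≡⟨ cong (_* abs (b - a)) (0≤p⇒∣p∣≡p (<⇒≤ (0<* (0<inv 0<a) (0<inv 0<b)))) ⟩
  w * abs (b - a)
    ≤⟨ *-mono w (inv δ * inv δ) (abs (b - a)) (ε * (δ * δ)) (0≤∣p∣ (b - a)) (<⇒≤ (0<* (0<inv 0<δ) (0<inv 0<δ)))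
         (*-mono (inv a) (inv δ) (inv b) (inv δ) (<⇒≤ (0<inv 0<b)) (<⇒≤ (0<inv 0<δ)) (inv-anti 0<δ δ≤a) (inv-anti 0<δ δ≤b))
         close ⟩
  inv δ * inv δ * (ε * (δ * δ))           ≡⟨ rearrange (inv δ) ε δ ⟩
  ε * (inv δ * δ) * (inv δ * δ)           ≡⟨ cong₂ (λ a b → ε * a * b) (inv-* 0<δ) (inv-* 0<δ) ⟩
  ε * 1ℚ * 1ℚ                             ≡⟨ trans (*-identityʳ (ε * 1ℚ)) (*-identityʳ ε) ⟩
  ε                                       ∎
  where
  open ≤-Reasoning
  w   = inv a * inv b
  0<a = <-≤-trans 0<δ δ≤a
  0<b = <-≤-trans 0<δ δ≤b
  lem : ∀ i j a b → i * j * (b - a) ≡ i * (j * b) - j * (i * a)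
  lem = solve 4 (λ i j a b → i :* j :* (b :- a) := i :* (j :* b) :- j :* (i :* a)) refl
    where open +-*-Solver
  rearrange : ∀ i e d → i * i * (e * (d * d)) ≡ e * (i * d) * (i * d)
  rearrange = solve 3 (λ i e d → i :* i :* (e :* (d :* d)) := e :* (i :* d) :* (i :* d)) refl
    where open +-*-Solver

-- Positivity of x bounds its sequence away from 0 from some index on, so the value of
-- inv at 0 is irrelevant.
recip : (x : ℝ) → 0ℝ <ℝ x → ℝ
recip (mkℝ x cx) (δ , 0<δ , M₀ , h₀) = mkℝ (λ n → inv (x n)) cs
  where
  cs : IsCauchy (λ n → inv (x n))
  cs ε 0<ε =
    let M₁ , h₁ = cx (ε * (δ * δ)) (0<* 0<ε (0<* 0<δ 0<δ))
    in M₀ ℕ.⊔ M₁ , λ m n m≥ n≥ →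
    inv-close δ ε (x m) (x n) 0<δ
      (subst (_≤ x m) (+-identityˡ δ) (h₀ m (ℕₚ.m⊔n≤o⇒m≤o M₀ M₁ m≥)))
      (subst (_≤ x n) (+-identityˡ δ) (h₀ n (ℕₚ.m⊔n≤o⇒m≤o M₀ M₁ n≥)))
      (h₁ n m (ℕₚ.m⊔n≤o⇒n≤o M₀ M₁ n≥) (ℕₚ.m⊔n≤o⇒n≤o M₀ M₁ m≥))

<ℝ-≤ℝ-trans : ∀ x y z → x <ℝ y → y ≤ℝ z → x <ℝ z
<ℝ-≤ℝ-trans x y z (ε , 0<ε , M , h) y≤z with y≤z (½ * ε) (0<½* 0<ε)
... | M′ , h′ = ½ * ε , 0<½* 0<ε , M ℕ.⊔ M′ , λ n n≥ → +-cancelʳ-≤ (½ * ε) (begin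
  seq x n + ½ * ε + ½ * ε     ≡⟨ trans (+-assoc (seq x n) _ _) (cong (_+_ (seq x n)) (½+½ ε)) ⟩
  seq x n + ε                 ≤⟨ h n (ℕₚ.m⊔n≤o⇒m≤o M M′ n≥) ⟩
  seq y n                     ≤⟨ h′ n (ℕₚ.m⊔n≤o⇒n≤o M M′ n≥) ⟩
  seq z n + ½ * ε             ∎)
  where open ≤-Reasoning

0<1ℝ : 0ℝ <ℝ 1ℝ
0<1ℝ = 1ℚ , positive⁻¹ 1ℚ , 0 , λ _ _ → ≤-reflexive (+-identityˡ 1ℚ)

1≤⇒0< : ∀ x → 1ℝ ≤ℝ x → 0ℝ <ℝ x
1≤⇒0< x = <ℝ-≤ℝ-trans 0ℝ 1ℝ x 0<1ℝ

∑ : ∀ {n} → (Fin n → ℝ) → ℝ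
∑ = foldr _+ℝ_ 0ℝ

/-* : ∀ a b .{{_ : ℕ.NonZero b}} → (+ a / b) * ι b ≡ ι a
/-* a b@(suc d) = toℚᵘ-injective (begin
  toℚᵘ ((+ a / b) * ι b)                    ≈⟨ toℚᵘ-homo-* (+ a / b) (ι b) ⟩
  toℚᵘ (+ a / b) ℚᵘ.* toℚᵘ (ι b)            ≈⟨ ℚᵘₚ.*-cong (toℚᵘ-fromℚᵘ (ℚᵘ.mkℚᵘ (+ a) d)) (ι-toℚᵘ b) ⟩
  ℚᵘ.mkℚᵘ (+ a) d ℚᵘ.* ℚᵘ.mkℚᵘ (+ b) 0      ≈⟨ ℚᵘ.*≡* (trans (ℤₚ.*-assoc (+ a) (+ b) (+ 1)) (cong (λ z → + a ℤ.* z) (trans (ℤₚ.*-identityʳ (+ b)) (cong +_ (sym (ℕₚ.*-identityʳ b)))))) ⟩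
  ℚᵘ.mkℚᵘ (+ a) 0                           ≈⟨ ℚᵘₚ.≃-sym (ι-toℚᵘ a) ⟩
  toℚᵘ (ι a)                                ∎)
  where open import Relation.Binary.Reasoning.Setoid ℚᵘₚ.≃-setoid

-- For b → ∞ this tends to log₂ r when r > 0: writing r = p/q in lowest terms it is
-- ⌊log₂ pᵇ⌋/b − ⌊log₂ qᵇ⌋/b, and each quotient is within 1/b of log₂ p, log₂ q.
log-approx : (b : ℕ) .{{_ : ℕ.NonZero b}} → ℚ → ℚ
log-approx b r = + ⌊log₂ ℤ.∣ ↥ r ∣ ℕ.^ b ⌋ / b - + ⌊log₂ ↧ₙ r ℕ.^ b ⌋ / b

/-inv : ∀ a b .{{_ : ℕ.NonZero b}} → + a / b ≡ ι a * inv (ι b)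
/-inv a b = trans (sym (trans (cong ((+ a / b) *_) (trans (*-comm (ι b) (inv (ι b))) (inv-* 0<b))) (*-identityʳ (+ a / b))))
  (trans (sym (*-assoc (+ a / b) (ι b) (inv (ι b)))) (cong (_* inv (ι b)) (/-* a b)))
  where
  0<b : 0ℚ < ι b
  0<b = ι-mono-< (ℕ.>-nonZero⁻¹ b)

numerator-eq : ∀ u → 0ℚ < u → u * ι (↧ₙ u) ≡ ι ℤ.∣ ↥ u ∣
numerator-eq u 0<u = go u (positive 0<u)
  where
  go : ∀ u → Positive u → u * ι (↧ₙ u) ≡ ι ℤ.∣ ↥ u ∣
  go u@(mkℚ (+ n) d c) _ = trans (cong (_* ι (suc d)) (sym (↥p/↧p≡p u))) (/-* n (suc d))

0<numerator : ∀ u → 0ℚ < u → 0 ℕ.< ℤ.∣ ↥ u ∣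
0<numerator u 0<u = go u (positive 0<u)
  where
  go : ∀ u → Positive u → 0 ℕ.< ℤ.∣ ↥ u ∣
  go (mkℚ (+ suc n) d c) _ = ℕ.s≤s ℕ.z≤n

0<denominator : ∀ u → 0 ℕ.< ↧ₙ u
0<denominator u@record{} = ℕ.s≤s ℕ.z≤n

ratio-ℕ : ∀ u v k → 0ℚ < u → 0ℚ < v → u * ι (2 ℕ.* k) ≤ v * ι (suc (2 ℕ.* k)) →
  ℤ.∣ ↥ u ∣ ℕ.* ↧ₙ v ℕ.* (2 ℕ.* k) ℕ.≤ ℤ.∣ ↥ v ∣ ℕ.* ↧ₙ u ℕ.* suc (2 ℕ.* k)
ratio-ℕ u v k 0<u 0<v h = ι-cancel-≤ (begin
  ι (p ℕ.* t ℕ.* (2 ℕ.* k))          ≡⟨ trans (ι-* (p ℕ.* t) (2 ℕ.* k)) (cong (_* K) (ι-* p t)) ⟩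
  ι p * ι t * K                      ≡⟨ cong (λ x → x * ι t * K) (sym (numerator-eq u 0<u)) ⟩
  u * ι q * ι t * K                  ≡⟨ swap₁ u (ι q) (ι t) K ⟩
  ι q * ι t * (u * K)                ≤⟨ *-monoˡ (u * K) (v * K′) 0≤qt h ⟩
  ι q * ι t * (v * K′)               ≡⟨ swap₂ v (ι q) (ι t) K′ ⟩
  v * ι t * ι q * K′                 ≡⟨ cong (λ x → x * ι q * K′) (numerator-eq v 0<v) ⟩
  ι s * ι q * K′                     ≡⟨ sym (trans (ι-* (s ℕ.* q) (suc (2 ℕ.* k))) (cong (_* K′) (ι-* s q))) ⟩
  ι (s ℕ.* q ℕ.* suc (2 ℕ.* k))      ∎)
  where
  open ≤-Reasoning
  p = ℤ.∣ ↥ u ∣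
  q = ↧ₙ u
  s = ℤ.∣ ↥ v ∣
  t = ↧ₙ v
  K = ι (2 ℕ.* k)
  K′ = ι (suc (2 ℕ.* k))
  0≤qt : 0ℚ ≤ ι q * ι t
  0≤qt = subst (0ℚ ≤_) (ι-* q t) (0≤ι (q ℕ.* t))
  swap₁ : ∀ u q t k → u * q * t * k ≡ q * t * (u * k)
  swap₁ = solve 4 (λ u q t k → u :* q :* t :* k := q :* t :* (u :* k)) refl
    where open +-*-Solver
  swap₂ : ∀ v q t k → q * t * (v * k) ≡ v * t * q * k
  swap₂ = solve 4 (λ v q t k → q :* t :* (v :* k) := v :* t :* q :* k) refl
    where open +-*-Solver

-- The inequality of log-ratio, divided by m n k.
divide : ∀ a b c d m n k μ ν κ → 0ℚ ≤ μ → 0ℚ ≤ ν → 0ℚ ≤ κ → μ * m ≡ 1ℚ → ν * n ≡ 1ℚ → κ * k ≡ 1ℚ →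
  a * (n * k) + d * (m * k) ≤ m * n + ((1ℚ + c) * (m * k) + (1ℚ + b) * (n * k)) →
  a * μ - b * μ ≤ c * ν - d * ν + (κ + μ + ν)
divide a b c d m n k μ ν κ 0≤μ 0≤ν 0≤κ μm νn κk h = +-cancelʳ-≤ (b * μ + d * ν) (begin
  a * μ - b * μ + (b * μ + d * ν)                         ≡⟨ tidyˡ a b d μ ν ⟩
  a * μ + d * ν                                           ≡⟨ sym (cong₂ _+_ (collapse a μ νn κk) (collapse d ν μm κk)) ⟩
  a * μ * ((ν * n) * (κ * k)) + d * ν * ((μ * m) * (κ * k)) ≡⟨ sym (trans (*-distribˡ-+ w (a * (n * k)) (d * (m * k))) (cong₂ _+_ (r₁ a n k μ ν κ) (r₂ d m k μ ν κ))) ⟩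
  w * (a * (n * k) + d * (m * k))                         ≤⟨ *-monoˡ _ _ 0≤w h ⟩
  w * (m * n + ((1ℚ + c) * (m * k) + (1ℚ + b) * (n * k)))
    ≡⟨ trans (*-distribˡ-+ w (m * n) _) (cong₂ _+_ (r₃ m n μ ν κ)
         (trans (*-distribˡ-+ w ((1ℚ + c) * (m * k)) ((1ℚ + b) * (n * k)))
                (cong₂ _+_ (r₂ (1ℚ + c) m k μ ν κ) (r₁ (1ℚ + b) n k μ ν κ)))) ⟩
  κ * ((μ * m) * (ν * n)) + ((1ℚ + c) * ν * ((μ * m) * (κ * k)) + (1ℚ + b) * μ * ((ν * n) * (κ * k)))
    ≡⟨ cong₂ _+_ (collapse₁ κ μm νn) (cong₂ _+_ (collapse (1ℚ + c) ν μm κk) (collapse (1ℚ + b) μ νn κk)) ⟩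
  κ + ((1ℚ + c) * ν + (1ℚ + b) * μ)                       ≡⟨ cong (λ z → κ + z) (cong₂ _+_ (unit c ν) (unit b μ)) ⟩
  κ + ((ν + c * ν) + (μ + b * μ))                         ≡⟨ tidyʳ (c * ν) (b * μ) (d * ν) κ μ ν ⟩
  c * ν - d * ν + (κ + μ + ν) + (b * μ + d * ν)           ∎)
  where
  open ≤-Reasoning
  w = μ * ν * κ
  0≤w : 0ℚ ≤ w
  0≤w = nonNegative⁻¹ w {{nonNeg*nonNeg⇒nonNeg (μ * ν) {{nonNeg*nonNeg⇒nonNeg μ {{nonNegative 0≤μ}} ν {{nonNegative 0≤ν}}}} κ {{nonNegative 0≤κ}}}}
  collapse₁ : ∀ x {y z} → y ≡ 1ℚ → z ≡ 1ℚ → x * (y * z) ≡ x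
  collapse₁ x y≡1 z≡1 = trans (cong₂ (λ y z → x * (y * z)) y≡1 z≡1) (*-identityʳ x)
  collapse : ∀ x x′ {y z} → y ≡ 1ℚ → z ≡ 1ℚ → x * x′ * (y * z) ≡ x * x′
  collapse x x′ = collapse₁ (x * x′)
  unit : ∀ x y → (1ℚ + x) * y ≡ y + x * y
  unit x y = trans (*-distribʳ-+ y 1ℚ x) (cong (_+ x * y) (*-identityˡ y))
  tidyˡ : ∀ a b d μ ν → a * μ - b * μ + (b * μ + d * ν) ≡ a * μ + d * ν
  tidyˡ = solve 5 (λ a b d μ ν → a :* μ :- b :* μ :+ (b :* μ :+ d :* ν) := a :* μ :+ d :* ν) refl
    where open +-*-Solver
  tidyʳ : ∀ c b d κ μ ν → κ + ((ν + c) + (μ + b)) ≡ c - d + (κ + μ + ν) + (b + d)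
  tidyʳ = solve 6 (λ c b d κ μ ν → κ :+ ((ν :+ c) :+ (μ :+ b)) := c :- d :+ (κ :+ μ :+ ν) :+ (b :+ d)) refl
    where open +-*-Solver
  r₁ : ∀ a n k μ ν κ → μ * ν * κ * (a * (n * k)) ≡ a * μ * ((ν * n) * (κ * k))
  r₁ = solve 6 (λ a n k μ ν κ → μ :* ν :* κ :* (a :* (n :* k)) := a :* μ :* ((ν :* n) :* (κ :* k))) refl
    where open +-*-Solver
  r₂ : ∀ d m k μ ν κ → μ * ν * κ * (d * (m * k)) ≡ d * ν * ((μ * m) * (κ * k))
  r₂ = solve 6 (λ d m k μ ν κ → μ :* ν :* κ :* (d :* (m :* k)) := d :* ν :* ((μ :* m) :* (κ :* k))) refl
    where open +-*-Solver
  r₃ : ∀ m n μ ν κ → μ * ν * κ * (m * n) ≡ κ * ((μ * m) * (ν * n))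
  r₃ = solve 5 (λ m n μ ν κ → μ :* ν :* κ :* (m :* n) := κ :* ((μ :* m) :* (ν :* n))) refl
    where open +-*-Solver

log-approx-≤ : ∀ k m n .{{_ : ℕ.NonZero m}} .{{_ : ℕ.NonZero n}} u v → 0 ℕ.< k → 0ℚ < u → 0ℚ < v →
  u * ι (2 ℕ.* k) ≤ v * ι (suc (2 ℕ.* k)) →
  log-approx m u ≤ log-approx n v + (inv (ι k) + inv (ι m) + inv (ι n))
log-approx-≤ k m n u v 0<k 0<u 0<v h =
  subst₂ (λ x y → x ≤ y + (inv (ι k) + inv (ι m) + inv (ι n)))
    (sym (cong₂ _-_ (/-inv A m) (/-inv B m))) (sym (cong₂ _-_ (/-inv C n) (/-inv D n)))
    (divide (ι A) (ι B) (ι C) (ι D) (ι m) (ι n) (ι k) (inv (ι m)) (inv (ι n)) (inv (ι k))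
      (<⇒≤ (0<inv 0<m)) (<⇒≤ (0<inv 0<n)) (<⇒≤ (0<inv (ι-mono-< 0<k)))
      (inv-* 0<m) (inv-* 0<n) (inv-* (ι-mono-< 0<k))
      (subst₂ _≤_ eqˡ eqʳ (ι-mono-≤ (log-ratio p q s t k m n
        (0<numerator u 0<u) (0<denominator u) (0<numerator v 0<v) (0<denominator v) 0<k (ratio-ℕ u v k 0<u 0<v h)))))
  where
  p = ℤ.∣ ↥ u ∣
  q = ↧ₙ u
  s = ℤ.∣ ↥ v ∣
  t = ↧ₙ v
  A = ⌊log₂ p ℕ.^ m ⌋
  B = ⌊log₂ q ℕ.^ m ⌋
  C = ⌊log₂ s ℕ.^ n ⌋
  D = ⌊log₂ t ℕ.^ n ⌋
  0<m : 0ℚ < ι m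
  0<m = ι-mono-< (ℕ.>-nonZero⁻¹ m)
  0<n : 0ℚ < ι n
  0<n = ι-mono-< (ℕ.>-nonZero⁻¹ n)
  ι-*** : ∀ a b c → ι (a ℕ.* (b ℕ.* c)) ≡ ι a * (ι b * ι c)
  ι-*** a b c = trans (ι-* a (b ℕ.* c)) (cong (ι a *_) (ι-* b c))
  ι-suc** : ∀ a b c → ι (suc a ℕ.* (b ℕ.* c)) ≡ (1ℚ + ι a) * (ι b * ι c)
  ι-suc** a b c = trans (ι-*** (suc a) b c) (cong (_* (ι b * ι c)) (ι-+ 1 a))
  eqˡ : ι (A ℕ.* (n ℕ.* k) ℕ.+ D ℕ.* (m ℕ.* k)) ≡ ι A * (ι n * ι k) + ι D * (ι m * ι k)
  eqˡ = trans (ι-+ (A ℕ.* (n ℕ.* k)) (D ℕ.* (m ℕ.* k))) (cong₂ _+_ (ι-*** A n k) (ι-*** D m k))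
  eqʳ : ι (m ℕ.* n ℕ.+ (suc C ℕ.* (m ℕ.* k) ℕ.+ suc B ℕ.* (n ℕ.* k)))
      ≡ ι m * ι n + ((1ℚ + ι C) * (ι m * ι k) + (1ℚ + ι B) * (ι n * ι k))
  eqʳ = trans (ι-+ (m ℕ.* n) (suc C ℕ.* (m ℕ.* k) ℕ.+ suc B ℕ.* (n ℕ.* k)))
    (cong₂ _+_ (ι-* m n) (trans (ι-+ (suc C ℕ.* (m ℕ.* k)) (suc B ℕ.* (n ℕ.* k)))
      (cong₂ _+_ (ι-suc** C m k) (ι-suc** B n k))))

archimedes : ∀ ε → 0ℚ < ε → ∃ λ k → 0 ℕ.< k × inv (ι k) + inv (ι k) + inv (ι k) ≤ ε
archimedes ε 0<ε = k , 0<k , (begin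
  i + i + i             ≡⟨ sym (triple i) ⟩
  i * ι 3               ≤⟨ *-monoˡ (ι 3) (ε * ι k) (<⇒≤ (0<inv (ι-mono-< 0<k))) three≤ ⟩
  i * (ε * ι k)         ≡⟨ swap i ε (ι k) ⟩
  ε * (i * ι k)         ≡⟨ cong (ε *_) (inv-* (ι-mono-< 0<k)) ⟩
  ε * 1ℚ                ≡⟨ *-identityʳ ε ⟩
  ε                     ∎)
  where
  open ≤-Reasoning
  k = 3 ℕ.* ↧ₙ ε
  i = inv (ι k)
  0<k : 0 ℕ.< k
  0<k = ℕₚ.*-mono-≤ {1} {3} (ℕ.s≤s ℕ.z≤n) (0<denominator ε)
  swap : ∀ i e k → i * (e * k) ≡ e * (i * k)
  swap = solve 3 (λ i e k → i :* (e :* k) := e :* (i :* k)) refl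
    where open +-*-Solver
  triple : ∀ i → i * ι 3 ≡ i + i + i
  triple i = trans (cong (i *_) (trans (ι-+ 2 1) (cong (_+ 1ℚ) (ι-+ 1 1)))) (go i 1ℚ refl)
    where
    go : ∀ i o → o ≡ 1ℚ → i * (o + o + o) ≡ i + i + i
    go i o refl = trans (*-distribˡ-+ i (1ℚ + 1ℚ) 1ℚ) (cong₂ _+_
      (trans (*-distribˡ-+ i 1ℚ 1ℚ) (cong₂ _+_ (*-identityʳ i) (*-identityʳ i))) (*-identityʳ i))
  three≤ : ι 3 ≤ ε * ι k
  three≤ = begin
    ι 3                          ≤⟨ ι-mono-≤ (ℕₚ.*-monoʳ-≤ 3 (0<numerator ε 0<ε)) ⟩
    ι (3 ℕ.* ℤ.∣ ↥ ε ∣)          ≡⟨ ι-* 3 ℤ.∣ ↥ ε ∣ ⟩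
    ι 3 * ι ℤ.∣ ↥ ε ∣            ≡⟨ cong (ι 3 *_) (sym (numerator-eq ε 0<ε)) ⟩
    ι 3 * (ε * ι (↧ₙ ε))         ≡⟨ swap (ι 3) ε (ι (↧ₙ ε)) ⟩
    ε * (ι 3 * ι (↧ₙ ε))         ≡⟨ cong (ε *_) (sym (ι-* 3 (↧ₙ ε))) ⟩
    ε * ι k                      ∎

log₂ : (x : ℝ) → 0ℝ <ℝ x → ℝ
log₂ (mkℝ x cx) (δ , 0<δ , M₀ , h₀) = mkℝ (λ n → log-approx (suc n) (x n)) cs
  where
  cs : IsCauchy (λ n → log-approx (suc n) (x n))
  cs ε 0<ε =
    let k , 0<k , 3/k≤ε = archimedes ε 0<ε
        K   = ι (2 ℕ.* k)
        0<K = ι-mono-< {0} {2 ℕ.* k} (ℕₚ.*-mono-≤ {1} {2} (ℕ.s≤s ℕ.z≤n) 0<k)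
        M₁ , h₁ = cx (δ * inv K) (0<* 0<δ (0<inv 0<K))
        M₀₁ = M₀ ℕ.⊔ M₁
    in M₀₁ ℕ.⊔ k , λ m n m≥ n≥ →
      let side = one-sided ε k 0<k 0<K 3/k≤ε M₁ h₁
          m≥₀₁ = ℕₚ.m⊔n≤o⇒m≤o M₀₁ k m≥
          n≥₀₁ = ℕₚ.m⊔n≤o⇒m≤o M₀₁ k n≥
          m≥₀ = ℕₚ.m⊔n≤o⇒m≤o M₀ M₁ m≥₀₁
          n≥₀ = ℕₚ.m⊔n≤o⇒m≤o M₀ M₁ n≥₀₁
          m≥₁ = ℕₚ.m⊔n≤o⇒n≤o M₀ M₁ m≥₀₁
          n≥₁ = ℕₚ.m⊔n≤o⇒n≤o M₀ M₁ n≥₀₁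
          m≥k = ℕₚ.m⊔n≤o⇒n≤o M₀₁ k m≥
          n≥k = ℕₚ.m⊔n≤o⇒n≤o M₀₁ k n≥
      in abs-≤ (side m n m≥₀ n≥₀ m≥₁ n≥₁ m≥k n≥k) (side n m n≥₀ m≥₀ n≥₁ m≥₁ n≥k m≥k)
    where
    one-sided : ∀ ε k → 0 ℕ.< k → 0ℚ < ι (2 ℕ.* k) → inv (ι k) + inv (ι k) + inv (ι k) ≤ ε → ∀ M₁ →
      (∀ m n → M₁ ℕ.≤ m → M₁ ℕ.≤ n → ∣ x m - x n ∣ ≤ δ * inv (ι (2 ℕ.* k))) →
      ∀ m n → M₀ ℕ.≤ m → M₀ ℕ.≤ n → M₁ ℕ.≤ m → M₁ ℕ.≤ n → k ℕ.≤ m → k ℕ.≤ n →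
      log-approx (suc m) (x m) ≤ log-approx (suc n) (x n) + ε
    one-sided ε k 0<k 0<K 3/k≤ε M₁ h₁ m n m≥₀ n≥₀ m≥₁ n≥₁ m≥k n≥k =
      ≤-trans (log-approx-≤ k (suc m) (suc n) (x m) (x n) 0<k (<-≤-trans 0<δ δ≤m) (<-≤-trans 0<δ δ≤n) close)
        (+-monoʳ-≤ (log-approx (suc n) (x n)) (≤-trans
          (+-mono-≤ (+-monoʳ-≤ (inv (ι k)) (small m m≥k)) (small n n≥k)) 3/k≤ε))
      where
      open ≤-Reasoning
      K = ι (2 ℕ.* k)
      δ≤m : δ ≤ x m
      δ≤m = subst (_≤ x m) (+-identityˡ δ) (h₀ m m≥₀)
      δ≤n : δ ≤ x n
      δ≤n = subst (_≤ x n) (+-identityˡ δ) (h₀ n n≥₀)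
      small : ∀ m → k ℕ.≤ m → inv (ι (suc m)) ≤ inv (ι k)
      small m k≤m = inv-anti (ι-mono-< 0<k) (ι-mono-≤ (ℕₚ.m≤n⇒m≤1+n k≤m))
      close : x m * K ≤ x n * ι (suc (2 ℕ.* k))
      close = begin
        x m * K                         ≤⟨ *-monoʳ-≤-nonNeg K {{nonNegative (<⇒≤ 0<K)}} (abs-≤ˡ {x m} {x n} (h₁ m n m≥₁ n≥₁)) ⟩
        (x n + δ * inv K) * K           ≡⟨ *-distribʳ-+ K (x n) (δ * inv K) ⟩
        x n * K + δ * inv K * K         ≡⟨ cong (λ z → x n * K + z) (trans (*-assoc δ (inv K) K) (trans (cong (δ *_) (inv-* 0<K)) (*-identityʳ δ))) ⟩
        x n * K + δ                     ≤⟨ +-monoʳ-≤ (x n * K) δ≤n ⟩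
        x n * K + x n                   ≡⟨ trans (+-comm (x n * K) (x n)) (cong (_+ x n * K) (sym (*-identityʳ (x n)))) ⟩
        x n * 1ℚ + x n * K              ≡⟨ sym (*-distribˡ-+ (x n) 1ℚ K) ⟩
        x n * (1ℚ + K)                  ≡⟨ cong (x n *_) (sym (ι-+ 1 (2 ℕ.* k))) ⟩
        x n * ι (suc (2 ℕ.* k))         ∎

-- log⁽ᵐ⁾ x is well defined when each of x, log x, …, log⁽ᵐ⁻¹⁾ x is positive.
LogDefined : ℕ → ℝ → Set
LogDefined zero    x = ⊤
LogDefined (suc m) x = Σ (0ℝ <ℝ x) λ 0<x → LogDefined m (log₂ x 0<x)

iterLog : (m : ℕ) (x : ℝ) → LogDefined m x → ℝ
iterLog zero    x _         = x
iterLog (suc m) x (0<x , d) = iterLog m (log₂ x 0<x) d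

record Distribution (n : ℕ) : Set where
  field
    prob   : Fin n → ℝ
    prob≥0 : ∀ i → 0ℝ ≤ℝ prob i
    total  : ∑ prob ≃ℝ 1ℝ
open Distribution public

-- There are n = suc k numbers, of which k are shown. The set S is given by its
-- increasing enumeration, and shown i is what the algorithm sees when the i-th number
-- has been deleted. By the spacing, a ±1 perturbation preserves the order, so the
-- shown list is the increasing enumeration of the set of modified numbers.
record Adversary (k N : ℕ) : Set where
  field
    S       : Vec ℤ (suc k)
    inRange : ∀ i → + 1 ℤ.≤ lookup S i × lookup S i ℤ.≤ + N
    spaced  : ∀ (i : Fin k) → lookup S (inject₁ i) ℤ.+ + 20 ℤ.≤ lookup S (Fin.suc i)
    shown   : Fin (suc k) → Vec ℤ k
    near    : ∀ i j → ℤ.∣ lookup (shown i) j ℤ.- lookup (removeAt S i) j ∣ ℕ.≤ 1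
open Adversary public

Algorithm : ℕ → Set
Algorithm k = Vec ℤ k → Distribution (suc k)

AllPositive : ∀ {n} → Distribution n → Set
AllPositive p = ∀ i → 0ℝ <ℝ prob p i

reward : ∀ {n} (p : Distribution n) → AllPositive p → (deleted guess : Fin n) → ℝ
reward p p>0 i g = if does (g Fin.≟ i) then recip (prob p i) (p>0 i) else 0ℝ

expectedReward : ∀ {k N} (p : Distribution (suc k)) → AllPositive p → Algorithm k → Adversary k N → ℝ
expectedReward p p>0 A σ =
  ∑ λ i → prob p i *ℝ (∑ λ g → prob (A (shown σ i)) g *ℝ reward p p>0 i g)

inverse-[6n]^[7n] : (n : ℕ) .{{_ : ℕ.NonZero n}} → ℚ
inverse-[6n]^[7n] n = (+ 1 / (6 ℕ.* n) ℕ.^ (7 ℕ.* n))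
  {{ℕₚ.m^n≢0 (6 ℕ.* n) (7 ℕ.* n) {{ℕₚ.m*n≢0 6 n}}}}

{-# OPTIONS --safe #-}
module Submission where

open import Defs
open import Data.Nat using (ℕ; suc; _+_)
open import Data.Product using (Σ; _×_)
open import Data.Bool using (if_then_else_)
open import Data.Empty using (⊥-elim)
open import Data.Fin as Fin using (Fin; toℕ; fromℕ<; inject₁; punchIn)
import Data.Fin.Properties as Finₚ
open import Data.Integer as ℤ using (ℤ) renaming (+_ to int)
import Data.Integer.Properties as ℤₚ
open import Data.Nat using (zero; _*_; _∸_; _^_; _⊓_; _⊔_; _≤_; _<_; _≤?_; _<?_; z≤n; s≤s; s≤s⁻¹; NonZero; >-nonZero; >-nonZero⁻¹)
open import Data.Nat.Logarithm using (⌊log₂_⌋; ⌊log₂⌋-mono-≤; ⌊log₂[2*b]⌋≡1+⌊log₂b⌋; ⌊log₂[2^n]⌋≡n)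
open import Data.Nat.Properties as ℕₚ using (≤-refl; ≤-trans; ≤-reflexive; <⇒≤; m≤m+n; m≤n+m; +-mono-≤; *-mono-≤)
open import Data.Nat.Tactic.RingSolver using (solve-∀)
open import Data.Product using (∃; _,_; proj₁; proj₂)
open import Data.Rational as ℚ using (ℚ; 0ℚ; 1ℚ; ½; ↥_; ↧ₙ_)
import Data.Rational.Properties as ℚₚ
open import Data.Rational.Solver using (module +-*-Solver)
open import Data.Sum as Sum using (_⊎_; inj₁; inj₂)
open import Data.Unit using (tt)
open import Data.Vec using (Vec; _∷_; lookup; removeAt)
open import Function using (_∘_)
open import Relation.Binary.PropositionalEquality using (_≡_; _≢_; refl; sym; trans; cong; cong₂; subst; subst₂; module ≡-Reasoning)
open import Relation.Nullary using (Dec; does; yes; no; ¬_)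

-- The probability pᵢ cancels against the reward 1/pᵢ, so one has to make the sum over i of
-- the probability of guessing i when i is deleted exceed 1. For four points, with visible
-- gaps h, h′ and u = h/(h + h′), guess with probabilities 1/4 + (−u, 2u, −2u, u)/8. On gaps
-- a, b, c this sums to 1 + (ac(a+c) + 3abc + b²(a+b+c)) / 8(a+b)(b+c)(a+b+c) up to a
-- perturbation of at most 3/4 of the gain, and the gain is bounded below unless
-- a ≪ b ≪ c or a ≫ b ≫ c. Playing this at a random place among n points gains a
-- definite amount unless the gaps are separated and monotone. In that case merging two
-- adjacent gaps amounts to deleting the smaller one, so the truncated logarithms of the
-- gaps are a perturbed game with n − 1 points in [log N]; a small admixture of a strategy
-- for that game closes the induction. The induction starts at n = 2, where guessing the
-- first index with probability proportional to the number shown gains 1/N, and at n = 3,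
-- where the concavity of log does the same for the visible gap.
-- Fractions of natural numbers

-- A denominator 0 gives the value 0, so weights built from gaps are defined for every input.
frac : ℕ → ℕ → ℚ
frac h d = ι h ℚ.* inv (ι d)

0<ι : ∀ {n} → 0 < n → 0ℚ ℚ.< ι n
0<ι {n} 0<n = ι-mono-< {0} {n} 0<n

0≤inv-ι : ∀ d → 0ℚ ℚ.≤ inv (ι d)
0≤inv-ι zero    = ℚₚ.≤-refl
0≤inv-ι d@(suc _) = ℚₚ.<⇒≤ (0<inv {ι d} (0<ι {d} (s≤s z≤n)))

0≤* : ∀ {p q} → 0ℚ ℚ.≤ p → 0ℚ ℚ.≤ q → 0ℚ ℚ.≤ p ℚ.* q
0≤* {p} {q} 0≤p 0≤q = subst (ℚ._≤ p ℚ.* q) (ℚₚ.*-zeroʳ p) (*-monoˡ 0ℚ q 0≤p 0≤q)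

0≤+ : ∀ {p q} → 0ℚ ℚ.≤ p → 0ℚ ℚ.≤ q → 0ℚ ℚ.≤ p ℚ.+ q
0≤+ = ℚₚ.+-mono-≤

0≤frac : ∀ h d → 0ℚ ℚ.≤ frac h d
0≤frac h d = 0≤* (0≤ι h) (0≤inv-ι d)

frac-cross : ∀ h d h′ d′ → 0 < d → 0 < d′ → h * d′ ≤ h′ * d → frac h d ℚ.≤ frac h′ d′
frac-cross h d h′ d′ 0<d 0<d′ le = begin
  ι h ℚ.* i                          ≡⟨ spread h i d′ 0<d′ ⟩
  ι (h * d′) ℚ.* (i ℚ.* i′)          ≤⟨ ℚₚ.*-monoʳ-≤-nonNeg (i ℚ.* i′) {{ℚ.nonNegative (0≤* (0≤inv-ι d) (0≤inv-ι d′))}} (ι-mono-≤ {h * d′} {h′ * d} le) ⟩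
  ι (h′ * d) ℚ.* (i ℚ.* i′)          ≡⟨ cong (ι (h′ * d) ℚ.*_) (ℚₚ.*-comm i i′) ⟩
  ι (h′ * d) ℚ.* (i′ ℚ.* i)          ≡⟨ sym (spread h′ i′ d 0<d) ⟩
  ι h′ ℚ.* i′                        ∎
  where
  open ℚₚ.≤-Reasoning
  i = inv (ι d)
  i′ = inv (ι d′)
  spread : ∀ h i e → 0 < e → ι h ℚ.* i ≡ ι (h * e) ℚ.* (i ℚ.* inv (ι e))
  spread h i e 0<e = sym (trans (cong (ℚ._* (i ℚ.* inv (ι e))) (ι-* h e))
    (trans (solve 4 (λ h e i j → h :* e :* (i :* j) := h :* i :* (j :* e)) refl (ι h) (ι e) i (inv (ι e)))
    (trans (cong (ι h ℚ.* i ℚ.*_) (inv-* {ι e} (0<ι 0<e))) (ℚₚ.*-identityʳ _))))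
    where open +-*-Solver

frac-mono : ∀ {h h′} d → h ≤ h′ → frac h d ℚ.≤ frac h′ d
frac-mono {h} {h′} d h≤h′ = ℚₚ.*-monoʳ-≤-nonNeg (inv (ι d)) {{ℚ.nonNegative (0≤inv-ι d)}} (ι-mono-≤ {h} {h′} h≤h′)

frac-+ : ∀ h h′ d → frac (h + h′) d ≡ frac h d ℚ.+ frac h′ d
frac-+ h h′ d = trans (cong (ℚ._* inv (ι d)) (ι-+ h h′)) (ℚₚ.*-distribʳ-+ (inv (ι d)) (ι h) (ι h′))

frac-self : ∀ d → 0 < d → frac d d ≡ 1ℚ
frac-self d 0<d = trans (ℚₚ.*-comm (ι d) (inv (ι d))) (inv-* {ι d} (0<ι 0<d))

frac≤1 : ∀ h d → h ≤ d → frac h d ℚ.≤ 1ℚ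
frac≤1 .0 zero z≤n = ℚₚ.<⇒≤ (0<ι {1} (s≤s z≤n))
frac≤1 h d@(suc _) h≤d = ℚₚ.≤-trans (frac-mono {h} {d} d h≤d) (ℚₚ.≤-reflexive (frac-self d (s≤s z≤n)))

share : ℕ → ℕ → ℚ
share p q = frac p (p + q)

-- The four-point inequality

-- For gaps a, b, c of four consecutive points, the exact gain of the four-point strategy
-- is cubic / crossed; perturbations cost at most slack / crossed.
cubic crossed slack : ℕ → ℕ → ℕ → ℕ
cubic   a b c = a * a * c + a * c * c + 3 * (a * b * c) + a * b * b + b * b * b + b * b * c
crossed a b c = (a + b) * (b + c) * (a + b + c)
slack   a b c = 2 * (a * a) + 2 * (c * c) + 12 * (b * b) + 12 * (a * c) + 14 * (a * b) + 14 * (b * c)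

-- Since every gap is at least 20, one factor in each monomial of the cubic can be lowered to 20.
-- Three times the resulting quadratic form dominates four times the slack coefficientwise, most
-- tightly at ab and bc (60 against 56).
4slack≤3cubic : ∀ a b c → 20 ≤ a → 20 ≤ b → 20 ≤ c → 4 * slack a b c ≤ 3 * cubic a b c
4slack≤3cubic a b c 20≤a 20≤b 20≤c = begin
  4 * slack a b c
    ≤⟨ m≤m+n (4 * slack a b c) _ ⟩
  4 * slack a b c + rest a b c
    ≡⟨ id a b c ⟩
  3 * (a * a * 20 + 20 * c * c + 3 * (a * 20 * c) + a * 20 * b + b * b * 20 + b * 20 * c)
    ≤⟨ ℕₚ.*-monoʳ-≤ 3 (+-mono-≤ (+-mono-≤ (+-mono-≤ (+-mono-≤ (+-mono-≤
         (ℕₚ.*-monoʳ-≤ (a * a) 20≤c) (ℕₚ.*-monoˡ-≤ c (ℕₚ.*-monoˡ-≤ c 20≤a)))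
         (ℕₚ.*-monoʳ-≤ 3 (ℕₚ.*-monoˡ-≤ c (ℕₚ.*-monoʳ-≤ a 20≤b))))
         (ℕₚ.*-monoˡ-≤ b (ℕₚ.*-monoʳ-≤ a 20≤b)))
         (ℕₚ.*-monoʳ-≤ (b * b) 20≤b))
         (ℕₚ.*-monoˡ-≤ c (ℕₚ.*-monoʳ-≤ b 20≤b))) ⟩
  3 * cubic a b c ∎
  where
  open ℕₚ.≤-Reasoning
  rest : ℕ → ℕ → ℕ → ℕ
  rest a b c = 52 * (a * a) + 52 * (c * c) + 12 * (b * b) + 132 * (a * c) + 4 * (a * b) + 4 * (b * c)
  id : ∀ a b c → 4 * (2 * (a * a) + 2 * (c * c) + 12 * (b * b) + 12 * (a * c) + 14 * (a * b) + 14 * (b * c))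
      + (52 * (a * a) + 52 * (c * c) + 12 * (b * b) + 132 * (a * c) + 4 * (a * b) + 4 * (b * c))
    ≡ 3 * (a * a * 20 + 20 * c * c + 3 * (a * 20 * c) + a * 20 * b + b * b * 20 + b * 20 * c)
  id = solve-∀

-- Over the common denominator `crossed`, the least favourable shares have numerator `L` on the
-- winning side and `R` on the losing side, and L - R = cubic - slack, of which at least a quarter
-- of the cubic is left. Writing a = 2 + α keeps a - 2 in ℕ.
noisy-gain : ∀ α b c → 20 ≤ 2 + α → 20 ≤ b → 20 ≤ c → let a = 2 + α in
  4 * ((b + 2) * (a + b) * (a + b + c) + 2 * ((a + 2) * (a + b) * (b + c))) + cubic a b c
    ≤ 4 * (α * (a + b + c) * (b + c) + 2 * ((α + b) * (a + b) * (b + c)))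
noisy-gain α b c 20≤a 20≤b 20≤c = ℕₚ.+-cancelʳ-≤ (4 * slack a b c) _ _ (begin
  4 * R + cubic a b c + 4 * slack a b c         ≤⟨ ℕₚ.+-monoʳ-≤ (4 * R + cubic a b c) (4slack≤3cubic a b c 20≤a 20≤b 20≤c) ⟩
  4 * R + cubic a b c + 3 * cubic a b c         ≡⟨ gather R (cubic a b c) ⟩
  4 * (R + cubic a b c)                         ≡⟨ cong (4 *_) (id α b c) ⟩
  4 * (L + slack a b c)                         ≡⟨ ℕₚ.*-distribˡ-+ 4 L (slack a b c) ⟩
  4 * L + 4 * slack a b c                       ∎)
  where
  open ℕₚ.≤-Reasoning
  a = 2 + α
  R = (b + 2) * (a + b) * (a + b + c) + 2 * ((a + 2) * (a + b) * (b + c))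
  L = α * (a + b + c) * (b + c) + 2 * ((α + b) * (a + b) * (b + c))
  gather : ∀ r k → 4 * r + k + 3 * k ≡ 4 * (r + k)
  gather = solve-∀
  id : ∀ α b c →
    (b + 2) * (2 + α + b) * (2 + α + b + c) + 2 * ((2 + α + 2) * (2 + α + b) * (b + c))
      + ((2 + α) * (2 + α) * c + (2 + α) * c * c + 3 * ((2 + α) * b * c) + (2 + α) * b * b + b * b * b + b * b * c)
    ≡ α * (2 + α + b + c) * (b + c) + 2 * ((α + b) * (2 + α + b) * (b + c))
      + (2 * ((2 + α) * (2 + α)) + 2 * (c * c) + 12 * (b * b) + 12 * ((2 + α) * c) + 14 * ((2 + α) * b) + 14 * (b * c))
  id = solve-∀

-- A share increases in its first argument, so p/(p + q) ≤ P/(P + q) ≤ P/S; the last equation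
-- rewrites P/S over the common denominator D.
share≤frac : ∀ p q P S N D → 0 < p + q → 0 < D → p ≤ P → S ≤ P + q → 0 < S → N * S ≡ P * D → share p q ℚ.≤ frac N D
share≤frac p q P S N D 0<p+q 0<D p≤P S≤P+q 0<S e = ℚₚ.≤-trans
  (frac-cross p (p + q) P S 0<p+q 0<S (begin
    p * S            ≤⟨ ℕₚ.*-monoʳ-≤ p S≤P+q ⟩
    p * (P + q)      ≡⟨ e₁ p P q ⟩
    P * p + p * q    ≤⟨ ℕₚ.+-monoʳ-≤ (P * p) (ℕₚ.*-monoˡ-≤ q p≤P) ⟩
    P * p + P * q    ≡⟨ sym (ℕₚ.*-distribˡ-+ P p q) ⟩
    P * (p + q)      ∎))
  (frac-cross P S N D 0<S 0<D (≤-reflexive (sym e)))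
  where
  open ℕₚ.≤-Reasoning
  e₁ : ∀ p P q → p * (P + q) ≡ P * p + p * q
  e₁ = solve-∀

frac≤share : ∀ p q P S N D → 0 < p + q → 0 < D → P ≤ p → q + P ≤ S → 0 < S → N * S ≡ P * D → frac N D ℚ.≤ share p q
frac≤share p q P S N D 0<p+q 0<D P≤p q+P≤S 0<S e = ℚₚ.≤-trans
  (frac-cross N D P S 0<D 0<S (≤-reflexive e))
  (frac-cross P S p (p + q) 0<S 0<p+q (begin
    P * (p + q)      ≡⟨ ℕₚ.*-distribˡ-+ P p q ⟩
    P * p + P * q    ≤⟨ ℕₚ.+-monoʳ-≤ (P * p) (ℕₚ.*-monoˡ-≤ q P≤p) ⟩
    P * p + p * q    ≡⟨ e₁ p P q ⟩
    p * (q + P)      ≤⟨ ℕₚ.*-monoʳ-≤ p q+P≤S ⟩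
    p * S            ∎))
  where
  open ℕₚ.≤-Reasoning
  e₁ : ∀ p P q → P * p + p * q ≡ p * (q + P)
  e₁ = solve-∀

-- The four shares are those seen when the 1st, 3rd, 4th, 2nd of the four points is missing.
share-gain : ∀ {a b c pa pb qa qbc vab vc wb wc} → 20 ≤ a → 20 ≤ b → 20 ≤ c →
  a ≤ 2 + pa → pb ≤ 2 + b → qa ≤ 2 + a → b + c ≤ 2 + qbc →
  a + b ≤ 2 + vab → vc ≤ 2 + c → wb ≤ 2 + b → c ≤ 2 + wc →
  share wb wc ℚ.+ (share qa qbc ℚ.+ share qa qbc) ℚ.+ frac (cubic a b c) (4 * crossed a b c)
    ℚ.≤ share pa pb ℚ.+ (share vab vc ℚ.+ share vab vc)
share-gain {suc zero} (s≤s ())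
share-gain {a@(suc (suc α))} {b@(suc _)} {c@(suc _)} {pa} {pb} {qa} {qbc} {vab} {vc} {wb} {wc}
           20≤a 20≤b 20≤c a≤pa pb≤b qa≤a bc≤qbc ab≤vab vc≤c wb≤b c≤wc = begin
  share wb wc ℚ.+ (share qa qbc ℚ.+ share qa qbc) ℚ.+ frac (cubic a b c) D
    ≤⟨ ℚₚ.+-monoˡ-≤ (frac (cubic a b c) D) (ℚₚ.+-mono-≤
         (share≤frac wb wc (2 + b) (b + c) W D (≤-trans (pos 20≤c c≤wc) (m≤n+m wc wb)) 0<D wb≤b c≤W (s≤s z≤n) (eW α b c))
         (ℚₚ.+-mono-≤ Q≤ Q≤)) ⟩
  frac W D ℚ.+ (frac Q D ℚ.+ frac Q D) ℚ.+ frac (cubic a b c) D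
    ≡⟨ sym (trans (frac-+ (W + (Q + Q)) (cubic a b c) D) (cong (ℚ._+ frac (cubic a b c) D)
         (trans (frac-+ W (Q + Q) D) (cong (frac W D ℚ.+_) (frac-+ Q Q D))))) ⟩
  frac (W + (Q + Q) + cubic a b c) D
    ≤⟨ frac-mono {W + (Q + Q) + cubic a b c} {P + (V + V)} D (subst₂ _≤_ (cong (_+ cubic a b c) (eL α b c)) (eR α b c) (noisy-gain α b c 20≤a 20≤b 20≤c)) ⟩
  frac (P + (V + V)) D
    ≡⟨ trans (frac-+ P (V + V) D) (cong (frac P D ℚ.+_) (frac-+ V V D)) ⟩
  frac P D ℚ.+ (frac V D ℚ.+ frac V D)
    ≤⟨ ℚₚ.+-mono-≤
         (frac≤share pa pb α (a + b) P D (≤-trans (pos 20≤a a≤pa) (m≤m+n pa pb)) 0<D (s≤s⁻¹ (s≤s⁻¹ a≤pa))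
           (subst (pb + α ≤_) (eP α b) (ℕₚ.+-monoˡ-≤ α pb≤b)) (s≤s z≤n) (eP′ α b c))
         (ℚₚ.+-mono-≤ V≥ V≥) ⟩
  share pa pb ℚ.+ (share vab vc ℚ.+ share vab vc) ∎
  where
  open ℚₚ.≤-Reasoning
  -- The numerators of the extreme perturbed shares over one denominator; its factor 4 makes a
  -- quarter of the exact gain a fraction with numerator `cubic`.
  D = 4 * crossed a b c
  W = 4 * ((b + 2) * (a + b) * (a + b + c))
  Q = 4 * ((a + 2) * (a + b) * (b + c))
  P = 4 * (α * (a + b + c) * (b + c))
  V = 4 * ((α + b) * (a + b) * (b + c))
  0<D : 0 < D
  0<D = s≤s z≤n
  pos : ∀ {x y} → 20 ≤ x → x ≤ 2 + y → 0 < y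
  pos {y = zero}  20≤x x≤ with ≤-trans 20≤x x≤
  ... | s≤s (s≤s ())
  pos {y = suc _} _ _ = s≤s z≤n
  c≤W : b + c ≤ 2 + b + wc
  c≤W = ≤-trans (ℕₚ.+-monoʳ-≤ b c≤wc) (≤-reflexive (e b wc))
    where
    e : ∀ b w → b + (2 + w) ≡ 2 + b + w
    e = solve-∀
  0<qbc : 0 < qbc
  0<qbc = pos 20≤b (≤-trans (m≤m+n b c) bc≤qbc)
  Q≤ : share qa qbc ℚ.≤ frac Q D
  Q≤ = share≤frac qa qbc (2 + a) (a + b + c) Q D (≤-trans 0<qbc (m≤n+m qbc qa)) 0<D qa≤a
    (≤-trans (≤-trans (≤-reflexive (ℕₚ.+-assoc a b c)) (ℕₚ.+-monoʳ-≤ a bc≤qbc)) (≤-reflexive (e a qbc))) (s≤s z≤n) (eQ α b c)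
    where
    e : ∀ a w → a + (2 + w) ≡ 2 + a + w
    e = solve-∀
    eQ : ∀ α b c → 4 * ((2 + α + 2) * (2 + α + b) * (b + c)) * (2 + α + b + c) ≡ (2 + (2 + α)) * (4 * ((2 + α + b) * (b + c) * (2 + α + b + c)))
    eQ = solve-∀
  V≥ : frac V D ℚ.≤ share vab vc
  V≥ = frac≤share vab vc (α + b) (a + b + c) V D (≤-trans (pos 20≤a (≤-trans (m≤m+n a b) ab≤vab)) (m≤m+n vab vc)) 0<D
    (s≤s⁻¹ (s≤s⁻¹ ab≤vab)) (subst (vc + (α + b) ≤_) (e α b c) (ℕₚ.+-monoˡ-≤ (α + b) vc≤c)) (s≤s z≤n) (eV α b c)
    where
    e : ∀ α b c → 2 + c + (α + b) ≡ 2 + α + b + c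
    e = solve-∀
    eV : ∀ α b c → 4 * ((α + b) * (2 + α + b) * (b + c)) * (2 + α + b + c) ≡ (α + b) * (4 * ((2 + α + b) * (b + c) * (2 + α + b + c)))
    eV = solve-∀
  eW : ∀ α b c → 4 * ((b + 2) * (2 + α + b) * (2 + α + b + c)) * (b + c) ≡ (2 + b) * (4 * ((2 + α + b) * (b + c) * (2 + α + b + c)))
  eW = solve-∀
  eP : ∀ α b → 2 + b + α ≡ 2 + α + b
  eP = solve-∀
  eP′ : ∀ α b c → 4 * (α * (2 + α + b + c) * (b + c)) * (2 + α + b) ≡ α * (4 * ((2 + α + b) * (b + c) * (2 + α + b + c)))
  eP′ = solve-∀
  eL : ∀ α b c → 4 * ((b + 2) * (2 + α + b) * (2 + α + b + c) + 2 * ((2 + α + 2) * (2 + α + b) * (b + c)))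
    ≡ 4 * ((b + 2) * (2 + α + b) * (2 + α + b + c)) + (4 * ((2 + α + 2) * (2 + α + b) * (b + c)) + 4 * ((2 + α + 2) * (2 + α + b) * (b + c)))
  eL = solve-∀
  eR : ∀ α b c → 4 * (α * (2 + α + b + c) * (b + c) + 2 * ((α + b) * (2 + α + b) * (b + c)))
    ≡ 4 * (α * (2 + α + b + c) * (b + c)) + (4 * ((α + b) * (2 + α + b) * (b + c)) + 4 * ((α + b) * (2 + α + b) * (b + c)))
  eR = solve-∀

-- The only monomials of `crossed` absent from `cubic` are a²b and bc². The first is at most M·ab²
-- or M·a²c, the second at most M·b²c or M·ac², according to the alternative that holds.
crossed≤cubic : ∀ M a b c → a ≤ M * b ⊎ b ≤ M * c → c ≤ M * b ⊎ b ≤ M * a → crossed a b c ≤ (2 + M) * cubic a b c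
crossed≤cubic M a b c h h′ = begin
  crossed a b c                                        ≡⟨ e a b c ⟩
  K + (a * b * b + b * b * c) + (a * a * b + b * c * c)  ≤⟨ +-mono-≤ (ℕₚ.+-monoʳ-≤ K (mid a b c)) (mixed h h′) ⟩
  K + K + M * K                                        ≡⟨ e′ K M ⟩
  (2 + M) * K                                          ∎
  where
  open ℕₚ.≤-Reasoning
  K = cubic a b c
  e : ∀ a b c → (a + b) * (b + c) * (a + b + c) ≡ a * a * c + a * c * c + 3 * (a * b * c) + a * b * b + b * b * b + b * b * c
    + (a * b * b + b * b * c) + (a * a * b + b * c * c)
  e = solve-∀
  e′ : ∀ K M → K + K + M * K ≡ (2 + M) * K
  e′ = solve-∀
  mid : ∀ a b c → a * b * b + b * b * c ≤ cubic a b c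
  mid a b c = ≤-trans (m≤m+n _ (a * a * c + a * c * c + 3 * (a * b * c) + b * b * b)) (≤-reflexive (e₁ a b c))
    where
    e₁ : ∀ a b c → a * b * b + b * b * c + (a * a * c + a * c * c + 3 * (a * b * c) + b * b * b)
      ≡ a * a * c + a * c * c + 3 * (a * b * c) + a * b * b + b * b * b + b * b * c
    e₁ = solve-∀
  1st : a ≤ M * b → a * a * b ≤ M * (a * b * b)
  1st a≤Mb = ≤-trans (ℕₚ.*-monoˡ-≤ b (ℕₚ.*-monoʳ-≤ a a≤Mb)) (≤-reflexive (e₁ M a b))
    where
    e₁ : ∀ M a b → a * (M * b) * b ≡ M * (a * b * b)
    e₁ = solve-∀
  2nd : b ≤ M * c → a * a * b ≤ M * (a * a * c)
  2nd b≤Mc = ≤-trans (ℕₚ.*-monoʳ-≤ (a * a) b≤Mc) (≤-reflexive (e₁ M a c))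
    where
    e₁ : ∀ M a c → a * a * (M * c) ≡ M * (a * a * c)
    e₁ = solve-∀
  3rd : c ≤ M * b → b * c * c ≤ M * (b * b * c)
  3rd c≤Mb = ≤-trans (ℕₚ.*-monoˡ-≤ c (ℕₚ.*-monoʳ-≤ b c≤Mb)) (≤-reflexive (e₁ M b c))
    where
    e₁ : ∀ M b c → b * (M * b) * c ≡ M * (b * b * c)
    e₁ = solve-∀
  4th : b ≤ M * a → b * c * c ≤ M * (a * c * c)
  4th b≤Ma = ≤-trans (ℕₚ.*-monoˡ-≤ c (ℕₚ.*-monoˡ-≤ c b≤Ma)) (≤-reflexive (e₁ M a c))
    where
    e₁ : ∀ M a c → M * a * c * c ≡ M * (a * c * c)
    e₁ = solve-∀
  -- X and Y are distinct monomials of the cubic in all four cases, so M·K suffices instead of 2M·K.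
  two : ∀ {x y X Y R} → x ≤ M * X → y ≤ M * Y → X + Y + R ≡ K → x + y ≤ M * K
  two {X = X} {Y} {R} x≤ y≤ eq = ≤-trans (+-mono-≤ x≤ y≤) (≤-trans (≤-reflexive (sym (ℕₚ.*-distribˡ-+ M X Y)))
    (ℕₚ.*-monoʳ-≤ M (≤-trans (m≤m+n (X + Y) R) (≤-reflexive eq))))
  mixed : a ≤ M * b ⊎ b ≤ M * c → c ≤ M * b ⊎ b ≤ M * a → a * a * b + b * c * c ≤ M * K
  mixed (inj₁ x) (inj₁ y) = two (1st x) (3rd y) (e₁ a b c)
    where
    e₁ : ∀ a b c → a * b * b + b * b * c + (a * a * c + a * c * c + 3 * (a * b * c) + b * b * b) ≡ a * a * c + a * c * c + 3 * (a * b * c) + a * b * b + b * b * b + b * b * c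
    e₁ = solve-∀
  mixed (inj₁ x) (inj₂ y) = two (1st x) (4th y) (e₁ a b c)
    where
    e₁ : ∀ a b c → a * b * b + a * c * c + (a * a * c + 3 * (a * b * c) + b * b * b + b * b * c) ≡ a * a * c + a * c * c + 3 * (a * b * c) + a * b * b + b * b * b + b * b * c
    e₁ = solve-∀
  mixed (inj₂ x) (inj₁ y) = two (2nd x) (3rd y) (e₁ a b c)
    where
    e₁ : ∀ a b c → a * a * c + b * b * c + (a * c * c + 3 * (a * b * c) + a * b * b + b * b * b) ≡ a * a * c + a * c * c + 3 * (a * b * c) + a * b * b + b * b * b + b * b * c
    e₁ = solve-∀
  mixed (inj₂ x) (inj₂ y) = two (2nd x) (4th y) (e₁ a b c)
    where
    e₁ : ∀ a b c → a * a * c + a * c * c + (3 * (a * b * c) + a * b * b + b * b * b + b * b * c) ≡ a * a * c + a * c * c + 3 * (a * b * c) + a * b * b + b * b * b + b * b * c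
    e₁ = solve-∀

-- Strategies for the game on sequences of natural numbers

sumTo : ℕ → (ℕ → ℚ) → ℚ
sumTo zero    f = 0ℚ
sumTo (suc n) f = f 0 ℚ.+ sumTo n (λ i → f (suc i))

sumTo-cong : ∀ n {f g : ℕ → ℚ} → (∀ i → i < n → f i ≡ g i) → sumTo n f ≡ sumTo n g
sumTo-cong zero    h = refl
sumTo-cong (suc n) h = cong₂ ℚ._+_ (h 0 (s≤s z≤n)) (sumTo-cong n (λ i i<n → h (suc i) (s≤s i<n)))

sumTo-mono : ∀ n {f g : ℕ → ℚ} → (∀ i → i < n → f i ℚ.≤ g i) → sumTo n f ℚ.≤ sumTo n g
sumTo-mono zero    h = ℚₚ.≤-refl
sumTo-mono (suc n) h = ℚₚ.+-mono-≤ (h 0 (s≤s z≤n)) (sumTo-mono n (λ i i<n → h (suc i) (s≤s i<n)))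

sumTo-zero : ∀ n → sumTo n (λ _ → 0ℚ) ≡ 0ℚ
sumTo-zero zero    = refl
sumTo-zero (suc n) = trans (ℚₚ.+-identityˡ _) (sumTo-zero n)

sumTo-nonneg : ∀ n {f} → (∀ i → i < n → 0ℚ ℚ.≤ f i) → 0ℚ ℚ.≤ sumTo n f
sumTo-nonneg n {f} h = subst (ℚ._≤ sumTo n f) (sumTo-zero n) (sumTo-mono n h)

sumTo-+ : ∀ n f g → sumTo n (λ i → f i ℚ.+ g i) ≡ sumTo n f ℚ.+ sumTo n g
sumTo-+ zero    f g = refl
sumTo-+ (suc n) f g = trans (cong (f 0 ℚ.+ g 0 ℚ.+_) (sumTo-+ n _ _))
  (solve 4 (λ a b c d → a :+ b :+ (c :+ d) := a :+ c :+ (b :+ d)) refl (f 0) (g 0) _ _)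
  where open +-*-Solver

sumTo-* : ∀ n c f → sumTo n (λ i → c ℚ.* f i) ≡ c ℚ.* sumTo n f
sumTo-* zero    c f = sym (ℚₚ.*-zeroʳ c)
sumTo-* (suc n) c f = trans (cong (c ℚ.* f 0 ℚ.+_) (sumTo-* n c _)) (sym (ℚₚ.*-distribˡ-+ c (f 0) _))

sumTo-swap : ∀ m n (f : ℕ → ℕ → ℚ) → sumTo m (λ i → sumTo n (f i)) ≡ sumTo n (λ j → sumTo m (λ i → f i j))
sumTo-swap zero    n f = sym (sumTo-zero n)
sumTo-swap (suc m) n f = trans (cong (sumTo n (f 0) ℚ.+_) (sumTo-swap m n (λ i → f (suc i)))) (sym (sumTo-+ n (f 0) _))

sumTo-snoc : ∀ n f → sumTo (suc n) f ≡ sumTo n f ℚ.+ f n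
sumTo-snoc zero    f = ℚₚ.+-comm (f 0) 0ℚ
sumTo-snoc (suc n) f = trans (cong (f 0 ℚ.+_) (sumTo-snoc n (λ i → f (suc i)))) (sym (ℚₚ.+-assoc (f 0) _ _))

sumTo-const : ∀ n c → sumTo n (λ _ → c) ≡ ι n ℚ.* c
sumTo-const zero    c = sym (ℚₚ.*-zeroˡ c)
sumTo-const (suc n) c = trans (cong (c ℚ.+_) (sumTo-const n c)) (sym (trans (cong (ℚ._* c) (ι-+ 1 n))
  (trans (ℚₚ.*-distribʳ-+ c 1ℚ (ι n)) (cong (ℚ._+ ι n ℚ.* c) (ℚₚ.*-identityˡ c)))))

term≤sumTo : ∀ n f j → j < n → (∀ i → i < n → 0ℚ ℚ.≤ f i) → f j ℚ.≤ sumTo n f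
term≤sumTo (suc n) f zero    _         h = subst (ℚ._≤ sumTo (suc n) f) (ℚₚ.+-identityʳ (f 0))
  (ℚₚ.+-monoʳ-≤ (f 0) (sumTo-nonneg n (λ i i<n → h (suc i) (s≤s i<n))))
term≤sumTo (suc n) f (suc j) (s≤s j<n) h = subst (ℚ._≤ sumTo (suc n) f) (ℚₚ.+-identityˡ (f (suc j)))
  (ℚₚ.+-mono-≤ (h 0 (s≤s z≤n)) (term≤sumTo n _ j j<n (λ i i<n → h (suc i) (s≤s i<n))))

-- The four-point strategy and its placement among n indices

¼ ⅛ : ℚ
¼ = ½ ℚ.* ½
⅛ = ½ ℚ.* ¼

0≤½ : 0ℚ ℚ.≤ ½
0≤½ = ℚₚ.<⇒≤ (ℚₚ.positive⁻¹ ½)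

0≤¼ : 0ℚ ℚ.≤ ¼
0≤¼ = 0≤* 0≤½ 0≤½

0≤⅛ : 0ℚ ℚ.≤ ⅛
0≤⅛ = 0≤* 0≤½ 0≤¼

-- The four-point strategy when the two visible gaps are in proportion u : 1 − u.
quad : ℚ → ℕ → ℚ
quad u 0 = ¼ ℚ.- ⅛ ℚ.* u
quad u 1 = ¼ ℚ.+ ¼ ℚ.* u
quad u 2 = ¼ ℚ.- ¼ ℚ.* u
quad u 3 = ¼ ℚ.+ ⅛ ℚ.* u
quad u (suc (suc (suc (suc _)))) = 0ℚ

p≤q⇒0≤q-p : ∀ {p q} → p ℚ.≤ q → 0ℚ ℚ.≤ q ℚ.- p
p≤q⇒0≤q-p {p} {q} p≤q = subst (ℚ._≤ q ℚ.- p) (ℚₚ.+-inverseʳ p) (ℚₚ.+-monoˡ-≤ (ℚ.- p) p≤q)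

quad-nonneg : ∀ {u} → 0ℚ ℚ.≤ u → u ℚ.≤ 1ℚ → ∀ i → 0ℚ ℚ.≤ quad u i
quad-nonneg {u} 0≤u u≤1 = go
  where
  open +-*-Solver
  0≤1-u = p≤q⇒0≤q-p u≤1
  go : ∀ i → 0ℚ ℚ.≤ quad u i
  go 0 = subst (0ℚ ℚ.≤_) (solve 1 (λ u → con ⅛ :* (con 1ℚ :- u) :+ con ⅛ := con ¼ :- con ⅛ :* u) refl u) (0≤+ (0≤* 0≤⅛ 0≤1-u) 0≤⅛)
  go 1 = 0≤+ 0≤¼ (0≤* 0≤¼ 0≤u)
  go 2 = subst (0ℚ ℚ.≤_) (solve 1 (λ u → con ¼ :* (con 1ℚ :- u) := con ¼ :- con ¼ :* u) refl u) (0≤* 0≤¼ 0≤1-u)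
  go 3 = 0≤+ 0≤¼ (0≤* 0≤⅛ 0≤u)
  go (suc (suc (suc (suc _)))) = ℚₚ.≤-refl

quad-total : ∀ u → quad u 0 ℚ.+ (quad u 1 ℚ.+ (quad u 2 ℚ.+ quad u 3)) ≡ 1ℚ
quad-total = solve 1 (λ u → con ¼ :- con ⅛ :* u :+ (con ¼ :+ con ¼ :* u :+
  (con ¼ :- con ¼ :* u :+ (con ¼ :+ con ⅛ :* u))) := con 1ℚ) refl
  where open +-*-Solver

-- Here w, v, q, p are the ratios seen when the first, second, third, fourth point is missing. The
-- constants ¼ add up to 1 and the linear terms to ⅛(p + 2v - 2q - w).
quad-payoff : ∀ w v q p k → w ℚ.+ (q ℚ.+ q) ℚ.+ k ℚ.≤ p ℚ.+ (v ℚ.+ v) →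
  1ℚ ℚ.+ ⅛ ℚ.* k ℚ.≤ quad w 0 ℚ.+ (quad v 1 ℚ.+ (quad q 2 ℚ.+ quad p 3))
quad-payoff w v q p k h = begin
  1ℚ ℚ.+ ⅛ ℚ.* k
    ≡⟨ solve 3 (λ w q k → con 1ℚ :+ con ⅛ :* k := con 1ℚ :- con ⅛ :* (w :+ (q :+ q)) :+ con ⅛ :* (w :+ (q :+ q) :+ k)) refl w q k ⟩
  1ℚ ℚ.- ⅛ ℚ.* (w ℚ.+ (q ℚ.+ q)) ℚ.+ ⅛ ℚ.* (w ℚ.+ (q ℚ.+ q) ℚ.+ k)
    ≤⟨ ℚₚ.+-monoʳ-≤ (1ℚ ℚ.- ⅛ ℚ.* (w ℚ.+ (q ℚ.+ q))) (*-monoˡ _ _ 0≤⅛ h) ⟩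
  1ℚ ℚ.- ⅛ ℚ.* (w ℚ.+ (q ℚ.+ q)) ℚ.+ ⅛ ℚ.* (p ℚ.+ (v ℚ.+ v))
    ≡⟨ solve 4 (λ w v q p → con 1ℚ :- con ⅛ :* (w :+ (q :+ q)) :+ con ⅛ :* (p :+ (v :+ v)) :=
         con ¼ :- con ⅛ :* w :+ (con ¼ :+ con ¼ :* v :+
         (con ¼ :- con ¼ :* q :+ (con ¼ :+ con ⅛ :* p)))) refl w v q p ⟩
  quad w 0 ℚ.+ (quad v 1 ℚ.+ (quad q 2 ℚ.+ quad p 3)) ∎
  where
  open ℚₚ.≤-Reasoning
  open +-*-Solver

place : ℕ → (ℕ → ℚ) → ℕ → ℚ
place zero    f i       = f i
place (suc j) f zero    = 0ℚ
place (suc j) f (suc i) = place j f i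

place-nonneg : ∀ j {f} → (∀ i → 0ℚ ℚ.≤ f i) → ∀ i → 0ℚ ℚ.≤ place j f i
place-nonneg zero    h i       = h i
place-nonneg (suc j) h zero    = ℚₚ.≤-refl
place-nonneg (suc j) h (suc i) = place-nonneg j h i

place-outside : ∀ j f → (∀ t → f (4 + t) ≡ 0ℚ) → ∀ i → 4 + j ≤ i → place j f i ≡ 0ℚ
place-outside zero    f h (suc (suc (suc (suc i)))) _ = h i
place-outside zero    f h (suc zero) (s≤s ())
place-outside zero    f h (suc (suc zero)) (s≤s (s≤s ()))
place-outside zero    f h (suc (suc (suc zero))) (s≤s (s≤s (s≤s ())))
place-outside (suc j) f h (suc i) (s≤s le) = place-outside j f h i le

-- The family `f` varies with i because the weights depend on what is shown after i is deleted.
sumTo-place : ∀ n j (f : ℕ → ℕ → ℚ) → 4 + j ≤ n → (∀ i t → f i (4 + t) ≡ 0ℚ) →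
  sumTo n (λ i → place j (f i) i) ≡ f j 0 ℚ.+ (f (1 + j) 1 ℚ.+ (f (2 + j) 2 ℚ.+ f (3 + j) 3))
sumTo-place (suc (suc zero)) zero _ (s≤s (s≤s ()))
sumTo-place (suc (suc (suc zero))) zero _ (s≤s (s≤s (s≤s ())))
sumTo-place (suc (suc (suc (suc n)))) zero f _ h =
  cong (f 0 0 ℚ.+_) (cong (f 1 1 ℚ.+_) (cong (f 2 2 ℚ.+_)
    (trans (cong (f 3 3 ℚ.+_) (trans (sumTo-cong n (λ i _ → h (4 + i) i)) (sumTo-zero n))) (ℚₚ.+-identityʳ (f 3 3)))))
sumTo-place (suc n) (suc j) f (s≤s le) h = trans (ℚₚ.+-identityˡ _) (sumTo-place n j (λ i → f (suc i)) le (λ i → h (suc i)))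

-- The map `punchIn` on natural numbers: the original index of the j-th number left when the i-th is
-- deleted.
skip : ℕ → ℕ → ℕ
skip zero    j       = suc j
skip (suc i) zero    = zero
skip (suc i) (suc j) = suc (skip i j)

skip-≥ : ∀ {i j} → i ≤ j → skip i j ≡ suc j
skip-≥ z≤n     = refl
skip-≥ (s≤s h) = cong suc (skip-≥ h)

skip-< : ∀ {i j} → j < i → skip i j ≡ j
skip-< {suc i} {zero}  _       = refl
skip-< {suc i} {suc j} (s≤s h) = cong suc (skip-< h)

skip≤ : ∀ i j → skip i j ≤ suc j
skip≤ zero    j       = ≤-refl
skip≤ (suc i) zero    = z≤n
skip≤ (suc i) (suc j) = s≤s (skip≤ i j)

-- Perturbed plays and randomized strategies

Near : ℕ → ℕ → Set
Near x y = x ≤ suc y × y ≤ suc x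

near-gap : ∀ {x x′ s s′ g} → Near x s → Near x′ s′ → s + g ≡ s′ → (x′ ∸ x ≤ 2 + g) × (g ≤ 2 + (x′ ∸ x))
near-gap {x} {x′} {s} {s′} {g} (x≤ , ≤x) (x′≤ , ≤x′) refl =
  ℕₚ.m≤n+o⇒m∸n≤o x′ x (≤-trans x′≤ (≤-trans (s≤s (ℕₚ.+-monoˡ-≤ g ≤x)) (≤-reflexive (e x g)))) ,
  ℕₚ.+-cancelˡ-≤ s g _ (≤-trans ≤x′ (≤-trans (s≤s (ℕₚ.m≤n+m∸n x′ x)) (≤-trans (s≤s (ℕₚ.+-monoˡ-≤ (x′ ∸ x) x≤)) (≤-reflexive (e s (x′ ∸ x))))))
  where
  e : ∀ x g → suc (suc x + g) ≡ x + (2 + g)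
  e = solve-∀

-- Here `v i` is what is shown when index i is deleted. Total functions make it easy to turn
-- logarithms and reflections of a play into a play again; only entries in range are constrained.
record Play (n N : ℕ) (s : ℕ → ℕ) (v : ℕ → ℕ → ℕ) : Set where
  field
    lower : ∀ i → i < n → 1 ≤ s i
    upper : ∀ i → i < n → s i ≤ N
    apart : ∀ i → suc i < n → s i + 20 ≤ s (suc i)
    close : ∀ i j → i < n → suc j < n → Near (v i j) (s (skip i j))

-- The weights form a probability vector for every x, whether or not x can be shown in a play, as an
-- algorithm must answer every input.
record Strategy (n : ℕ) : Set where
  field
    weight  : (ℕ → ℕ) → ℕ → ℚ
    nonneg  : ∀ x i → 0ℚ ℚ.≤ weight x i
    outside : ∀ x i → n ≤ i → weight x i ≡ 0ℚ
    norm    : ∀ x → sumTo n (weight x) ≡ 1ℚ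
open Strategy

payoff : ∀ {n} → Strategy n → (ℕ → ℕ → ℕ) → ℚ
payoff {n} A v = sumTo n (λ i → weight A (v i) i)

payoff-nonneg : ∀ {n} (A : Strategy n) v → 0ℚ ℚ.≤ payoff A v
payoff-nonneg {n} A v = sumTo-nonneg n (λ i _ → nonneg A (v i) i)

ratio : (ℕ → ℕ) → ℕ → ℚ
ratio x j = share (x (1 + j) ∸ x j) (x (2 + j) ∸ x (1 + j))

quad-ratio-nonneg : ∀ x j i → 0ℚ ℚ.≤ quad (ratio x j) i
quad-ratio-nonneg x j = quad-nonneg (0≤frac p (p + q)) (frac≤1 p (p + q) (m≤m+n p q))
  where
  p = x (1 + j) ∸ x j
  q = x (2 + j) ∸ x (1 + j)

average : ℕ → (ℕ → ℚ) → ℚ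
average q f = inv (ι (1 + q)) ℚ.* sumTo (1 + q) f

average-const : ∀ q c → average q (λ _ → c) ≡ c
average-const q c = trans (cong (inv (ι (1 + q)) ℚ.*_) (sumTo-const (1 + q) c))
  (trans (sym (ℚₚ.*-assoc (inv (ι (1 + q))) (ι (1 + q)) c))
  (trans (cong (ℚ._* c) (inv-* {ι (1 + q)} (0<ι {1 + q} (s≤s z≤n)))) (ℚₚ.*-identityˡ c)))

sumTo-average : ∀ n q (f : ℕ → ℕ → ℚ) → sumTo n (λ i → average q (f i)) ≡ average q (λ j → sumTo n (λ i → f i j))
sumTo-average n q f = trans (sumTo-* n (inv (ι (1 + q))) (λ i → sumTo (1 + q) (f i)))
  (cong (inv (ι (1 + q)) ℚ.*_) (sumTo-swap n (1 + q) f))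

average-cong : ∀ q {f g : ℕ → ℚ} → (∀ j → j < 1 + q → f j ≡ g j) → average q f ≡ average q g
average-cong q h = cong (inv (ι (1 + q)) ℚ.*_) (sumTo-cong (1 + q) h)

average-mono : ∀ q {f g : ℕ → ℚ} → (∀ j → j < 1 + q → f j ℚ.≤ g j) → average q f ℚ.≤ average q g
average-mono q {f} {g} h = *-monoˡ (sumTo (1 + q) f) (sumTo (1 + q) g) (0≤inv-ι (1 + q)) (sumTo-mono (1 + q) h)

average-+ : ∀ q f g → average q (λ j → f j ℚ.+ g j) ≡ average q f ℚ.+ average q g
average-+ q f g = trans (cong (inv (ι (1 + q)) ℚ.*_) (sumTo-+ (1 + q) f g))
  (ℚₚ.*-distribˡ-+ (inv (ι (1 + q))) (sumTo (1 + q) f) (sumTo (1 + q) g))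

-- Play the four-point strategy at a uniformly random place j.
balanced : ∀ q → Strategy (4 + q)
balanced q = record
  { weight  = λ x i → average q (λ j → place j (quad (ratio x j)) i)
  ; nonneg  = λ x i → 0≤* (0≤inv-ι (1 + q)) (sumTo-nonneg (1 + q) (λ j _ → place-nonneg j (quad-ratio-nonneg x j) i))
  ; outside = λ x i n≤i → trans
      (average-cong q (λ j j<1+q → place-outside j (quad (ratio x j)) (λ _ → refl) i (≤-trans (ℕₚ.+-monoʳ-≤ 3 j<1+q) n≤i)))
      (average-const q 0ℚ)
  ; norm    = λ x → trans (sumTo-average (4 + q) q (λ i j → place j (quad (ratio x j)) i))
      (trans (average-cong q (λ j j<1+q → trans
          (sumTo-place (4 + q) j (λ _ → quad (ratio x j)) (ℕₚ.+-monoʳ-≤ 3 j<1+q) (λ _ _ → refl))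
          (quad-total (ratio x j))))
        (average-const q 1ℚ))
  }

gap : (ℕ → ℕ) → ℕ → ℕ
gap s l = s (suc l) ∸ s l

module _ {n N s v} (P : Play n N s v) where
  open Play P

  s+gap : ∀ l → suc l < n → s l + gap s l ≡ s (suc l)
  s+gap l h = ℕₚ.m+[n∸m]≡n (≤-trans (m≤m+n (s l) 20) (apart l h))

  20≤gap : ∀ l → suc l < n → 20 ≤ gap s l
  20≤gap l h = ℕₚ.+-cancelˡ-≤ (s l) 20 (gap s l) (≤-trans (apart l h) (≤-reflexive (sym (s+gap l h))))

  gap≤ : ∀ l → suc l < n → gap s l ≤ N
  gap≤ l h = ≤-trans (ℕₚ.m∸n≤m (s (suc l)) (s l)) (upper (suc l) h)

  close′ : ∀ {i j t} → i < n → suc j < n → skip i j ≡ t → Near (v i j) (s t)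
  close′ {i} {j} i<n j<n e = subst (λ t → Near (v i j) (s t)) e (close i j i<n j<n)

-- The factor ⅛ comes from the weights of the four-point strategy, the 4 in the denominator from the
-- quarter of the exact gain that survives perturbation.
gainAt : (ℕ → ℕ) → ℕ → ℚ
gainAt s j = ⅛ ℚ.* frac (cubic a b c) (4 * crossed a b c)
  where
  a = gap s j
  b = gap s (1 + j)
  c = gap s (2 + j)

0≤gainAt : ∀ s j → 0ℚ ℚ.≤ gainAt s j
0≤gainAt s j = 0≤* 0≤⅛ (0≤frac (cubic a b c) (4 * crossed a b c))
  where
  a = gap s j
  b = gap s (1 + j)
  c = gap s (2 + j)

balanced-local : ∀ {n N s v} → Play n N s v → ∀ j → 3 + j < n →
  1ℚ ℚ.+ gainAt s j ℚ.≤ quad (ratio (v j) j) 0 ℚ.+ (quad (ratio (v (1 + j)) j) 1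
    ℚ.+ (quad (ratio (v (2 + j)) j) 2 ℚ.+ quad (ratio (v (3 + j)) j) 3))
balanced-local {n} {N} {s} {v} P j 3+j<n = quad-payoff (ratio (v j) j) (ratio (v (1 + j)) j) (ratio (v (2 + j)) j) (ratio (v (3 + j)) j)
  (frac (cubic a b c) (4 * crossed a b c))
  (share-gain (20≤gap P j 1+j<n) (20≤gap P (1 + j) 2+j<n) (20≤gap P (2 + j) 3+j<n)
    (proj₂ (near-gap x₃₀ x₃₁ sa)) (proj₁ (near-gap x₃₁ x₃₂ sb))
    (proj₁ (near-gap x₂₀ x₂₁ sa)) (proj₂ (near-gap x₂₁ x₂₂ sbc))
    (proj₂ (near-gap x₁₀ x₁₁ sab)) (proj₁ (near-gap x₁₁ x₁₂ sc))
    (proj₁ (near-gap x₀₀ x₀₁ sb)) (proj₂ (near-gap x₀₁ x₀₂ sc)))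
  where
  a = gap s j
  b = gap s (1 + j)
  c = gap s (2 + j)
  2+j<n : 2 + j < n
  2+j<n = <⇒≤ 3+j<n
  1+j<n : 1 + j < n
  1+j<n = <⇒≤ 2+j<n
  j<n : j < n
  j<n = <⇒≤ 1+j<n
  sa = s+gap P j 1+j<n
  sb = s+gap P (1 + j) 2+j<n
  sc = s+gap P (2 + j) 3+j<n
  sab : s j + (a + b) ≡ s (2 + j)
  sab = trans (sym (ℕₚ.+-assoc (s j) a b)) (trans (cong (_+ b) sa) sb)
  sbc : s (1 + j) + (b + c) ≡ s (3 + j)
  sbc = trans (sym (ℕₚ.+-assoc (s (1 + j)) b c)) (trans (cong (_+ c) sb) sc)
  -- In each name the first index tells which of the four points is deleted, the second which of the
  -- three visible ones is compared with its true position.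
  x₀₀ = close′ P j<n 1+j<n (skip-≥ (≤-refl {j}))
  x₀₁ = close′ P j<n 2+j<n (skip-≥ (m≤n+m j 1))
  x₀₂ = close′ P j<n 3+j<n (skip-≥ (m≤n+m j 2))
  x₁₀ = close′ P 1+j<n 1+j<n (skip-< (≤-refl {1 + j}))
  x₁₁ = close′ P 1+j<n 2+j<n (skip-≥ (≤-refl {1 + j}))
  x₁₂ = close′ P 1+j<n 3+j<n (skip-≥ (m≤n+m (1 + j) 1))
  x₂₀ = close′ P 2+j<n 1+j<n (skip-< (m≤n+m (1 + j) 1))
  x₂₁ = close′ P 2+j<n 2+j<n (skip-< (≤-refl {2 + j}))
  x₂₂ = close′ P 2+j<n 3+j<n (skip-≥ (≤-refl {2 + j}))
  x₃₀ = close′ P 3+j<n 1+j<n (skip-< (m≤n+m (1 + j) 2))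
  x₃₁ = close′ P 3+j<n 2+j<n (skip-< (m≤n+m (2 + j) 1))
  x₃₂ = close′ P 3+j<n 3+j<n (skip-< (≤-refl {3 + j}))

balanced-payoff : ∀ {q N s v} → Play (4 + q) N s v → 1ℚ ℚ.+ average q (gainAt s) ℚ.≤ payoff (balanced q) v
balanced-payoff {q} {N} {s} {v} P = begin
  1ℚ ℚ.+ average q (gainAt s)
    ≡⟨ cong (ℚ._+ average q (gainAt s)) (sym (average-const q 1ℚ)) ⟩
  average q (λ _ → 1ℚ) ℚ.+ average q (gainAt s)
    ≡⟨ sym (average-+ q (λ _ → 1ℚ) (gainAt s)) ⟩
  average q (λ j → 1ℚ ℚ.+ gainAt s j)
    ≤⟨ average-mono q (λ j j<1+q → balanced-local P j (ℕₚ.+-monoʳ-≤ 3 j<1+q)) ⟩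
  average q (λ j → quad (ratio (v j) j) 0 ℚ.+ (quad (ratio (v (1 + j)) j) 1
    ℚ.+ (quad (ratio (v (2 + j)) j) 2 ℚ.+ quad (ratio (v (3 + j)) j) 3)))
    ≡⟨ average-cong q (λ j j<1+q → sym (sumTo-place (4 + q) j (λ i → quad (ratio (v i) j)) (ℕₚ.+-monoʳ-≤ 3 j<1+q) (λ _ _ → refl))) ⟩
  average q (λ j → sumTo (4 + q) (λ i → place j (quad (ratio (v i) j)) i))
    ≡⟨ sym (sumTo-average (4 + q) q (λ i j → place j (quad (ratio (v i) j)) i)) ⟩
  payoff (balanced q) v ∎
  where open ℚₚ.≤-Reasoning

balanced≥1 : ∀ {q N s v} → Play (4 + q) N s v → 1ℚ ℚ.≤ payoff (balanced q) v
balanced≥1 {q} {N} {s} P = ℚₚ.≤-trans (subst (ℚ._≤ 1ℚ ℚ.+ average q (gainAt s)) (ℚₚ.+-identityʳ 1ℚ)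
  (ℚₚ.+-monoʳ-≤ 1ℚ (0≤* (0≤inv-ι (1 + q)) (sumTo-nonneg (1 + q) (λ j _ → 0≤gainAt s j))))) (balanced-payoff P)

-- Two consecutive gaps of comparable size, or a local extremum.
Unseparated : ℕ → (ℕ → ℕ) → ℕ → Set
Unseparated M s j = (a ≤ M * b ⊎ b ≤ M * c) × (c ≤ M * b ⊎ b ≤ M * a)
  where
  a = gap s j
  b = gap s (1 + j)
  c = gap s (2 + j)

-- One such place is enough: the gains at the other places are nonnegative, so only the factor 1/(1
-- + q) for choosing this place is lost.
balanced-gain : ∀ {q N s v} M → Play (4 + q) N s v → ∀ j → j < 1 + q → Unseparated M s j →
  1ℚ ℚ.+ inv (ι (1 + q)) ℚ.* (⅛ ℚ.* frac 1 (4 * (2 + M))) ℚ.≤ payoff (balanced q) v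
balanced-gain {q} {N} {s} M P j j<1+q (h , h′) = ℚₚ.≤-trans
  (ℚₚ.+-monoʳ-≤ 1ℚ (*-monoˡ (⅛ ℚ.* frac 1 (4 * (2 + M))) (sumTo (1 + q) (gainAt s)) (0≤inv-ι (1 + q))
    (ℚₚ.≤-trans (*-monoˡ (frac 1 (4 * (2 + M))) (frac (cubic a b c) (4 * crossed a b c)) 0≤⅛
        (frac-cross 1 (4 * (2 + M)) (cubic a b c) (4 * crossed a b c) (s≤s z≤n) 0<D (begin
          1 * (4 * crossed a b c)             ≡⟨ ℕₚ.*-identityˡ (4 * crossed a b c) ⟩
          4 * crossed a b c                   ≤⟨ ℕₚ.*-monoʳ-≤ 4 (crossed≤cubic M a b c h h′) ⟩
          4 * ((2 + M) * cubic a b c)         ≡⟨ e M (cubic a b c) ⟩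
          cubic a b c * (4 * (2 + M))         ∎)))
      (term≤sumTo (1 + q) (gainAt s) j j<1+q (λ i _ → 0≤gainAt s i)))))
  (balanced-payoff P)
  where
  open ℕₚ.≤-Reasoning
  a = gap s j
  b = gap s (1 + j)
  c = gap s (2 + j)
  e : ∀ M k → 4 * ((2 + M) * k) ≡ k * (4 * (2 + M))
  e = solve-∀
  3+j<n : 3 + j < 4 + q
  3+j<n = ℕₚ.+-monoʳ-≤ 3 j<1+q
  0<b : 0 < b
  0<b = ≤-trans (s≤s z≤n) (20≤gap P (1 + j) (<⇒≤ 3+j<n))
  0<D : 0 < 4 * crossed a b c
  0<D = ≤-trans (*-mono-≤ (*-mono-≤ (≤-trans 0<b (m≤n+m b a)) (≤-trans 0<b (m≤m+n b c))) (≤-trans 0<b (≤-trans (m≤n+m b a) (m≤m+n (a + b) c))))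
    (m≤m+n (crossed a b c) _)

-- Passing to the logarithms of the gaps

-- A factor of at most 2 either way moves the truncated logarithm by at most 1. The additive error 2
-- is absorbed because H ≥ 2.
⌊log₂⌋-near : ∀ {G H} → 20 ≤ G → G ≤ 2 + H → H ≤ 2 * G → Near ⌊log₂ H ⌋ ⌊log₂ G ⌋
⌊log₂⌋-near {G@(suc _)} {zero}  20≤G G≤2+H _ with ≤-trans 20≤G G≤2+H
... | s≤s (s≤s ())
⌊log₂⌋-near {G@(suc _)} {H@(suc _)} 20≤G G≤2+H H≤2G =
  ≤-trans (⌊log₂⌋-mono-≤ H≤2G) (≤-reflexive (⌊log₂[2*b]⌋≡1+⌊log₂b⌋ G)) ,
  ≤-trans (⌊log₂⌋-mono-≤ G≤2H) (≤-reflexive (⌊log₂[2*b]⌋≡1+⌊log₂b⌋ H))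
  where
  2≤H : 2 ≤ H
  2≤H = ≤-trans (s≤s (s≤s z≤n)) (s≤s⁻¹ (s≤s⁻¹ (≤-trans 20≤G G≤2+H)))
  G≤2H : G ≤ 2 * H
  G≤2H = ≤-trans G≤2+H (≤-trans (ℕₚ.+-monoˡ-≤ H 2≤H) (≤-reflexive (cong (H +_) (sym (ℕₚ.+-identityʳ H)))))

1≤⌊log₂⌋ : ∀ {x} → 2 ≤ x → 1 ≤ ⌊log₂ x ⌋
1≤⌊log₂⌋ {x} 2≤x = ⌊log₂⌋-mono-≤ {2} {x} 2≤x

-- The margin 2 makes room for the perturbation of a visible gap, so that a perturbed merged gap is
-- still at most twice the larger of its two parts.
⌊log₂⌋-apart : ∀ {x y} → 2 ≤ x → 0 < y → ⌊log₂ x ⌋ + 20 ≤ ⌊log₂ y ⌋ → 2 + x ≤ y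
⌊log₂⌋-apart {x} {y} 2≤x 0<y h = begin
  2 + x                       ≤⟨ ℕₚ.+-monoˡ-≤ x 2≤x ⟩
  x + x                       ≡⟨ cong (x +_) (sym (ℕₚ.+-identityʳ x)) ⟩
  2 * x                       ≤⟨ ℕₚ.*-monoʳ-≤ 2 (<⇒≤ (n<2^[1+⌊log₂n⌋] x (≤-trans (s≤s z≤n) 2≤x))) ⟩
  2 ^ (2 + ⌊log₂ x ⌋)         ≤⟨ ℕₚ.^-monoʳ-≤ 2 (≤-trans (≤-reflexive (ℕₚ.+-comm 2 ⌊log₂ x ⌋)) (≤-trans (ℕₚ.+-monoʳ-≤ ⌊log₂ x ⌋ (s≤s (s≤s z≤n))) h)) ⟩
  2 ^ ⌊log₂ y ⌋               ≤⟨ 2^⌊log₂n⌋≤n y 0<y ⟩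
  y                           ∎
  where open ℕₚ.≤-Reasoning

⌊log₂⌋-comparable : ∀ d {x y} → 0 < x → 0 < y → ⌊log₂ y ⌋ < ⌊log₂ x ⌋ + d → y ≤ 2 ^ d * x
⌊log₂⌋-comparable d {x} {y} 0<x 0<y h = begin
  y                             ≤⟨ <⇒≤ (n<2^[1+⌊log₂n⌋] y 0<y) ⟩
  2 ^ (1 + ⌊log₂ y ⌋)           ≤⟨ ℕₚ.^-monoʳ-≤ 2 h ⟩
  2 ^ (⌊log₂ x ⌋ + d)           ≡⟨ trans (ℕₚ.^-distribˡ-+-* 2 ⌊log₂ x ⌋ d) (ℕₚ.*-comm (2 ^ ⌊log₂ x ⌋) (2 ^ d)) ⟩
  2 ^ d * 2 ^ ⌊log₂ x ⌋         ≤⟨ ℕₚ.*-monoʳ-≤ (2 ^ d) (2^⌊log₂n⌋≤n x 0<x) ⟩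
  2 ^ d * x                     ∎
  where open ℕₚ.≤-Reasoning

Additive Roomy : (ℕ → ℕ) → ℕ → Set
Additive s n = ∀ l → l < n → s l + gap s l ≡ s (suc l)
Roomy    s n = ∀ l → l < n → 2 ≤ gap s l

-- Deleting a point merges two gaps; when the gaps grow (or shrink) fast, the merged gap
-- is the larger of the two up to a factor less than 2.
merged-growing : ∀ n s g j → suc j < n → Additive s n → Roomy s n → (∀ l → suc l < n → 2 + gap s l ≤ gap s (suc l)) →
  ∃ λ e → s (skip (suc g) j) + (gap s (skip g j) + e) ≡ s (skip (suc g) (suc j)) × 2 + e ≤ gap s (skip g j)
-- Point 1 is deleted: gaps 0 and 1 merge, and the excess over gap 1 is gap 0. In the next two cases
-- the visible gap is a true gap and the excess is 0.
merged-growing n s zero zero 1<n add room grow =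
  gap s 0 , trans (trans (cong (s 0 +_) (ℕₚ.+-comm (gap s 1) (gap s 0))) (trans (sym (ℕₚ.+-assoc (s 0) _ _)) (cong (_+ gap s 1) (add 0 (<⇒≤ 1<n))))) (add 1 1<n) , grow 0 1<n
merged-growing n s zero (suc j) 2+j<n add room grow =
  0 , trans (cong (s (2 + j) +_) (ℕₚ.+-identityʳ _)) (add (2 + j) 2+j<n) , room (2 + j) 2+j<n
merged-growing n s (suc g) zero 1<n add room grow =
  0 , trans (cong (s 0 +_) (ℕₚ.+-identityʳ _)) (add 0 (<⇒≤ 1<n)) , room 0 (<⇒≤ 1<n)
merged-growing (suc n) s (suc g) (suc j) (s≤s 1+j<n) add room grow =
  merged-growing n (λ l → s (suc l)) g j 1+j<n (λ l h → add (suc l) (s≤s h)) (λ l h → room (suc l) (s≤s h)) (λ l h → grow (suc l) (s≤s h))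

-- For shrinking gaps the right one of two merged gaps is lost, so deleting point g deletes gap g;
-- for growing gaps the left one is lost, and it is point g + 1 whose deletion deletes gap g.
merged-shrinking : ∀ n s g j → suc j < n → Additive s n → Roomy s n → (∀ l → suc l < n → 2 + gap s (suc l) ≤ gap s l) →
  ∃ λ e → s (skip g j) + (gap s (skip g j) + e) ≡ s (skip g (suc j)) × 2 + e ≤ gap s (skip g j)
merged-shrinking n s zero j 1+j<n add room shrink =
  0 , trans (cong (s (1 + j) +_) (ℕₚ.+-identityʳ _)) (add (1 + j) 1+j<n) , room (1 + j) 1+j<n
merged-shrinking n s (suc zero) zero 1<n add room shrink =
  gap s 1 , trans (trans (sym (ℕₚ.+-assoc (s 0) _ _)) (cong (_+ gap s 1) (add 0 (<⇒≤ 1<n)))) (add 1 1<n) , shrink 0 1<n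
merged-shrinking n s (suc (suc g)) zero 1<n add room shrink =
  0 , trans (cong (s 0 +_) (ℕₚ.+-identityʳ _)) (add 0 (<⇒≤ 1<n)) , room 0 (<⇒≤ 1<n)
merged-shrinking (suc n) s (suc g) (suc j) (s≤s 1+j<n) add room shrink =
  merged-shrinking n (λ l → s (suc l)) g j 1+j<n (λ l h → add (suc l) (s≤s h)) (λ l h → room (suc l) (s≤s h)) (λ l h → shrink (suc l) (s≤s h))

logs : (ℕ → ℕ) → ℕ → ℕ
logs x j = ⌊log₂ gap x j ⌋

∸-near : ∀ C {x y} → Near x y → Near (C ∸ x) (C ∸ y)
∸-near C (x≤ , y≤) = go x≤ y≤ , go y≤ x≤
  where
  go : ∀ {x y} → x ≤ suc y → y ≤ suc x → C ∸ x ≤ suc (C ∸ y)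
  go {x} {y} x≤ y≤ = ℕₚ.m≤n+o⇒m∸n≤o C x (≤-trans (ℕₚ.m≤n+m∸n C y) (≤-trans (ℕₚ.+-monoˡ-≤ (C ∸ y) y≤) (≤-reflexive (sym (ℕₚ.+-suc x (C ∸ y))))))

∸-apart : ∀ {C x y} → x ≤ C → y + 20 ≤ x → C ∸ x + 20 ≤ C ∸ y
∸-apart {C} {x} {y} x≤C h = ℕₚ.m+n≤o⇒m≤o∸n (C ∸ x + 20) (begin
  C ∸ x + 20 + y       ≡⟨ trans (ℕₚ.+-assoc (C ∸ x) 20 y) (cong (C ∸ x +_) (ℕₚ.+-comm 20 y)) ⟩
  C ∸ x + (y + 20)     ≤⟨ ℕₚ.+-monoʳ-≤ (C ∸ x) h ⟩
  C ∸ x + x            ≡⟨ ℕₚ.m∸n+n≡m x≤C ⟩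
  C                    ∎)
  where open ℕₚ.≤-Reasoning

module _ {n N s v} (P : Play (suc n) N s v) where
  open Play P

  private
    add : Additive s n
    add l h = s+gap P l (s≤s h)
    wide : ∀ l → l < n → 20 ≤ gap s l
    wide l h = 20≤gap P l (s≤s h)
    room : Roomy s n
    room l h = ≤-trans (s≤s (s≤s z≤n)) (wide l h)
    wide₀ : ∀ l → l < n → 0 < gap s l
    wide₀ l h = ≤-trans (s≤s z≤n) (wide l h)
    logs≥1 : ∀ l → l < n → 1 ≤ logs s l
    logs≥1 l h = 1≤⌊log₂⌋ (room l h)
    logs≤ : ∀ l → l < n → logs s l ≤ ⌊log₂ N ⌋
    logs≤ l h = ⌊log₂⌋-mono-≤ (gap≤ P l (s≤s h))

    merged-near : ∀ i j m → i < suc n → suc j < n → m < n →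
      (∃ λ e → s (skip i j) + (gap s m + e) ≡ s (skip i (suc j)) × 2 + e ≤ gap s m) →
      Near (logs (v i) j) (logs s m)
    merged-near i j m i≤n 1+j<n m<n (e , eq , 2+e≤) =
      ⌊log₂⌋-near (wide m m<n) (≤-trans (m≤m+n (gap s m) e) (proj₂ ng))
        (≤-trans (proj₁ ng) (≤-trans (≤-reflexive (shuffle (gap s m) e)) (≤-trans (ℕₚ.+-monoʳ-≤ (gap s m) 2+e≤) (≤-reflexive (cong (gap s m +_) (sym (ℕₚ.+-identityʳ (gap s m))))))))
      where
      ng = near-gap (close i j i≤n (s≤s (<⇒≤ 1+j<n))) (close i (suc j) i≤n (s≤s 1+j<n)) eq
      shuffle : ∀ g e → 2 + (g + e) ≡ g + (2 + e)
      shuffle = solve-∀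

  growing-play : (∀ l → suc l < n → logs s l + 20 ≤ logs s (suc l)) →
    Play n ⌊log₂ N ⌋ (logs s) (λ g → logs (v (suc g)))
  growing-play grow = record
    { lower = logs≥1
    ; upper = logs≤
    ; apart = grow
    ; close = λ g j g<n 1+j<n → merged-near (suc g) j (skip g j) (s≤s g<n) 1+j<n (≤-trans (s≤s (skip≤ g j)) 1+j<n)
        (merged-growing n s g j 1+j<n add room
          (λ l h → ⌊log₂⌋-apart (room l (<⇒≤ h)) (wide₀ (suc l) h) (grow l h)))
    }

  -- The logarithms lie between 1 and ⌊log₂ N⌋; subtracting them from 1 + ⌊log₂ N⌋ preserves this
  -- range and turns decrease into increase.
  shrinking-play : (∀ l → suc l < n → logs s (suc l) + 20 ≤ logs s l) →
    Play n ⌊log₂ N ⌋ (λ l → suc ⌊log₂ N ⌋ ∸ logs s l) (λ g j → suc ⌊log₂ N ⌋ ∸ logs (v g) j)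
  shrinking-play shrink = record
    { lower = λ l h → ℕₚ.m<n⇒0<n∸m (s≤s (logs≤ l h))
    ; upper = λ l h → ≤-trans (ℕₚ.∸-monoʳ-≤ (suc ⌊log₂ N ⌋) (logs≥1 l h)) ≤-refl
    ; apart = λ l h → ∸-apart (ℕₚ.m≤n⇒m≤1+n (logs≤ l (<⇒≤ h))) (shrink l h)
    ; close = λ g j g<n 1+j<n → ∸-near (suc ⌊log₂ N ⌋) (merged-near g j (skip g j) (ℕₚ.m<n⇒m<1+n g<n) 1+j<n (≤-trans (s≤s (skip≤ g j)) 1+j<n)
        (merged-shrinking n s g j 1+j<n add room
          (λ l h → ⌊log₂⌋-apart (room (suc l) h) (wide₀ l (<⇒≤ h)) (shrink l h))))
    }

near-< : ∀ {x y a b} → Near x a → Near y b → a + 20 ≤ b → x < y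
near-< {x} {y} {a} {b} (x≤ , _) (_ , b≤) h = s≤s⁻¹ (≤-trans (s≤s (s≤s x≤)) (≤-trans (≤-trans (≤-trans (m≤m+n (3 + a) 17) (≤-reflexive (e a))) h) b≤))
  where
  e : ∀ a → 3 + a + 17 ≡ a + 20
  e = solve-∀

-- The first two visible logarithms decide whether the gaps grow. If they do, deleting gap i means
-- deleting point i + 1, so the guess of `B` is raised by one; otherwise it is kept. The decision is
-- an argument so that proofs can match on it.
oriented : ∀ {n} (C : ℕ) → Strategy n → (x : ℕ → ℕ) → Dec (logs x 0 < logs x 1) → ℕ → ℚ
oriented C B x (yes _) zero    = 0ℚ
oriented C B x (yes _) (suc i) = weight B (logs x) i
oriented C B x (no  _) i       = weight B (λ j → C ∸ logs x j) i

-- Decreasing logarithms are reflected at C to obtain an increasing sequence again.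
contracted : ∀ {n} → ℕ → Strategy n → Strategy (suc n)
contracted {n} C B = record
  { weight  = λ x → oriented C B x (logs x 0 <? logs x 1)
  ; nonneg  = λ x → pos x (logs x 0 <? logs x 1)
  ; outside = λ x → out x (logs x 0 <? logs x 1)
  ; norm    = λ x → one x (logs x 0 <? logs x 1)
  }
  where
  pos : ∀ x d i → 0ℚ ℚ.≤ oriented C B x d i
  pos x (yes _) zero    = ℚₚ.≤-refl
  pos x (yes _) (suc i) = nonneg B (logs x) i
  pos x (no _)  i       = nonneg B (λ j → C ∸ logs x j) i
  out : ∀ x d i → suc n ≤ i → oriented C B x d i ≡ 0ℚ
  out x (yes _) (suc i) (s≤s n≤i) = outside B (logs x) i n≤i
  out x (no _)  i       n<i       = outside B (λ j → C ∸ logs x j) i (<⇒≤ n<i)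
  one : ∀ x d → sumTo (suc n) (oriented C B x d) ≡ 1ℚ
  one x (yes _) = trans (ℚₚ.+-identityˡ _) (norm B (logs x))
  one x (no _)  = trans (sumTo-snoc n (weight B (λ j → C ∸ logs x j)))
    (trans (cong (sumTo n (weight B (λ j → C ∸ logs x j)) ℚ.+_) (outside B (λ j → C ∸ logs x j) n ≤-refl))
    (trans (ℚₚ.+-identityʳ _) (norm B (λ j → C ∸ logs x j))))

-- The shown logarithms are off by at most 1 while the true ones are 20 apart, so the orientation is
-- recognized and each term of `B` reappears one index higher. The term for deleting point 0 is
-- bounded below by 0.
contracted-growing : ∀ {n N C s v} (B : Strategy n) → 3 ≤ n → Play n N s (λ g → logs (v (suc g))) →
  payoff B (λ g → logs (v (suc g))) ℚ.≤ payoff (contracted C B) v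
contracted-growing {n} {N} {C} {s} {v} B 3≤n P = begin
  sumTo n f                       ≡⟨ sumTo-cong n (λ g g<n → step g g<n (logs (v (suc g)) 0 <? logs (v (suc g)) 1)) ⟩
  sumTo n (λ g → h (suc g))       ≡⟨ sym (ℚₚ.+-identityˡ _) ⟩
  0ℚ ℚ.+ sumTo n (λ g → h (suc g)) ≤⟨ ℚₚ.+-monoˡ-≤ (sumTo n (λ g → h (suc g))) (nonneg (contracted C B) (v 0) 0) ⟩
  sumTo (suc n) h                 ∎
  where
  open ℚₚ.≤-Reasoning
  f h : ℕ → ℚ
  f g = weight B (logs (v (suc g))) g
  h i = weight (contracted C B) (v i) i
  step : ∀ g → g < n → (d : Dec (logs (v (suc g)) 0 < logs (v (suc g)) 1)) → f g ≡ oriented C B (v (suc g)) d (suc g)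
  step g g<n (yes _) = refl
  step g g<n (no ¬p) = ⊥-elim (¬p (near-< (Play.close P g 0 g<n (<⇒≤ 3≤n)) (Play.close P g 1 g<n 3≤n) (increasing g)))
    where
    -- Whichever entry is deleted, at least two remain as n ≥ 3, and the first two are still 20
    -- apart.
    increasing : ∀ g → s (skip g 0) + 20 ≤ s (skip g 1)
    increasing zero          = Play.apart P 1 3≤n
    increasing (suc zero)    = ≤-trans (Play.apart P 0 (<⇒≤ 3≤n)) (≤-trans (m≤m+n (s 1) 20) (Play.apart P 1 3≤n))
    increasing (suc (suc g)) = Play.apart P 0 (<⇒≤ 3≤n)

contracted-shrinking : ∀ {n N C s v} (B : Strategy n) → 3 ≤ n → Play n N s (λ g j → C ∸ logs (v g) j) →
  payoff B (λ g j → C ∸ logs (v g) j) ℚ.≤ payoff (contracted C B) v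
contracted-shrinking {n} {N} {C} {s} {v} B 3≤n P = begin
  sumTo n f                       ≡⟨ sumTo-cong n (λ g g<n → step g g<n (logs (v g) 0 <? logs (v g) 1)) ⟩
  sumTo n h                       ≡⟨ sym (ℚₚ.+-identityʳ _) ⟩
  sumTo n h ℚ.+ 0ℚ                ≤⟨ ℚₚ.+-monoʳ-≤ (sumTo n h) (nonneg (contracted C B) (v n) n) ⟩
  sumTo n h ℚ.+ h n               ≡⟨ sym (sumTo-snoc n h) ⟩
  sumTo (suc n) h                 ∎
  where
  open ℚₚ.≤-Reasoning
  f h : ℕ → ℚ
  f g = weight B (λ j → C ∸ logs (v g) j) g
  h i = weight (contracted C B) (v i) i
  step : ∀ g → g < n → (d : Dec (logs (v g) 0 < logs (v g) 1)) → f g ≡ oriented C B (v g) d g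
  step g g<n (no _)  = refl
  step g g<n (yes p) = ⊥-elim (ℕₚ.<⇒≱ (near-< (Play.close P g 0 g<n (<⇒≤ 3≤n)) (Play.close P g 1 g<n 3≤n) (increasing g)) (ℕₚ.∸-monoʳ-≤ C (<⇒≤ p)))
    where
    increasing : ∀ g → s (skip g 0) + 20 ≤ s (skip g 1)
    increasing zero          = Play.apart P 1 3≤n
    increasing (suc zero)    = ≤-trans (Play.apart P 0 (<⇒≤ 3≤n)) (≤-trans (m≤m+n (s 1) 20) (Play.apart P 1 3≤n))
    increasing (suc (suc g)) = Play.apart P 0 (<⇒≤ 3≤n)

-- If no triple is unseparated, each rises steeply or falls steeply, and consecutive triples go the
-- same way because they share a step.
scan : ∀ q (δ : ℕ → ℕ) →
  (∃ λ j → j < 1 + q × (δ j < δ (1 + j) + 20 ⊎ δ (1 + j) < δ (2 + j) + 20) × (δ (2 + j) < δ (1 + j) + 20 ⊎ δ (1 + j) < δ j + 20))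
  ⊎ (∀ l → l < 2 + q → δ l + 20 ≤ δ (suc l))
  ⊎ (∀ l → l < 2 + q → δ (suc l) + 20 ≤ δ l)
scan zero δ with δ 0 + 20 ≤? δ 1 | δ 1 + 20 ≤? δ 2 | δ 1 + 20 ≤? δ 0 | δ 2 + 20 ≤? δ 1
... | yes a | yes b | _ | _ = inj₂ (inj₁ λ { zero _ → a ; (suc zero) _ → b ; (suc (suc l)) (s≤s (s≤s ())) })
... | _ | _ | yes c | yes d = inj₂ (inj₂ λ { zero _ → c ; (suc zero) _ → d ; (suc (suc l)) (s≤s (s≤s ())) })
... | no a | _ | no c | _ = inj₁ (0 , s≤s z≤n , inj₁ (ℕₚ.≰⇒> c) , inj₂ (ℕₚ.≰⇒> a))
... | no a | _ | yes _ | no d = inj₁ (0 , s≤s z≤n , inj₂ (ℕₚ.≰⇒> d) , inj₂ (ℕₚ.≰⇒> a))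
... | yes _ | no b | no c | _ = inj₁ (0 , s≤s z≤n , inj₁ (ℕₚ.≰⇒> c) , inj₁ (ℕₚ.≰⇒> b))
... | yes _ | no b | yes _ | no d = inj₁ (0 , s≤s z≤n , inj₂ (ℕₚ.≰⇒> d) , inj₁ (ℕₚ.≰⇒> b))
scan (suc q) δ with scan q (λ l → δ (suc l))
... | inj₁ (j , j<1+q , h) = inj₁ (suc j , s≤s j<1+q , h)
-- The tail rises, so the first triple cannot fall; it is unseparated unless its first step rises by
-- 20.
... | inj₂ (inj₁ up) with δ 0 + 20 ≤? δ 1
...   | yes a = inj₂ (inj₁ λ { zero _ → a ; (suc l) (s≤s h) → up l h })
...   | no  a = inj₁ (0 , s≤s z≤n , inj₂ (ℕₚ.≤-<-trans (≤-trans (m≤m+n (δ 1) 20) (up 0 (s≤s z≤n))) (ℕₚ.m<m+n (δ 2) (s≤s z≤n))) , inj₂ (ℕₚ.≰⇒> a))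
scan (suc q) δ | inj₂ (inj₂ down) with δ 1 + 20 ≤? δ 0
...   | yes a = inj₂ (inj₂ λ { zero _ → a ; (suc l) (s≤s h) → down l h })
...   | no  a = inj₁ (0 , s≤s z≤n , inj₁ (ℕₚ.≰⇒> a) , inj₁ (ℕₚ.≤-<-trans (≤-trans (m≤m+n (δ 2) 20) (down 0 (s≤s z≤n))) (ℕₚ.m<m+n (δ 1) (s≤s z≤n))))

-- Induction on the number of points

iter⌊log₂⌋ : ℕ → ℕ → ℕ
iter⌊log₂⌋ zero    N = N
iter⌊log₂⌋ (suc m) N = iter⌊log₂⌋ m ⌊log₂ N ⌋

scale : ℕ → ℕ
scale n = (6 * n) ^ (7 * n)

-- The truncated iterated logarithm can be 0, hence the added 1 in the denominator.
Advantage : ℕ → ℕ → Set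
Advantage m N = Σ (Strategy (2 + m)) λ A → ∀ s v → Play (2 + m) N s v →
  1ℚ ℚ.+ frac 1 (scale (2 + m)) ℚ.* frac 1 (1 + iter⌊log₂⌋ m N) ℚ.≤ payoff A v

frac-* : ∀ a b → 0 < a → 0 < b → frac 1 a ℚ.* frac 1 b ≡ frac 1 (a * b)
frac-* a b 0<a 0<b = trans (cong₂ ℚ._*_ (ℚₚ.*-identityˡ (inv (ι a))) (ℚₚ.*-identityˡ (inv (ι b))))
  (sym (trans (ℚₚ.*-identityˡ (inv (ι (a * b)))) (begin
    k                                                ≡⟨ sym (ℚₚ.*-identityʳ k) ⟩
    k ℚ.* 1ℚ                                         ≡⟨ cong (k ℚ.*_) (sym (trans (cong₂ ℚ._*_ (inv-* {ι a} (0<ι 0<a)) (inv-* {ι b} (0<ι 0<b))) (ℚₚ.*-identityˡ 1ℚ))) ⟩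
    k ℚ.* (i ℚ.* ι a ℚ.* (j ℚ.* ι b))                ≡⟨ shuffle k i (ι a) j (ι b) ⟩
    i ℚ.* j ℚ.* (k ℚ.* (ι a ℚ.* ι b))                ≡⟨ cong (λ z → i ℚ.* j ℚ.* (k ℚ.* z)) (sym (ι-* a b)) ⟩
    i ℚ.* j ℚ.* (k ℚ.* ι (a * b))                    ≡⟨ cong (i ℚ.* j ℚ.*_) (inv-* {ι (a * b)} (0<ι {a * b} (*-mono-≤ 0<a 0<b))) ⟩
    i ℚ.* j ℚ.* 1ℚ                                   ≡⟨ ℚₚ.*-identityʳ _ ⟩
    i ℚ.* j                                          ∎)))
  where
  open ≡-Reasoning
  i = inv (ι a)
  j = inv (ι b)
  k = inv (ι (a * b))
  shuffle : ∀ k i a j b → k ℚ.* (i ℚ.* a ℚ.* (j ℚ.* b)) ≡ i ℚ.* j ℚ.* (k ℚ.* (a ℚ.* b))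
  shuffle = solve 5 (λ k i a j b → k :* (i :* a :* (j :* b)) := i :* j :* (k :* (a :* b))) refl
    where open +-*-Solver

-- Convex combinations of two strategies

mixture : ∀ {n} η → 0ℚ ℚ.≤ η → η ℚ.≤ 1ℚ → Strategy n → Strategy n → Strategy n
mixture {n} η 0≤η η≤1 Z B = record
  { weight  = λ x i → (1ℚ ℚ.- η) ℚ.* weight Z x i ℚ.+ η ℚ.* weight B x i
  ; nonneg  = λ x i → 0≤+ (0≤* (p≤q⇒0≤q-p η≤1) (nonneg Z x i)) (0≤* 0≤η (nonneg B x i))
  ; outside = λ x i n≤i → trans (cong₂ (λ z b → (1ℚ ℚ.- η) ℚ.* z ℚ.+ η ℚ.* b) (outside Z x i n≤i) (outside B x i n≤i))
      (solve 1 (λ η → (con 1ℚ :- η) :* con 0ℚ :+ η :* con 0ℚ := con 0ℚ) refl η)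
  ; norm    = λ x → trans (mixed (weight Z x) (weight B x)) (trans (cong₂ (λ z b → (1ℚ ℚ.- η) ℚ.* z ℚ.+ η ℚ.* b) (norm Z x) (norm B x))
      (solve 1 (λ η → (con 1ℚ :- η) :* con 1ℚ :+ η :* con 1ℚ := con 1ℚ) refl η))
  }
  where
  open +-*-Solver
  mixed : ∀ f g → sumTo n (λ i → (1ℚ ℚ.- η) ℚ.* f i ℚ.+ η ℚ.* g i) ≡ (1ℚ ℚ.- η) ℚ.* sumTo n f ℚ.+ η ℚ.* sumTo n g
  mixed f g = trans (sumTo-+ n (λ i → (1ℚ ℚ.- η) ℚ.* f i) (λ i → η ℚ.* g i)) (cong₂ ℚ._+_ (sumTo-* n (1ℚ ℚ.- η) f) (sumTo-* n η g))

mixture-payoff : ∀ {n} η 0≤η η≤1 (Z B : Strategy n) v →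
  payoff (mixture η 0≤η η≤1 Z B) v ≡ (1ℚ ℚ.- η) ℚ.* payoff Z v ℚ.+ η ℚ.* payoff B v
mixture-payoff {n} η 0≤η η≤1 Z B v = trans (sumTo-+ n (λ i → (1ℚ ℚ.- η) ℚ.* weight Z (v i) i) (λ i → η ℚ.* weight B (v i) i))
  (cong₂ ℚ._+_ (sumTo-* n (1ℚ ℚ.- η) (λ i → weight Z (v i) i)) (sumTo-* n η (λ i → weight B (v i) i)))

-- Since (1 - η)(1 + 4η) = 1 + η + 2η(1 - 2η), a gain of 4η pays for giving up the weight η as long
-- as η ≤ ½.
mixture-gainˡ : ∀ η x z b → 0ℚ ℚ.≤ η → η ℚ.≤ ½ → x ℚ.≤ 1ℚ → 0ℚ ℚ.≤ b → 1ℚ ℚ.+ (η ℚ.+ η ℚ.+ (η ℚ.+ η)) ℚ.≤ z →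
  1ℚ ℚ.+ η ℚ.* x ℚ.≤ (1ℚ ℚ.- η) ℚ.* z ℚ.+ η ℚ.* b
mixture-gainˡ η x z b 0≤η η≤½ x≤1 0≤b h = begin
  1ℚ ℚ.+ η ℚ.* x
    ≤⟨ ℚₚ.+-monoʳ-≤ 1ℚ (*-monoˡ x 1ℚ 0≤η x≤1) ⟩
  1ℚ ℚ.+ η ℚ.* 1ℚ
    ≡⟨ sym (ℚₚ.+-identityʳ _) ⟩
  1ℚ ℚ.+ η ℚ.* 1ℚ ℚ.+ 0ℚ
    ≤⟨ ℚₚ.+-monoʳ-≤ (1ℚ ℚ.+ η ℚ.* 1ℚ) (0≤* (0≤* (0≤+ 0≤½ (0≤+ 0≤½ (0≤+ 0≤½ 0≤½))) 0≤η) (0≤+ (p≤q⇒0≤q-p η≤½) (p≤q⇒0≤q-p η≤½))) ⟩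
  1ℚ ℚ.+ η ℚ.* 1ℚ ℚ.+ (½ ℚ.+ (½ ℚ.+ (½ ℚ.+ ½))) ℚ.* η ℚ.* (½ ℚ.- η ℚ.+ (½ ℚ.- η))
    ≡⟨ solve 1 (λ η → con 1ℚ :+ η :* con 1ℚ :+ (con ½ :+ (con ½ :+ (con ½ :+ con ½))) :* η :* (con ½ :- η :+ (con ½ :- η))
         := (con 1ℚ :- η) :* (con 1ℚ :+ (η :+ η :+ (η :+ η))) :+ con 0ℚ) refl η ⟩
  (1ℚ ℚ.- η) ℚ.* (1ℚ ℚ.+ (η ℚ.+ η ℚ.+ (η ℚ.+ η))) ℚ.+ 0ℚ
    ≤⟨ ℚₚ.+-mono-≤ (*-monoˡ _ z (p≤q⇒0≤q-p (ℚₚ.≤-trans η≤½ (frac≤1 1 2 (s≤s z≤n)))) h) (0≤* 0≤η 0≤b) ⟩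
  (1ℚ ℚ.- η) ℚ.* z ℚ.+ η ℚ.* b ∎
  where
  open ℚₚ.≤-Reasoning
  open +-*-Solver

mixture-gainʳ : ∀ η x z b → 0ℚ ℚ.≤ η → η ℚ.≤ 1ℚ → 1ℚ ℚ.≤ z → 1ℚ ℚ.+ x ℚ.≤ b →
  1ℚ ℚ.+ η ℚ.* x ℚ.≤ (1ℚ ℚ.- η) ℚ.* z ℚ.+ η ℚ.* b
mixture-gainʳ η x z b 0≤η η≤1 1≤z h = begin
  1ℚ ℚ.+ η ℚ.* x
    ≡⟨ solve 2 (λ η x → con 1ℚ :+ η :* x := (con 1ℚ :- η) :* con 1ℚ :+ η :* (con 1ℚ :+ x)) refl η x ⟩
  (1ℚ ℚ.- η) ℚ.* 1ℚ ℚ.+ η ℚ.* (1ℚ ℚ.+ x)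
    ≤⟨ ℚₚ.+-mono-≤ (*-monoˡ 1ℚ z (p≤q⇒0≤q-p η≤1) 1≤z) (*-monoˡ (1ℚ ℚ.+ x) b 0≤η h) ⟩
  (1ℚ ℚ.- η) ℚ.* z ℚ.+ η ℚ.* b ∎
  where
  open ℚₚ.≤-Reasoning
  open +-*-Solver

-- Abstract, because unfolding M in ι M is intractable for the type checker.
abstract
  M : ℕ
  M = 2 ^ 20

  ⌊log₂⌋-<20 : ∀ {x y} → 0 < x → 0 < y → ⌊log₂ y ⌋ < ⌊log₂ x ⌋ + 20 → y ≤ M * x
  ⌊log₂⌋-<20 = ⌊log₂⌋-comparable 20

  128[2+M]≤x^6 : ∀ x → 24 ≤ x → 128 * (2 + M) ≤ x ^ 6
  -- Indeed 128(2 + 2²⁰) = 134217984 is below 24⁶ = 191102976; 24 is the value of 6n at n = 4, where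
  -- the inductive step starts.
  128[2+M]≤x^6 x 24≤x = ≤-trans (ℕₚ.≤ᵇ⇒≤ (128 * (2 + 2 ^ 20)) (24 ^ 6) tt) (ℕₚ.^-monoˡ-≤ 6 24≤x)

-- The inductive step and its constants

0<scale : ∀ n → 0 < scale (suc n)
0<scale n = ℕₚ.m^n>0 (6 * suc n) (7 * suc n)

-- The reciprocal of the mixing weight η, chosen so that 4η is exactly the gain in `balanced-gain`.
step-denominator : ℕ → ℕ
step-denominator q = 4 * ((1 + q) * (8 * (4 * (2 + M))))

-- Passing from n - 1 to n = 4 + q points gains a factor (6n)⁷: one power pays for 1 + q, the other
-- six for 128(2 + M).
scale-step : ∀ q → step-denominator q * scale (3 + q) ≤ scale (4 + q)
scale-step q = begin
  4 * ((1 + q) * (8 * (4 * (2 + M)))) * scale (3 + q)   ≤⟨ *-mono-≤ den pow ⟩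
  x ^ 7 * x ^ (7 * (3 + q))                             ≡⟨ sym (ℕₚ.^-distribˡ-+-* x 7 (7 * (3 + q))) ⟩
  x ^ (7 + 7 * (3 + q))                                 ≡⟨ cong (x ^_) (sym (ℕₚ.*-suc 7 (3 + q))) ⟩
  x ^ (7 * (4 + q))                                     ∎
  where
  open ℕₚ.≤-Reasoning
  x = 6 * (4 + q)
  den : 4 * ((1 + q) * (8 * (4 * (2 + M)))) ≤ x ^ 7
  den = begin
    4 * ((1 + q) * (8 * (4 * (2 + M))))   ≡⟨ e q M ⟩
    (1 + q) * (128 * (2 + M))             ≤⟨ *-mono-≤ 1+q≤x (128[2+M]≤x^6 x (ℕₚ.*-monoʳ-≤ 6 (m≤m+n 4 q))) ⟩
    x * x ^ 6                             ∎
    where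
    e : ∀ q M → 4 * ((1 + q) * (8 * (4 * (2 + M)))) ≡ (1 + q) * (128 * (2 + M))
    e = solve-∀
    1+q≤x : 1 + q ≤ x
    1+q≤x = ≤-trans (m≤n+m (1 + q) 3) (ℕₚ.m≤n*m (4 + q) 6)
  pow : scale (3 + q) ≤ x ^ (7 * (3 + q))
  pow = ℕₚ.^-monoˡ-≤ (7 * (3 + q)) (ℕₚ.*-monoʳ-≤ 6 (ℕₚ.n≤1+n (3 + q)))

frac-1-anti : ∀ {a b} → 0 < a → a ≤ b → frac 1 b ℚ.≤ frac 1 a
frac-1-anti {a} {b} 0<a a≤b = frac-cross 1 b 1 a (≤-trans 0<a a≤b) 0<a (≤-trans (≤-reflexive (ℕₚ.*-identityˡ a)) (≤-trans a≤b (≤-reflexive (sym (ℕₚ.*-identityˡ b)))))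

-- At an unseparated place the balanced strategy alone gains 4η. Otherwise it still earns at least
-- 1, and the contracted strategy, played with weight η, contributes the gain η·x.
advantage-step : ∀ q N → Advantage (1 + q) ⌊log₂ N ⌋ → Advantage (2 + q) N
advantage-step q N (B , wins) = A , λ s v P → ℚₚ.≤-trans (ℚₚ.+-monoʳ-≤ 1ℚ shrink)
    (subst (1ℚ ℚ.+ η ℚ.* x ℚ.≤_) (sym (mixture-payoff η 0≤η η≤1 (balanced q) B̂ v)) (gain s v P (scan q (logs s))))
  where
  D F : ℕ
  D = step-denominator q
  -- By definition this is also 1 plus the iterated logarithm in the hypothesis on `B`, one
  -- logarithm having been taken already.
  F = 1 + iter⌊log₂⌋ (2 + q) N
  η x : ℚ
  η = frac 1 D
  x = frac 1 (scale (3 + q)) ℚ.* frac 1 F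
  0<D : 0 < D
  0<D = s≤s z≤n
  0≤η : 0ℚ ℚ.≤ η
  0≤η = 0≤frac 1 D
  η≤½ : η ℚ.≤ ½
  η≤½ = frac-1-anti {2} {D} (s≤s z≤n) (≤-trans (s≤s (s≤s z≤n)) (ℕₚ.m≤m*n 4 ((1 + q) * (8 * (4 * (2 + M))))))
  η≤1 : η ℚ.≤ 1ℚ
  η≤1 = frac≤1 1 D 0<D
  x≤1 : x ℚ.≤ 1ℚ
  x≤1 = subst (ℚ._≤ 1ℚ) (sym (frac-* (scale (3 + q)) F (0<scale (2 + q)) (s≤s z≤n)))
    (frac≤1 1 (scale (3 + q) * F) (*-mono-≤ (0<scale (2 + q)) (s≤s z≤n)))
  B̂ = contracted (suc ⌊log₂ N ⌋) B
  A = mixture η 0≤η η≤1 (balanced q) B̂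
  shrink : frac 1 (scale (4 + q)) ℚ.* frac 1 F ℚ.≤ η ℚ.* x
  shrink = begin
    frac 1 (scale (4 + q)) ℚ.* frac 1 F
      ≤⟨ ℚₚ.*-monoʳ-≤-nonNeg (frac 1 F) {{ℚ.nonNegative (0≤frac 1 F)}}
           (frac-1-anti {D * scale (3 + q)} (*-mono-≤ 0<D (0<scale (2 + q))) (scale-step q)) ⟩
    frac 1 (D * scale (3 + q)) ℚ.* frac 1 F
      ≡⟨ cong (ℚ._* frac 1 F) (sym (frac-* D (scale (3 + q)) 0<D (0<scale (2 + q)))) ⟩
    η ℚ.* frac 1 (scale (3 + q)) ℚ.* frac 1 F
      ≡⟨ ℚₚ.*-assoc η (frac 1 (scale (3 + q))) (frac 1 F) ⟩
    η ℚ.* x ∎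
    where open ℚₚ.≤-Reasoning
  4η≤ : η ℚ.+ η ℚ.+ (η ℚ.+ η) ℚ.≤ inv (ι (1 + q)) ℚ.* (⅛ ℚ.* frac 1 (4 * (2 + M)))
  4η≤ = begin
    η ℚ.+ η ℚ.+ (η ℚ.+ η)
      ≡⟨ sym (trans (frac-+ 2 2 D) (cong₂ ℚ._+_ (frac-+ 1 1 D) (frac-+ 1 1 D))) ⟩
    frac 4 D
      ≤⟨ frac-cross 4 D 1 E 0<D (s≤s z≤n) (≤-reflexive (sym (ℕₚ.*-identityˡ D))) ⟩
    frac 1 E
      ≡⟨ sym (trans (cong (frac 1 (1 + q) ℚ.*_) (frac-* 8 (4 * (2 + M)) (s≤s z≤n) (s≤s z≤n))) (frac-* (1 + q) (8 * (4 * (2 + M))) (s≤s z≤n) (s≤s z≤n))) ⟩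
    frac 1 (1 + q) ℚ.* (⅛ ℚ.* frac 1 (4 * (2 + M)))
      ≡⟨ cong (ℚ._* (⅛ ℚ.* frac 1 (4 * (2 + M)))) (ℚₚ.*-identityˡ (inv (ι (1 + q)))) ⟩
    inv (ι (1 + q)) ℚ.* (⅛ ℚ.* frac 1 (4 * (2 + M))) ∎
    where
    open ℚₚ.≤-Reasoning
    E = (1 + q) * (8 * (4 * (2 + M)))
  gain : ∀ s v → Play (4 + q) N s v → _ → 1ℚ ℚ.+ η ℚ.* x ℚ.≤ (1ℚ ℚ.- η) ℚ.* payoff (balanced q) v ℚ.+ η ℚ.* payoff B̂ v
  gain s v P (inj₁ (j , j<1+q , h , h′)) =
    mixture-gainˡ η x (payoff (balanced q) v) (payoff B̂ v) 0≤η η≤½ x≤1 (payoff-nonneg B̂ v)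
      (ℚₚ.≤-trans (ℚₚ.+-monoʳ-≤ 1ℚ 4η≤) (balanced-gain M P j j<1+q
        (Sum.map (⌊log₂⌋-<20 0<b 0<a) (⌊log₂⌋-<20 0<c 0<b) h , Sum.map (⌊log₂⌋-<20 0<b 0<c) (⌊log₂⌋-<20 0<a 0<b) h′)))
    where
    3+j<n = ℕₚ.+-monoʳ-≤ 3 j<1+q
    0<c : 0 < gap s (2 + j)
    0<c = ≤-trans (s≤s z≤n) (20≤gap P (2 + j) 3+j<n)
    0<b : 0 < gap s (1 + j)
    0<b = ≤-trans (s≤s z≤n) (20≤gap P (1 + j) (<⇒≤ 3+j<n))
    0<a : 0 < gap s j
    0<a = ≤-trans (s≤s z≤n) (20≤gap P j (<⇒≤ (<⇒≤ 3+j<n)))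
  gain s v P (inj₂ (inj₁ up)) =
    mixture-gainʳ η x (payoff (balanced q) v) (payoff B̂ v) 0≤η η≤1 (balanced≥1 P)
      (ℚₚ.≤-trans (wins (logs s) (λ g → logs (v (suc g))) P′) (contracted-growing {C = suc ⌊log₂ N ⌋} {v = v} B (s≤s (s≤s (s≤s z≤n))) P′))
    where
    P′ = growing-play P (λ l h → up l (s≤s⁻¹ h))
  gain s v P (inj₂ (inj₂ down)) =
    mixture-gainʳ η x (payoff (balanced q) v) (payoff B̂ v) 0≤η η≤1 (balanced≥1 P)
      (ℚₚ.≤-trans (wins _ (λ g j → suc ⌊log₂ N ⌋ ∸ logs (v g) j) P′) (contracted-shrinking {C = suc ⌊log₂ N ⌋} {v = v} B (s≤s (s≤s (s≤s z≤n))) P′))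
    where
    P′ = shrinking-play P (λ l h → down l (s≤s⁻¹ h))

-- Base cases: two and three points

scale-bonus≤ : ∀ n F d → 0 < d → d ≤ scale (suc n) → frac 1 (scale (suc n)) ℚ.* frac 1 (1 + F) ℚ.≤ frac 1 (d * (1 + F))
scale-bonus≤ n F d 0<d d≤ = ℚₚ.≤-trans (ℚₚ.≤-reflexive (frac-* (scale (suc n)) (1 + F) (0<scale n) (s≤s z≤n)))
  (frac-1-anti {d * (1 + F)} (*-mono-≤ 0<d (s≤s z≤n)) (ℕₚ.*-monoˡ-≤ (1 + F) d≤))

frac-complement : ∀ h d → h ≤ d → 0ℚ ℚ.≤ 1ℚ ℚ.- frac h d
frac-complement h d h≤d = p≤q⇒0≤q-p (frac≤1 h d h≤d)

advantage-two : ∀ N → Advantage 0 N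
advantage-two N = A , wins
  where
  -- A perturbation can raise the number shown to N + 1; inputs beyond that, which no play produces,
  -- are capped.
  R = 1 + N
  w : ℕ → ℕ → ℚ
  w x 0 = frac (x ⊓ R) R
  w x 1 = 1ℚ ℚ.- frac (x ⊓ R) R
  w x (suc (suc _)) = 0ℚ
  pos : ∀ x i → 0ℚ ℚ.≤ w x i
  pos x 0 = 0≤frac (x ⊓ R) R
  pos x 1 = frac-complement (x ⊓ R) R (ℕₚ.m⊓n≤n x R)
  pos x (suc (suc _)) = ℚₚ.≤-refl
  out : ∀ x i → 2 ≤ i → w x i ≡ 0ℚ
  out x (suc (suc _)) _ = refl
  out x (suc zero) (s≤s ())
  A : Strategy 2
  A = record
    { weight  = λ x → w (x 0)
    ; nonneg  = λ x → pos (x 0)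
    ; outside = λ x → out (x 0)
    ; norm    = λ x → solve 1 (λ u → u :+ (con 1ℚ :- u :+ con 0ℚ) := con 1ℚ) refl (frac (x 0 ⊓ R) R)
    }
    where open +-*-Solver
  wins : ∀ s v → Play 2 N s v → 1ℚ ℚ.+ frac 1 (scale 2) ℚ.* frac 1 R ℚ.≤ payoff A v
  wins s v P = begin
    1ℚ ℚ.+ frac 1 (scale 2) ℚ.* frac 1 R
      ≤⟨ ℚₚ.+-monoʳ-≤ 1ℚ (scale-bonus≤ 1 N 1 (s≤s z≤n) (0<scale 1)) ⟩
    1ℚ ℚ.+ frac 1 (1 * R)
      ≡⟨ cong (λ r → 1ℚ ℚ.+ frac 1 r) (ℕₚ.*-identityˡ R) ⟩
    1ℚ ℚ.+ frac 1 R
      ≡⟨ solve 2 (λ b x → con 1ℚ :+ b := b :+ x :+ (con 1ℚ :- x)) refl (frac 1 R) (frac (v 1 0 ⊓ R) R) ⟩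
    frac 1 R ℚ.+ frac (v 1 0 ⊓ R) R ℚ.+ (1ℚ ℚ.- frac (v 1 0 ⊓ R) R)
      ≤⟨ ℚₚ.+-monoˡ-≤ (1ℚ ℚ.- frac (v 1 0 ⊓ R) R) (ℚₚ.≤-trans (ℚₚ.≤-reflexive (sym (frac-+ 1 (v 1 0 ⊓ R) R))) (frac-mono {1 + v 1 0 ⊓ R} {v 0 0 ⊓ R} R apart)) ⟩
    frac (v 0 0 ⊓ R) R ℚ.+ (1ℚ ℚ.- frac (v 1 0 ⊓ R) R)
      ≡⟨ solve 2 (λ x y → x :+ (con 1ℚ :- y) := x :+ (con 1ℚ :- y :+ con 0ℚ)) refl (frac (v 0 0 ⊓ R) R) (frac (v 1 0 ⊓ R) R) ⟩
    payoff A v ∎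
    where
    open ℚₚ.≤-Reasoning
    open +-*-Solver
    near₀ : Near (v 0 0) (s 1)
    near₀ = Play.close P 0 0 (s≤s z≤n) (s≤s (s≤s z≤n))
    near₁ : Near (v 1 0) (s 0)
    near₁ = Play.close P 1 0 (s≤s (s≤s z≤n)) (s≤s (s≤s z≤n))
    below : 1 + v 1 0 ≤ v 0 0
    below = near-< near₁ near₀ (Play.apart P 0 (s≤s (s≤s z≤n)))
    v₀₀≤R : v 0 0 ≤ R
    v₀₀≤R = ≤-trans (proj₁ near₀) (s≤s (Play.upper P 1 (s≤s (s≤s z≤n))))
    apart : 1 + v 1 0 ⊓ R ≤ v 0 0 ⊓ R
    apart = ≤-trans (s≤s (ℕₚ.m⊓n≤m (v 1 0) R)) (≤-trans below (≤-reflexive (sym (ℕₚ.m≤n⇒m⊓n≡m v₀₀≤R))))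

-- Squaring the gap doubles the resolution of the truncated logarithm.
log² : ℕ → ℕ
log² h = ⌊log₂ h * h ⌋

-- The spacing leaves 2YZ ≤ X² despite the perturbation, hence 4Y²Z² ≤ X⁴. The factor 4 outweighs
-- the truncation in the two copies of `log² X`, each of which loses a factor less than 2.
log²-concave : ∀ {a b X Y Z} → 20 ≤ a → 20 ≤ b → a + b ≤ 2 + X → 0 < Y → Y ≤ 2 + a → 0 < Z → Z ≤ 2 + b →
  1 + (log² Y + log² Z) ≤ log² X + log² X
log²-concave {a} {b} {X} {Y} {Z} 20≤a 20≤b a+b≤ 0<Y Y≤ 0<Z Z≤ = ℕₚ.≰⇒> λ h → ℕₚ.<-irrefl refl (begin-strict
  2 ^ (2 + (y + z))                      ≡⟨ cong (λ w → 2 * (2 * w)) (ℕₚ.^-distribˡ-+-* 2 y z) ⟩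
  2 * (2 * (2 ^ y * 2 ^ z))              ≤⟨ ℕₚ.*-monoʳ-≤ 2 (ℕₚ.*-monoʳ-≤ 2 (*-mono-≤ (2^⌊log₂n⌋≤n (Y * Y) (*-mono-≤ 0<Y 0<Y)) (2^⌊log₂n⌋≤n (Z * Z) (*-mono-≤ 0<Z 0<Z)))) ⟩
  2 * (2 * (Y * Y * (Z * Z)))            ≡⟨ square Y Z ⟩
  2 * (Y * Z) * (2 * (Y * Z))            ≤⟨ *-mono-≤ product product ⟩
  X * X * (X * X)                        <⟨ ℕₚ.*-mono-< X²< X²< ⟩
  2 ^ (1 + x) * 2 ^ (1 + x)              ≡⟨ sym (ℕₚ.^-distribˡ-+-* 2 (1 + x) (1 + x)) ⟩
  2 ^ (1 + x + (1 + x))                  ≤⟨ ℕₚ.^-monoʳ-≤ 2 (≤-trans (≤-reflexive (cong suc (ℕₚ.+-suc x x))) (s≤s (s≤s h))) ⟩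
  2 ^ (2 + (y + z))                      ∎)
  where
  open ℕₚ.≤-Reasoning
  x = log² X
  y = log² Y
  z = log² Z
  p = a ∸ 20
  r = b ∸ 20
  square : ∀ Y Z → 2 * (2 * (Y * Y * (Z * Z))) ≡ 2 * (Y * Z) * (2 * (Y * Z))
  square = solve-∀
  20+p : 20 + p ≡ a
  20+p = ℕₚ.m+[n∸m]≡n 20≤a
  20+r : 20 + r ≡ b
  20+r = ℕₚ.m+[n∸m]≡n 20≤b
  X≥ : 38 + p + r ≤ X
  X≥ = ℕₚ.+-cancelˡ-≤ 2 _ _ (≤-trans (≤-reflexive (trans (e p r) (cong₂ _+_ 20+p 20+r))) a+b≤)
    where
    e : ∀ p r → 2 + (38 + p + r) ≡ 20 + p + (20 + r)
    e = solve-∀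
  product : 2 * (Y * Z) ≤ X * X
  product = begin
    2 * (Y * Z)                               ≤⟨ ℕₚ.*-monoʳ-≤ 2 (*-mono-≤ Y≤ Z≤) ⟩
    2 * ((2 + a) * (2 + b))                   ≡⟨ cong₂ (λ a b → 2 * ((2 + a) * (2 + b))) (sym 20+p) (sym 20+r) ⟩
    2 * ((22 + p) * (22 + r))                 ≤⟨ m≤m+n _ (476 + 32 * p + 32 * r + p * p + r * r) ⟩
    2 * ((22 + p) * (22 + r)) + (476 + 32 * p + 32 * r + p * p + r * r) ≡⟨ e p r ⟩
    (38 + p + r) * (38 + p + r)               ≤⟨ *-mono-≤ X≥ X≥ ⟩
    X * X                                     ∎
    where
    e : ∀ p r → 2 * ((22 + p) * (22 + r)) + (476 + 32 * p + 32 * r + p * p + r * r) ≡ (38 + p + r) * (38 + p + r)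
    e = solve-∀
  0<X : 0 < X
  0<X = ≤-trans (s≤s z≤n) X≥
  X²< : X * X < 2 ^ (1 + x)
  X²< = n<2^[1+⌊log₂n⌋] (X * X) (*-mono-≤ 0<X 0<X)

-- The payoff is 1 + u(v 1) - (u(v 0) + u(v 2))/2. Deleting the middle point shows the sum of the
-- two gaps that the other deletions show singly, so concavity yields a gain of 1/(2R).
advantage-three : ∀ N → Advantage 1 N
advantage-three N = A , wins
  where
  F = ⌊log₂ N ⌋
  -- A visible gap is at most N + 1 ≤ 2^(1 + F), so its `log²` is at most R.
  R = 2 * (1 + F)
  0<R : 0 < R
  0<R = s≤s z≤n
  u : (ℕ → ℕ) → ℚ
  u x = frac (log² (gap x 0) ⊓ R) R
  w : (ℕ → ℕ) → ℕ → ℚ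
  w x 0 = ½ ℚ.* (1ℚ ℚ.- u x)
  w x 1 = u x
  w x 2 = ½ ℚ.* (1ℚ ℚ.- u x)
  w x (suc (suc (suc _))) = 0ℚ
  0≤½[1-u] : ∀ x → 0ℚ ℚ.≤ ½ ℚ.* (1ℚ ℚ.- u x)
  0≤½[1-u] x = 0≤* 0≤½ (frac-complement (log² (gap x 0) ⊓ R) R (ℕₚ.m⊓n≤n (log² (gap x 0)) R))
  pos : ∀ x i → 0ℚ ℚ.≤ w x i
  pos x 0 = 0≤½[1-u] x
  pos x 1 = 0≤frac (log² (gap x 0) ⊓ R) R
  pos x 2 = 0≤½[1-u] x
  pos x (suc (suc (suc _))) = ℚₚ.≤-refl
  out : ∀ x i → 3 ≤ i → w x i ≡ 0ℚ
  out x (suc (suc (suc _))) _ = refl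
  out x (suc zero) (s≤s ())
  out x (suc (suc zero)) (s≤s (s≤s ()))
  A : Strategy 3
  A = record
    { weight  = w
    ; nonneg  = pos
    ; outside = out
    ; norm    = λ x → solve 1 (λ u → con ½ :* (con 1ℚ :- u) :+ (u :+ (con ½ :* (con 1ℚ :- u) :+ con 0ℚ)) := con 1ℚ) refl (u x)
    }
    where open +-*-Solver
  wins : ∀ s v → Play 3 N s v → 1ℚ ℚ.+ frac 1 (scale 3) ℚ.* frac 1 (1 + F) ℚ.≤ payoff A v
  wins s v P = begin
    1ℚ ℚ.+ frac 1 (scale 3) ℚ.* frac 1 (1 + F)
      ≤⟨ ℚₚ.+-monoʳ-≤ 1ℚ (scale-bonus≤ 2 F 4 (s≤s z≤n) (≤-trans (ℕₚ.m≤m+n 4 14) (ℕₚ.^-monoʳ-≤ 18 {1} {21} (s≤s z≤n)))) ⟩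
    1ℚ ℚ.+ frac 1 (4 * (1 + F))
      ≡⟨ cong (1ℚ ℚ.+_) (sym (trans (frac-* 2 R (s≤s z≤n) 0<R) (cong (frac 1) (e F)))) ⟩
    1ℚ ℚ.+ ½ ℚ.* frac 1 R
      ≡⟨ solve 3 (λ b y z → con 1ℚ :+ con ½ :* b := con 1ℚ :- con ½ :* (y :+ z) :+ con ½ :* (b :+ (y :+ z))) refl (frac 1 R) (u (v 2)) (u (v 0)) ⟩
    1ℚ ℚ.- ½ ℚ.* (u (v 2) ℚ.+ u (v 0)) ℚ.+ ½ ℚ.* (frac 1 R ℚ.+ (u (v 2) ℚ.+ u (v 0)))
      ≤⟨ ℚₚ.+-monoʳ-≤ (1ℚ ℚ.- ½ ℚ.* (u (v 2) ℚ.+ u (v 0))) (*-monoˡ _ (u (v 1) ℚ.+ u (v 1)) 0≤½ concave) ⟩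
    1ℚ ℚ.- ½ ℚ.* (u (v 2) ℚ.+ u (v 0)) ℚ.+ ½ ℚ.* (u (v 1) ℚ.+ u (v 1))
      ≡⟨ solve 3 (λ x y z → con 1ℚ :- con ½ :* (y :+ z) :+ con ½ :* (x :+ x) :=
           con ½ :* (con 1ℚ :- z) :+ (x :+ (con ½ :* (con 1ℚ :- y) :+ con 0ℚ))) refl (u (v 1)) (u (v 2)) (u (v 0)) ⟩
    payoff A v ∎
    where
    open ℚₚ.≤-Reasoning
    open +-*-Solver using (solve; _:=_; _:+_; _:*_; _:-_; con)
    e : ∀ F → 2 * (2 * (1 + F)) ≡ 4 * (1 + F)
    e = solve-∀
    0<3 : 0 < 3
    0<3 = s≤s z≤n
    1<3 : 1 < 3
    1<3 = s≤s (s≤s z≤n)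
    2<3 : 2 < 3
    2<3 = s≤s (s≤s (s≤s z≤n))
    sa = s+gap P 0 1<3
    sb = s+gap P 1 2<3
    ng₀ = near-gap (Play.close P 0 0 0<3 1<3) (Play.close P 0 1 0<3 2<3) sb
    ng₁ = near-gap (Play.close P 1 0 1<3 1<3) (Play.close P 1 1 1<3 2<3)
            (trans (sym (ℕₚ.+-assoc (s 0) (gap s 0) (gap s 1))) (trans (cong (_+ gap s 1) sa) sb))
    ng₂ = near-gap (Play.close P 2 0 2<3 1<3) (Play.close P 2 1 2<3 2<3) sa
    20≤a = 20≤gap P 0 1<3
    20≤b = 20≤gap P 1 2<3
    pos′ : ∀ {x y} → 20 ≤ x → x ≤ 2 + y → 0 < y
    pos′ h h′ = ≤-trans (s≤s z≤n) (s≤s⁻¹ (s≤s⁻¹ (≤-trans h h′)))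
    0<N : 0 < N
    0<N = ≤-trans (Play.lower P 0 0<3) (Play.upper P 0 0<3)
    small : ∀ i → i < 3 → log² (gap (v i) 0) ≤ R
    small i i<3 = ≤-trans (⌊log₂⌋-mono-≤ (≤-trans (*-mono-≤ h≤ h≤) (≤-reflexive (trans (sym (ℕₚ.^-distribˡ-+-* 2 (1 + F) (1 + F))) (cong (λ r → 2 ^ (1 + F + r)) (sym (ℕₚ.+-identityʳ (1 + F))))))))
      (≤-reflexive (⌊log₂[2^n]⌋≡n R))
      where
      top : skip i 1 < 3
      top = s≤s (skip≤ i 1)
      h≤ : gap (v i) 0 ≤ 2 ^ (1 + F)
      h≤ = ≤-trans (ℕₚ.m∸n≤m (v i 1) (v i 0)) (≤-trans (proj₁ (Play.close P i 1 i<3 2<3)) (≤-trans (s≤s (Play.upper P (skip i 1) top)) (n<2^[1+⌊log₂n⌋] N 0<N)))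
    u≡ : ∀ i → i < 3 → u (v i) ≡ frac (log² (gap (v i) 0)) R
    u≡ i i<3 = cong (λ k → frac k R) (ℕₚ.m≤n⇒m⊓n≡m (small i i<3))
    concave : frac 1 R ℚ.+ (u (v 2) ℚ.+ u (v 0)) ℚ.≤ u (v 1) ℚ.+ u (v 1)
    concave = begin
      frac 1 R ℚ.+ (u (v 2) ℚ.+ u (v 0))
        ≡⟨ cong (frac 1 R ℚ.+_) (cong₂ ℚ._+_ (u≡ 2 2<3) (u≡ 0 0<3)) ⟩
      frac 1 R ℚ.+ (frac y R ℚ.+ frac z R)
        ≡⟨ sym (trans (frac-+ 1 (y + z) R) (cong (frac 1 R ℚ.+_) (frac-+ y z R))) ⟩
      frac (1 + (y + z)) R
        ≤⟨ frac-mono {1 + (y + z)} {x + x} R (log²-concave 20≤a 20≤b (proj₂ ng₁) (pos′ 20≤a (proj₂ ng₂)) (proj₁ ng₂) (pos′ 20≤b (proj₂ ng₀)) (proj₁ ng₀)) ⟩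
      frac (x + x) R
        ≡⟨ trans (frac-+ x x R) (sym (cong₂ ℚ._+_ (u≡ 1 1<3) (u≡ 1 1<3))) ⟩
      u (v 1) ℚ.+ u (v 1) ∎
      where
      x = log² (gap (v 1) 0)
      y = log² (gap (v 2) 0)
      z = log² (gap (v 0) 0)

advantage : ∀ m N → Advantage m N
advantage zero          N = advantage-two N
advantage (suc zero)    N = advantage-three N
advantage (suc (suc q)) N = advantage-step q N (advantage (suc q) ⌊log₂ N ⌋)

-- Real logarithms

⌊log₂⌋-shift : ∀ e y → 0 < y → e + ⌊log₂ y ⌋ ≤ ⌊log₂ 2 ^ e * y ⌋
⌊log₂⌋-shift zero    y 0<y = ⌊log₂⌋-mono-≤ (≤-reflexive (sym (ℕₚ.*-identityˡ y)))
⌊log₂⌋-shift (suc e) y 0<y = ≤-trans (s≤s (⌊log₂⌋-shift e y 0<y))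
  (≤-reflexive (trans (sym (⌊log₂[2*b]⌋≡1+⌊log₂b⌋ (2 ^ e * y) {{>-nonZero (*-mono-≤ (ℕₚ.m^n>0 2 e) 0<y)}})) (cong ⌊log₂_⌋ (sym (ℕₚ.*-assoc 2 (2 ^ e) y)))))

-- With ι X = p/q and e = ⌊log₂ X⌋, the bound Xq ≤ p gives 2^(eb)·q^b ≤ p^b. A factor 2^(eb) raises
-- the truncated logarithm by at least eb, so truncation costs nothing.
⌊log₂⌋≤log-approx : ∀ b .{{_ : NonZero b}} X → 0 < X → ι ⌊log₂ X ⌋ ℚ.≤ log-approx b (ι X)
⌊log₂⌋≤log-approx b X 0<X = +-cancelʳ-≤ (frac B b) (begin
  ι e ℚ.+ frac B b                        ≡⟨ cong (ℚ._+ frac B b) (sym unfrac) ⟩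
  frac (e * b) b ℚ.+ frac B b             ≡⟨ sym (frac-+ (e * b) B b) ⟩
  frac (e * b + B) b                      ≤⟨ frac-mono {e * b + B} {A} b integral ⟩
  frac A b                                ≡⟨ solve 2 (λ x y → x := x :- y :+ y) refl (frac A b) (frac B b) ⟩
  frac A b ℚ.- frac B b ℚ.+ frac B b      ≡⟨ cong (ℚ._+ frac B b) (sym (cong₂ ℚ._-_ (/-inv A b) (/-inv B b))) ⟩
  log-approx b (ι X) ℚ.+ frac B b         ∎)
  where
  open ℚₚ.≤-Reasoning
  open +-*-Solver
  e = ⌊log₂ X ⌋
  p = ℤ.∣ ↥ ι X ∣
  q = ↧ₙ (ι X)
  A = ⌊log₂ p ^ b ⌋
  B = ⌊log₂ q ^ b ⌋
  unfrac : frac (e * b) b ≡ ι e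
  unfrac = trans (cong (ℚ._* inv (ι b)) (ι-* e b)) (trans (ℚₚ.*-assoc (ι e) (ι b) (inv (ι b)))
    (trans (cong (ι e ℚ.*_) (frac-self b (>-nonZero⁻¹ b))) (ℚₚ.*-identityʳ (ι e))))
  Xq≤p : X * q ≤ p
  Xq≤p = ι-cancel-≤ {X * q} {p} (ℚₚ.≤-reflexive (trans (ι-* X q) (numerator-eq (ι X) (0<ι 0<X))))
  0<q^b : 0 < q ^ b
  0<q^b = ℕₚ.m^n>0 q {{>-nonZero (0<denominator (ι X))}} b
  integral : e * b + B ≤ A
  integral = ≤-trans (⌊log₂⌋-shift (e * b) (q ^ b) 0<q^b) (⌊log₂⌋-mono-≤ (ℕR.begin
    2 ^ (e * b) * q ^ b       ℕR.≡⟨ cong (_* q ^ b) (sym (ℕₚ.^-*-assoc 2 e b)) ⟩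
    (2 ^ e) ^ b * q ^ b       ℕR.≡⟨ sym (^-distribʳ-* (2 ^ e) q b) ⟩
    (2 ^ e * q) ^ b           ℕR.≤⟨ ℕₚ.^-monoˡ-≤ b (≤-trans (ℕₚ.*-monoˡ-≤ q (2^⌊log₂n⌋≤n X 0<X)) Xq≤p) ⟩
    p ^ b                     ℕR.∎))
    where module ℕR = ℕₚ.≤-Reasoning

-- Turns an additive error 1/(1 + K) into the ratio (1 + K)/K required by `log-approx-≤`; u ≥ 1
-- absorbs the error.
widen : ∀ u v K → 1ℚ ℚ.≤ u → 0ℚ ℚ.< 1ℚ ℚ.+ K → u ℚ.≤ v ℚ.+ inv (1ℚ ℚ.+ K) → u ℚ.* K ℚ.≤ v ℚ.* (1ℚ ℚ.+ K)
widen u v K 1≤u 0<K′ h = +-cancelʳ-≤ 1ℚ (begin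
  u ℚ.* K ℚ.+ 1ℚ                       ≤⟨ ℚₚ.+-monoʳ-≤ (u ℚ.* K) 1≤u ⟩
  u ℚ.* K ℚ.+ u                        ≡⟨ solve 2 (λ u K → u :* K :+ u := u :* (con 1ℚ :+ K)) refl u K ⟩
  u ℚ.* K′                             ≤⟨ ℚₚ.*-monoʳ-≤-nonNeg K′ {{ℚ.nonNegative (ℚₚ.<⇒≤ 0<K′)}} h ⟩
  (v ℚ.+ inv K′) ℚ.* K′                ≡⟨ ℚₚ.*-distribʳ-+ K′ v (inv K′) ⟩
  v ℚ.* K′ ℚ.+ inv K′ ℚ.* K′           ≡⟨ cong (v ℚ.* K′ ℚ.+_) (inv-* {K′} 0<K′) ⟩
  v ℚ.* K′ ℚ.+ 1ℚ                      ∎)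
  where
  open ℚₚ.≤-Reasoning
  open +-*-Solver
  K′ = 1ℚ ℚ.+ K

⌊log₂⌋≤log-approx-close : ∀ X v n k ε → 0 < X → 0 < k → k ≤ n → 0ℚ ℚ.< v → inv (ι k) ℚ.+ inv (ι k) ℚ.+ inv (ι k) ℚ.≤ ε →
  ι X ℚ.≤ v ℚ.+ inv (ι (suc (2 * k))) → ι ⌊log₂ X ⌋ ℚ.≤ log-approx (suc n) v ℚ.+ ε
⌊log₂⌋≤log-approx-close X v n k ε 0<X 0<k k≤n 0<v 3/k≤ε h = begin
  ι ⌊log₂ X ⌋
    ≤⟨ ⌊log₂⌋≤log-approx (suc n) X 0<X ⟩
  log-approx (suc n) (ι X)
    ≤⟨ log-approx-≤ k (suc n) (suc n) (ι X) v 0<k (0<ι 0<X) 0<v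
         (subst (λ K′ → ι X ℚ.* ι (2 * k) ℚ.≤ v ℚ.* K′) (sym 1+K)
           (widen (ι X) v (ι (2 * k)) (ι-mono-≤ {1} {X} 0<X) (subst (0ℚ ℚ.<_) 1+K (0<ι {suc (2 * k)} (s≤s z≤n)))
             (subst (λ K′ → ι X ℚ.≤ v ℚ.+ inv K′) 1+K h))) ⟩
  log-approx (suc n) v ℚ.+ (inv (ι k) ℚ.+ inv (ι (suc n)) ℚ.+ inv (ι (suc n)))
    ≤⟨ ℚₚ.+-monoʳ-≤ (log-approx (suc n) v) (ℚₚ.≤-trans (ℚₚ.+-mono-≤ (ℚₚ.+-monoʳ-≤ (inv (ι k)) small) small) 3/k≤ε) ⟩
  log-approx (suc n) v ℚ.+ ε ∎
  where
  open ℚₚ.≤-Reasoning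
  1+K : ι (suc (2 * k)) ≡ 1ℚ ℚ.+ ι (2 * k)
  1+K = ι-+ 1 (2 * k)
  small : inv (ι (suc n)) ℚ.≤ inv (ι k)
  small = inv-anti {ι k} {ι (suc n)} (0<ι 0<k) (ι-mono-≤ {k} {suc n} (ℕₚ.m≤n⇒m≤1+n k≤n))

⌊log₂⌋≤log₂ : ∀ X x (0<x : 0ℝ <ℝ x) → 0 < X → fromℕ X ≤ℝ x → fromℕ ⌊log₂ X ⌋ ≤ℝ log₂ x 0<x
⌊log₂⌋≤log₂ X x (δ , 0<δ , M₀ , h₀) 0<X X≤x ε 0<ε =
  let k , 0<k , 3/k≤ε = archimedes ε 0<ε
      -- The accuracy 1/(2k + 1) is the one `widen` takes for K = 2k.
      M₁ , h₁ = X≤x (inv (ι (suc (2 * k)))) (0<inv {ι (suc (2 * k))} (0<ι {suc (2 * k)} (s≤s z≤n)))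
  in M₀ ⊔ M₁ ⊔ k , λ n n≥ →
  let n≥₀₁ = ℕₚ.m⊔n≤o⇒m≤o (M₀ ⊔ M₁) k n≥
      n≥₀ = ℕₚ.m⊔n≤o⇒m≤o M₀ M₁ n≥₀₁
      0<xₙ = ℚₚ.<-≤-trans 0<δ (subst (ℚ._≤ seq x n) (ℚₚ.+-identityˡ δ) (h₀ n n≥₀))
  in ⌊log₂⌋≤log-approx-close X (seq x n) n k ε 0<X 0<k (ℕₚ.m⊔n≤o⇒n≤o (M₀ ⊔ M₁) k n≥) 0<xₙ 3/k≤ε (h₁ n (ℕₚ.m⊔n≤o⇒n≤o M₀ M₁ n≥₀₁))

iter⌊log₂⌋-zero : ∀ m → iter⌊log₂⌋ m 0 ≡ 0
iter⌊log₂⌋-zero zero    = refl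
iter⌊log₂⌋-zero (suc m) = iter⌊log₂⌋-zero m

-- The truncated logarithm sends 0 to 0, so a positive last iterate forces all earlier ones to be
-- positive, as the comparison of single logarithms requires.
iter⌊log₂⌋≤iterLog : ∀ m X x d → fromℕ X ≤ℝ x → 0 < iter⌊log₂⌋ m X → fromℕ (iter⌊log₂⌋ m X) ≤ℝ iterLog m x d
iter⌊log₂⌋≤iterLog zero    X x d         X≤x 0<F = X≤x
iter⌊log₂⌋≤iterLog (suc m) X x (0<x , d) X≤x 0<F =
  iter⌊log₂⌋≤iterLog m ⌊log₂ X ⌋ (log₂ x 0<x) d (⌊log₂⌋≤log₂ X x 0<x (positive X 0<F) X≤x) 0<F
  where
  positive : ∀ X → 0 < iter⌊log₂⌋ m ⌊log₂ X ⌋ → 0 < X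
  positive zero    0<F = ⊥-elim (ℕₚ.<-irrefl refl (subst (0 <_) (iter⌊log₂⌋-zero m) 0<F))
  positive (suc _) _   = s≤s z≤n

≤ℝ-refl : ∀ x → x ≤ℝ x
≤ℝ-refl x ε 0<ε = 0 , λ n _ → subst (ℚ._≤ seq x n ℚ.+ ε) (ℚₚ.+-identityʳ (seq x n)) (ℚₚ.+-monoʳ-≤ (seq x n) (ℚₚ.<⇒≤ 0<ε))

-- The source of the constant c = ¼. The approximations l of L satisfy the two bounds only up to ½,
-- so l ≥ ½ and 1 + F ≤ l + 3/2 ≤ 4l. For F = 0 the second bound follows from 1 ≤ L.
quarter-recip : ∀ F L → 1ℝ ≤ℝ L → (0 < F → fromℕ F ≤ℝ L) → ∃ λ T → ∀ t → T ≤ t → ¼ ℚ.* inv (seq L t) ℚ.≤ frac 1 (1 + F)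
quarter-recip F L 1≤L F≤L = T₁ ⊔ T₂ , λ t t≥ → bound t (proj₂ (1≤L ½ 0<½) t (ℕₚ.m⊔n≤o⇒m≤o T₁ T₂ t≥)) (proj₂ (F≤L′ F F≤L) t (ℕₚ.m⊔n≤o⇒n≤o T₁ T₂ t≥))
  where
  open ℚₚ.≤-Reasoning
  0<½ : 0ℚ ℚ.< ½
  0<½ = ℚₚ.positive⁻¹ ½
  F≤L′ : ∀ F → (0 < F → fromℕ F ≤ℝ L) → ∃ λ T → ∀ t → T ≤ t → ι F ℚ.≤ seq L t ℚ.+ ½
  F≤L′ zero    _ = proj₁ (1≤L ½ 0<½) , λ t t≥ → ℚₚ.≤-trans (ℚₚ.<⇒≤ (0<ι {1} (s≤s z≤n))) (proj₂ (1≤L ½ 0<½) t t≥)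
  F≤L′ (suc _) h = h (s≤s z≤n) ½ 0<½
  T₁ = proj₁ (1≤L ½ 0<½)
  T₂ = proj₁ (F≤L′ F F≤L)
  bound : ∀ t → 1ℚ ℚ.≤ seq L t ℚ.+ ½ → ι F ℚ.≤ seq L t ℚ.+ ½ → ¼ ℚ.* inv (seq L t) ℚ.≤ frac 1 (1 + F)
  bound t 1≤ F≤ = begin
    ¼ ℚ.* i                                ≡⟨ sym (ℚₚ.*-identityʳ _) ⟩
    ¼ ℚ.* i ℚ.* 1ℚ                         ≡⟨ cong (¼ ℚ.* i ℚ.*_) (sym (inv-* {ι (1 + F)} (0<ι {1 + F} (s≤s z≤n)))) ⟩
    ¼ ℚ.* i ℚ.* (j ℚ.* ι (1 + F))          ≡⟨ sym (ℚₚ.*-assoc (¼ ℚ.* i) j (ι (1 + F))) ⟩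
    ¼ ℚ.* i ℚ.* j ℚ.* ι (1 + F)            ≤⟨ *-monoˡ _ _ (0≤* (0≤* 0≤¼ (ℚₚ.<⇒≤ (0<inv {l} 0<l))) (0≤inv-ι (1 + F))) 1+F≤4l ⟩
    ¼ ℚ.* i ℚ.* j ℚ.* (l ℚ.+ l ℚ.+ (l ℚ.+ l))
      ≡⟨ solve 3 (λ i j l → con ¼ :* i :* j :* (l :+ l :+ (l :+ l)) := j :* (i :* l)) refl i j l ⟩
    j ℚ.* (i ℚ.* l)                        ≡⟨ cong (j ℚ.*_) (inv-* {l} 0<l) ⟩
    j ℚ.* 1ℚ                               ≡⟨ ℚₚ.*-comm j 1ℚ ⟩
    frac 1 (1 + F)                         ∎
    where
    open +-*-Solver
    l = seq L t
    i = inv l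
    j = inv (ι (1 + F))
    ½≤l : ½ ℚ.≤ l
    ½≤l = +-cancelʳ-≤ ½ {½} {l} 1≤
    0<l : 0ℚ ℚ.< l
    0<l = ℚₚ.<-≤-trans 0<½ ½≤l
    1+F≤4l : ι (1 + F) ℚ.≤ l ℚ.+ l ℚ.+ (l ℚ.+ l)
    1+F≤4l = begin
      ι (1 + F)                        ≡⟨ ι-+ 1 F ⟩
      1ℚ ℚ.+ ι F                       ≤⟨ ℚₚ.+-monoʳ-≤ 1ℚ F≤ ⟩
      1ℚ ℚ.+ (l ℚ.+ ½)                 ≡⟨ solve 1 (λ l → con 1ℚ :+ (l :+ con ½) := con ½ :+ con ½ :+ (l :+ con ½)) refl l ⟩
      ½ ℚ.+ ½ ℚ.+ (l ℚ.+ ½)            ≤⟨ ℚₚ.+-mono-≤ (ℚₚ.+-mono-≤ ½≤l ½≤l) (ℚₚ.+-monoʳ-≤ l ½≤l) ⟩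
      l ℚ.+ l ℚ.+ (l ℚ.+ l)            ∎

-- From vectors to sequences

extend : ∀ {A : Set} {n} → A → (Fin n → A) → ℕ → A
extend {n = zero}  z f i       = z
extend {n = suc n} z f zero    = f Fin.zero
extend {n = suc n} z f (suc i) = extend z (f ∘ Fin.suc) i

extend-toℕ : ∀ {A : Set} {n} (z : A) (f : Fin n → A) i → extend z f (toℕ i) ≡ f i
extend-toℕ z f Fin.zero    = refl
extend-toℕ z f (Fin.suc i) = extend-toℕ z (f ∘ Fin.suc) i

∀Fin⇒∀< : ∀ {n} (Q : ℕ → Set) → (∀ (i : Fin n) → Q (toℕ i)) → ∀ i → i < n → Q i
∀Fin⇒∀< Q h i i<n = subst Q (Finₚ.toℕ-fromℕ< i<n) (h (fromℕ< i<n))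

-- Absolute values leave the positions unchanged, as these are at least 1, and do not increase
-- distances, so nearness survives for shown numbers of either sign.
magnitudes : ∀ {k} → Vec ℤ k → ℕ → ℕ
magnitudes xs = extend 0 (λ i → ℤ.∣ lookup xs i ∣)

toℕ-punchIn : ∀ {n} (i : Fin (suc n)) j → toℕ (punchIn i j) ≡ skip (toℕ i) (toℕ j)
toℕ-punchIn Fin.zero    j           = refl
toℕ-punchIn (Fin.suc i) Fin.zero    = refl
toℕ-punchIn (Fin.suc i) (Fin.suc j) = cong suc (toℕ-punchIn i j)

lookup-removeAt : ∀ {n} (xs : Vec ℤ (suc n)) i j → lookup (removeAt xs i) j ≡ lookup xs (punchIn i j)
lookup-removeAt (x ∷ xs)       Fin.zero    j           = refl
lookup-removeAt (x ∷ xs@(_ ∷ _)) (Fin.suc i) Fin.zero    = refl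
lookup-removeAt (x ∷ xs@(_ ∷ _)) (Fin.suc i) (Fin.suc j) = lookup-removeAt xs i j

∣-∣≤1⇒Near : ∀ x y → ℤ.∣ x ℤ.- y ∣ ≤ 1 → Near ℤ.∣ x ∣ ℤ.∣ y ∣
∣-∣≤1⇒Near x y h = one-sided x y h , one-sided y x (subst (_≤ 1) (ℤₚ.∣i-j∣≡∣j-i∣ x y) h)
  where
  one-sided : ∀ x y → ℤ.∣ x ℤ.- y ∣ ≤ 1 → ℤ.∣ x ∣ ≤ suc ℤ.∣ y ∣
  one-sided x y h = subst (λ z → ℤ.∣ z ∣ ≤ suc ℤ.∣ y ∣) (trans (ℤₚ.+-assoc x (ℤ.- y) y) (trans (cong (ℤ._+_ x) (ℤₚ.+-inverseˡ y)) (ℤₚ.+-identityʳ x)))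
    (≤-trans (ℤₚ.∣i+j∣≤∣i∣+∣j∣ (x ℤ.- y) y) (ℕₚ.+-monoˡ-≤ ℤ.∣ y ∣ h))

module _ {k N} (σ : Adversary k N) where

  positions : ℕ → ℕ
  positions = magnitudes (S σ)

  views : ℕ → ℕ → ℕ
  views = extend (λ _ → 0) (λ i → magnitudes (shown σ i))

  positions-toℕ : ∀ i → int (positions (toℕ i)) ≡ lookup (S σ) i
  positions-toℕ i = trans (cong int (extend-toℕ 0 _ i)) (ℤₚ.0≤i⇒+∣i∣≡i (ℤₚ.≤-trans (ℤ.+≤+ z≤n) (proj₁ (inRange σ i))))

  adversary-play : Play (suc k) N positions views
  adversary-play = record
    { lower = ∀Fin⇒∀< (λ i → 1 ≤ positions i) (λ i → ℤₚ.drop‿+≤+ (subst (int 1 ℤ.≤_) (sym (positions-toℕ i)) (proj₁ (inRange σ i))))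
    ; upper = ∀Fin⇒∀< (λ i → positions i ≤ N) (λ i → ℤₚ.drop‿+≤+ (subst (ℤ._≤ int N) (sym (positions-toℕ i)) (proj₂ (inRange σ i))))
    ; apart = λ i h → ∀Fin⇒∀< (λ i → positions i + 20 ≤ positions (suc i)) step i (s≤s⁻¹ h)
    ; close = λ i j i<n h → ∀Fin⇒∀< (λ i → Near (views i j) (positions (skip i j)))
        (λ i → ∀Fin⇒∀< (λ j → Near (views (toℕ i) j) (positions (skip (toℕ i) j))) (nearby i) j (s≤s⁻¹ h)) i i<n
    }
    where
    step : ∀ (i : Fin k) → positions (toℕ i) + 20 ≤ positions (suc (toℕ i))
    step i = ℤₚ.drop‿+≤+ (subst₂ (λ a b → a ℤ.+ int 20 ℤ.≤ b)
      (trans (sym (positions-toℕ (inject₁ i))) (cong (λ l → int (positions l)) (Finₚ.toℕ-inject₁ i)))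
      (sym (positions-toℕ (Fin.suc i))) (spaced σ i))
    nearby : ∀ (i : Fin (suc k)) (j : Fin k) → Near (views (toℕ i) (toℕ j)) (positions (skip (toℕ i) (toℕ j)))
    nearby i j = subst₂ Near
      (sym (trans (cong (λ f → f (toℕ j)) (extend-toℕ (λ _ → 0) (λ i → magnitudes (shown σ i)) i)) (extend-toℕ 0 _ j)))
      (trans (cong ℤ.∣_∣ (trans (lookup-removeAt (S σ) i j) (sym (positions-toℕ (punchIn i j))))) (cong positions (toℕ-punchIn i j)))
      (∣-∣≤1⇒Near (lookup (shown σ i) j) (lookup (removeAt (S σ) i) j) (near σ i j))

-- Expected rewards

seq-∑ : ∀ {n} (f : Fin n → ℝ) (g : ℕ → ℚ) t → (∀ i → seq (f i) t ≡ g (toℕ i)) → seq (∑ f) t ≡ sumTo n g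
seq-∑ {zero}  f g t h = refl
seq-∑ {suc n} f g t h = cong₂ ℚ._+_ (h Fin.zero) (seq-∑ (f ∘ Fin.suc) (g ∘ suc) t (h ∘ Fin.suc))

seq-∑-zero : ∀ {n} (f : Fin n → ℝ) t → (∀ i → seq (f i) t ≡ 0ℚ) → seq (∑ f) t ≡ 0ℚ
seq-∑-zero {n} f t h = trans (seq-∑ f (λ _ → 0ℚ) t h) (sumTo-zero n)

seq-∑-single : ∀ {n} (f : Fin n → ℝ) i t → (∀ g → g ≢ i → seq (f g) t ≡ 0ℚ) → seq (∑ f) t ≡ seq (f i) t
seq-∑-single f Fin.zero    t h = trans (cong (seq (f Fin.zero) t ℚ.+_) (seq-∑-zero (f ∘ Fin.suc) t (λ i → h (Fin.suc i) (λ ())))) (ℚₚ.+-identityʳ _)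
seq-∑-single f (Fin.suc i) t h = trans (cong₂ ℚ._+_ (h Fin.zero (λ ())) (seq-∑-single (f ∘ Fin.suc) i t (λ g g≢i → h (Fin.suc g) (g≢i ∘ Finₚ.suc-injective)))) (ℚₚ.+-identityˡ _)

seq-if-yes : ∀ {P : Set} (d : Dec P) r t → P → seq (if does d then r else 0ℝ) t ≡ seq r t
seq-if-yes (yes _) r t h = refl
seq-if-yes (no ¬h) r t h = ⊥-elim (¬h h)

seq-if-no : ∀ {P : Set} (d : Dec P) r t → ¬ P → seq (if does d then r else 0ℝ) t ≡ 0ℚ
seq-if-no (yes h) r t ¬h = ⊥-elim (¬h h)
seq-if-no (no _)  r t ¬h = refl

reward-correct : ∀ {n} (p : Distribution n) p>0 i t → seq (reward p p>0 i i) t ≡ inv (seq (prob p i) t)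
reward-correct p p>0 i t = seq-if-yes (i Fin.≟ i) (recip (prob p i) (p>0 i)) t refl

reward-wrong : ∀ {n} (p : Distribution n) p>0 i g t → g ≢ i → seq (reward p p>0 i g) t ≡ 0ℚ
reward-wrong p p>0 i g t = seq-if-no (g Fin.≟ i) (recip (prob p i) (p>0 i)) t

eventually-all : ∀ {n} (Q : Fin n → ℕ → Set) → (∀ i → ∃ λ T → ∀ t → T ≤ t → Q i t) → ∃ λ T → ∀ t → T ≤ t → ∀ i → Q i t
eventually-all {zero}  Q h = 0 , λ _ _ ()
eventually-all {suc n} Q h with h Fin.zero | eventually-all (Q ∘ Fin.suc) (h ∘ Fin.suc)
... | T , h₀ | T′ , hₛ = T ⊔ T′ , λ { t t≥ Fin.zero → h₀ t (ℕₚ.m⊔n≤o⇒m≤o T T′ t≥) ; t t≥ (Fin.suc i) → hₛ t (ℕₚ.m⊔n≤o⇒n≤o T T′ t≥) i }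

distribution : ∀ {n} (w : ℕ → ℚ) → (∀ i → 0ℚ ℚ.≤ w i) → sumTo n w ≡ 1ℚ → Distribution n
distribution {n} w 0≤w Σw≡1 = record
  { prob   = λ i → fromℚ (w (toℕ i))
  ; prob≥0 = λ i ε 0<ε → 0 , λ _ _ → 0≤+ (0≤w (toℕ i)) (ℚₚ.<⇒≤ 0<ε)
  ; total  = (λ ε 0<ε → 0 , λ t _ → subst (ℚ._≤ 1ℚ ℚ.+ ε) (sym (Σ≡1 t)) (above ε 0<ε))
           , (λ ε 0<ε → 0 , λ t _ → subst (λ z → 1ℚ ℚ.≤ z ℚ.+ ε) (sym (Σ≡1 t)) (above ε 0<ε))
  }
  where
  Σ≡1 : ∀ t → seq (∑ {n} (λ i → fromℚ (w (toℕ i)))) t ≡ 1ℚ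
  Σ≡1 t = trans (seq-∑ {n} _ w t (λ _ → refl)) Σw≡1
  above : ∀ ε → 0ℚ ℚ.< ε → 1ℚ ℚ.≤ 1ℚ ℚ.+ ε
  above ε 0<ε = subst (ℚ._≤ 1ℚ ℚ.+ ε) (ℚₚ.+-identityʳ 1ℚ) (ℚₚ.+-monoʳ-≤ 1ℚ (ℚₚ.<⇒≤ 0<ε))

algorithm : ∀ {k} → Strategy (suc k) → Algorithm k
algorithm A xs = distribution (weight A (magnitudes xs)) (nonneg A (magnitudes xs)) (norm A (magnitudes xs))

-- A correct guess earns 1/pᵢ with probability pᵢ, so p cancels.
seq-reward-term : ∀ {n} (p : Distribution n) p>0 (a : Fin n → ℝ) i t → 0ℚ ℚ.< seq (prob p i) t →
  seq (prob p i *ℝ (∑ λ g → a g *ℝ reward p p>0 i g)) t ≡ seq (a i) t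
seq-reward-term {n} p p>0 a i t 0<pᵢ = trans (cong (pᵢ ℚ.*_) (trans single (cong (aᵢ ℚ.*_) (reward-correct p p>0 i t)))) (begin
  pᵢ ℚ.* (aᵢ ℚ.* inv pᵢ)    ≡⟨ solve 3 (λ p a q → p :* (a :* q) := a :* (q :* p)) refl pᵢ aᵢ (inv pᵢ) ⟩
  aᵢ ℚ.* (inv pᵢ ℚ.* pᵢ)    ≡⟨ cong (aᵢ ℚ.*_) (inv-* {pᵢ} 0<pᵢ) ⟩
  aᵢ ℚ.* 1ℚ                 ≡⟨ ℚₚ.*-identityʳ aᵢ ⟩
  aᵢ                        ∎)
  where
  open ≡-Reasoning
  open +-*-Solver
  pᵢ = seq (prob p i) t
  aᵢ = seq (a i) t
  single : seq (∑ λ g → a g *ℝ reward p p>0 i g) t ≡ aᵢ ℚ.* seq (reward p p>0 i i) t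
  single = seq-∑-single (λ g → a g *ℝ reward p p>0 i g) i t
    (λ g g≢i → trans (cong (seq (a g) t ℚ.*_) (reward-wrong p p>0 i g t g≢i)) (ℚₚ.*-zeroʳ (seq (a g) t)))

eventually-positive : ∀ {n} (p : Distribution n) → AllPositive p → ∃ λ T → ∀ t → T ≤ t → ∀ i → 0ℚ ℚ.< seq (prob p i) t
eventually-positive p p>0 = eventually-all (λ i t → 0ℚ ℚ.< seq (prob p i) t) λ i →
  let ε , 0<ε , T , h = p>0 i
  in T , λ t t≥ → ℚₚ.<-≤-trans 0<ε (subst (ℚ._≤ seq (prob p i) t) (ℚₚ.+-identityˡ ε) (h t t≥))

-- The equality is exact at each index t of the approximating sequences: the weights are constant
-- sequences, and a positive approximation of pᵢ cancels against its inverse.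
expectedReward≡payoff : ∀ {k N} (p : Distribution (suc k)) p>0 (A : Strategy (suc k)) (σ : Adversary k N) t →
  (∀ i → 0ℚ ℚ.< seq (prob p i) t) → seq (expectedReward p p>0 (algorithm A) σ) t ≡ payoff A (views σ)
expectedReward≡payoff {k} p p>0 A σ t 0<p =
  seq-∑ (λ i → prob p i *ℝ (∑ λ g → prob (algorithm A (shown σ i)) g *ℝ reward p p>0 i g))
    (λ i → weight A (views σ i) i) t
    (λ i → trans (seq-reward-term p p>0 (prob (algorithm A (shown σ i))) i t (0<p i))
      (cong (λ x → weight A x (toℕ i)) (sym (extend-toℕ (λ _ → 0) (λ i → magnitudes (shown σ i)) i))))

theorem4p1 : Σ ℝ λ c → 0ℝ <ℝ c ×
    ((m N : ℕ) →
    let n = 2 + m in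
    (p : Distribution n) (p>0 : AllPositive p)
    (d : LogDefined m (fromℕ N)) →
    let L = iterLog m (fromℕ N) d in
    (1≤L : 1ℝ ≤ℝ L) →
    Σ (Algorithm (suc m)) λ A →
    (σ : Adversary (suc m) N) →
    1ℝ +ℝ fromℚ (inverse-[6n]^[7n] n) *ℝ (c *ℝ recip L (1≤⇒0< L 1≤L))
    ≤ℝ expectedReward p p>0 A σ)
theorem4p1 = fromℚ ¼ , (¼ , 0<* (ℚₚ.positive⁻¹ ½) (ℚₚ.positive⁻¹ ½) , 0 , λ _ _ → ℚₚ.≤-reflexive (ℚₚ.+-identityˡ ¼)) ,
  λ m N p p>0 d 1≤L →
    let A , wins = advantage m N
        F = iter⌊log₂⌋ m N
        L = iterLog m (fromℕ N) d
        T₁ , small = quarter-recip F L 1≤L (iter⌊log₂⌋≤iterLog m N (fromℕ N) d (≤ℝ-refl (fromℕ N)))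
    in algorithm A , λ σ ε 0<ε →
    let T₂ , 0<p = eventually-positive p p>0
    -- From T₁ on the bound on 1/L holds; from T₂ on all approximations of the pᵢ are positive.
    in T₁ ⊔ T₂ , λ t t≥ → begin
      1ℚ ℚ.+ inverse-[6n]^[7n] (2 + m) ℚ.* (¼ ℚ.* inv (seq L t))
        ≡⟨ cong (λ z → 1ℚ ℚ.+ z ℚ.* (¼ ℚ.* inv (seq L t))) (/-inv 1 (scale (2 + m)) {{>-nonZero (0<scale (1 + m))}}) ⟩
      1ℚ ℚ.+ frac 1 (scale (2 + m)) ℚ.* (¼ ℚ.* inv (seq L t))
        ≤⟨ ℚₚ.+-monoʳ-≤ 1ℚ (*-monoˡ (¼ ℚ.* inv (seq L t)) (frac 1 (1 + F)) (0≤frac 1 (scale (2 + m))) (small t (ℕₚ.m⊔n≤o⇒m≤o T₁ T₂ t≥))) ⟩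
      1ℚ ℚ.+ frac 1 (scale (2 + m)) ℚ.* frac 1 (1 + F)
        ≤⟨ wins (positions σ) (views σ) (adversary-play σ) ⟩
      payoff A (views σ)
        ≡⟨ sym (expectedReward≡payoff p p>0 A σ t (0<p t (ℕₚ.m⊔n≤o⇒n≤o T₁ T₂ t≥))) ⟩
      seq (expectedReward p p>0 (algorithm A) σ) t
        ≡⟨ sym (ℚₚ.+-identityʳ _) ⟩
      seq (expectedReward p p>0 (algorithm A) σ) t ℚ.+ 0ℚ
        ≤⟨ ℚₚ.+-monoʳ-≤ (seq (expectedReward p p>0 (algorithm A) σ) t) (ℚₚ.<⇒≤ 0<ε) ⟩
      seq (expectedReward p p>0 (algorithm A) σ) t ℚ.+ ε ∎
  where open ℚₚ.≤-Reasoning
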